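{- Let $\lambda$ be a shifted pavable partition with 2-quotient $(\mu,\nu)$. Then $$\sum_{T}x^T = Q_{\mu}\,Q_{\nu},$$ where the sum runs over all shifted domino tableaux $T$ of shape $\lambda$.
   Context: Diagrams. A partition is a finite non-increasing sequence of positive integers; its length is its number of parts. The Young diagram of $\lambda=(\lambda_1,\dots,\lambda_\ell)$ is drawn in $\mathbb{R}^2$ with the first row at the bottom: it consists of the unit cells with lower-left corners $(x,y)$, $0\le y<\ell$, $0\le x<\lambda_{y+1}$. For an integer $k$, $D_k$ is the line of equation $Y=X+k$; the cell with lower-left corner $(x,y)$ is cut by the unique diagonal $D_{y-x}$. The part $\mathrm{up}(\lambda)$ consists of the cells cut by $D_k$ with $k>0$; the other cells form $\mathrm{down}(\lambda)$. 2-core and 2-quotient. A domino is a $1\times2$ or $2\times1$ rectangle of cells. The 2-core of $\lambda$ is obtained by successively removing from the diagram dominoes having no cell above them or to their right, until this is no longer possible (the result does not depend on the order). $\lambda$ is pavable if its 2-core is empty. The 2-quotient $(\mu,\nu)$ of $\lambda=(\lambda_1,\dots,\lambda_\ell)$ is defined as follows: let $L$ be the $\ell$-tuple with $L_i=\lambda_i+\ell-i$; let $M$ be obtained from $L$ by replacing, from right to left, the even entries successively by $0,2,4,\dots$ and the odd entries successively by $1,3,5,\dots$; then $\mu$ is the sequence of the values $(L_i-M_i)/2$ over the $i$ with $L_i$ even, and $\nu$ the sequence of these values over the $i$ with $L_i$ odd (zero parts are dropped). Pavings. A paving of a pavable partition $\lambda$ is a tiling of its diagram by dominoes. Each domino is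 cut by exactly one diagonal of even index $D_{2k}$; it is said to be on $D_{2k}$. In a paving, $\mathrm{up}'(\lambda)$ is the set of dominoes on $D_{2k}$ with $k>0$, and $\mathrm{down}'(\lambda)$ is the set of the remaining dominoes. Shifted pavable partitions. A pavable partition $\lambda$ with 2-quotient $(\mu,\nu)$ is a shifted pavable partition if the last part of $\mu$ is at least the length of $\mu$ and the last part of $\nu$ is at least the length of $\nu$ (an empty partition being allowed), and it is considered only with pavings satisfying: there is no vertical domino $d$ on $D_0$ which has adjacent dominoes on its left, all of them belonging to $\mathrm{up}'(\lambda)$. Shifted domino tableaux. A shifted domino tableau of shape $\lambda$ is a paving of $\lambda$ satisfying this last condition, together with a filling of the dominoes of $\mathrm{up}'(\lambda)$ by the symbol $X$ and of the dominoes of $\mathrm{down}'(\lambda)$ by letters of the ordered alphabet $\{1'<1<2'<2<\cdots\}$ such that, disregarding the $X$'s: rows are non-decreasing from left to right and columns are non-decreasing from bottom to top; each unprimed letter appears in at most one domino of each column; each primed letter appears in at most one domino of each row. Two shifted domino tableaux of shape $\lambda$ whose labelled dominoes in $\mathrm{down}'(\lambda)$ coincide are regarded as equal (only the lower part matters). Shifted Young tableaux and Q-Schur functions. For a partition $\mu$ whose last part is at least its length $\ell$ (or $\mu$ empty), a shifted Young tableau of shape $\mu$ is a filling of the cells of $\mathrm{up}(\mu)$ by $X$ and of the cells of $\mathrm{down}(\mu)$ by letters of $\{1'<1<2'<2<\cdots\}$ such that, disregarding the $X$'s: rows are non-decreasing from left to right and columns non-decreasing from bottom to top; each unprimed letter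 appears at most once in each column; each primed letter appears at most once in each row. (Deleting the $X$'s gives a usual shifted tableau on the shifted diagram of the strict partition $(\mu_1,\mu_2-1,\dots,\mu_\ell-\ell+1)$.) For a shifted Young tableau or shifted domino tableau $T$, put $x^T=x_1^{a_1}x_2^{a_2}\cdots$, where $a_i$ is the number of cells (respectively dominoes) of $T$ labelled $i$ or $i'$. Then $Q_\mu=\sum_t x^t$, the sum being over all shifted Young tableaux $t$ of shape $\mu$; equivalently, $Q_\mu$ is the usual Q-Schur function of the strict partition $(\mu_1,\mu_2-1,\dots,\mu_\ell-\ell+1)$. -}

module Defs where

open import Data.Bool.Base using (if_then_else_)
open import Data.Empty using (⊥-elim)
open import Data.Fin.Base using (Fin; zero; suc)
open import Data.Integer.Base as ℤ using (ℤ; 0ℤ; _⊖_)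
import Data.Integer.Properties as ℤ
open import Data.List.Base hiding (sum)
open import Data.Nat.ListAction using (sum)
open import Data.List.Membership.Propositional using (_∈_)
open import Data.List.Membership.Propositional.Properties
open import Data.List.Properties using (filter-none)
open import Data.List.Relation.Binary.Permutation.Propositional using (_↭_)
open import Data.List.Relation.Unary.All as All using (All; []; _∷_)
open import Data.List.Relation.Unary.AllPairs using ([]; _∷_)
open import Data.List.Relation.Unary.Any as Any using (Any; here; there)
open import Data.List.Relation.Unary.Any.Properties using (lookup-index)
open import Data.List.Relation.Unary.Linked using (Linked)
open import Data.List.Relation.Unary.Unique.Propositional using (Unique)
import Data.List.Relation.Unary.Unique.Propositional.Properties as Unique
open import Data.Maybe.Base as Maybe using (Maybe; just; nothing)
open import Data.Maybe using (Is-just)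
import Data.Maybe.Relation.Unary.Any as MaybeAny
open import Data.Nat.Base
open import Data.Nat.Divisibility using (_∣?_)
import Data.Nat.Properties as ℕ
open import Data.Product.Base using (_×_; _,_; proj₁; proj₂; ∃-syntax; ∃₂)
open import Data.Product.Properties using (≡-dec)
open import Data.Sum.Base using (inj₁; inj₂)
open import Data.Unit.Base using (tt)
open import Function.Base using (_∘_; case_of_; _on_)
open import Function.Bundles using (Inverse; _⇔_; mk⇔; Equivalence)
open import Level using (0ℓ)
open import Relation.Binary.Bundles using (Setoid)
open import Relation.Binary.Definitions using (DecidableEquality)
open import Relation.Binary.PropositionalEquality
  using (_≡_; _≢_; refl; sym; trans; cong; subst; setoid)
import Relation.Binary.Construct.On as On
open import Relation.Binary.Construct.Closure.ReflexiveTransitive using (Star)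
open import Relation.Nullary.Decidable using (Dec; yes; no; does; map′; ¬?; _×-dec_; _→-dec_)
open import Relation.Nullary.Negation using (¬_; contradiction)
open import Relation.Unary using (Pred; Decidable)

------------------------------------------------------------------------
-- Diagrams

-- The parts of a partition are listed from λ₁ on, i.e. from the bottom
-- row of the diagram upwards.

record IsPartition (sh : List ℕ) : Set where
  field
    nonIncreasing : Linked _≥_ sh
    positive      : All (0 <_) sh

-- A cell is given by its lower-left corner (x , y).

Cell : Set
Cell = ℕ × ℕ

col row : Cell → ℕ
col = proj₁
row = proj₂

cellsFrom : ℕ → List ℕ → List Cell
cellsFrom y []       = []
cellsFrom y (r ∷ rs) = map (_, y) (upTo r) ++ cellsFrom (suc y) rs

cells : List ℕ → List Cell
cells = cellsFrom 0

diagonal : Cell → ℤ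
diagonal (x , y) = y ⊖ x

InUp : Cell → Set
InUp c = 0ℤ ℤ.< diagonal c

------------------------------------------------------------------------
-- Dominoes

-- A domino is given by its lower-left cell.

data Domino : Set where
  horizontal vertical : Cell → Domino

dominoCells : Domino → List Cell
dominoCells (horizontal (x , y)) = (x , y) ∷ (suc x , y) ∷ []
dominoCells (vertical   (x , y)) = (x , y) ∷ (x , suc y) ∷ []

-- d is on the diagonal D₂ₖ.

On₂ : ℤ → Domino → Set
On₂ k d = Any (λ c → diagonal c ≡ ℤ.+ 2 ℤ.* k) (dominoCells d)

InUp′ : Domino → Set
InUp′ d = ∃[ k ] 0ℤ ℤ.< k × On₂ k d

------------------------------------------------------------------------
-- 2-core and 2-quotient

record Removable (sh : List ℕ) (d : Domino) : Set where
  field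
    inside      : ∀ {c} → c ∈ dominoCells d → c ∈ cells sh
    nothingUp   : ∀ {x y} → (x , y) ∈ dominoCells d →
                  (x , suc y) ∈ cells sh → (x , suc y) ∈ dominoCells d
    nothingNext : ∀ {x y} → (x , y) ∈ dominoCells d →
                  (suc x , y) ∈ cells sh → (suc x , y) ∈ dominoCells d

_⟶_ : List ℕ → List ℕ → Set
sh ⟶ sh' = ∃[ d ] Removable sh d × IsPartition sh' ×
                   (cells sh ↭ dominoCells d ++ cells sh')

IsTwoCore : List ℕ → List ℕ → Set
IsTwoCore sh core = Star _⟶_ sh core × (∀ d → ¬ Removable core d)

Pavable : List ℕ → Set
Pavable sh = IsTwoCore sh []

Even? : Decidable _
Even? = 2 ∣?_

Odd? : Decidable _
Odd? = ¬? ∘ Even?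

-- Lᵢ = λᵢ + ℓ - i: there are ℓ - i parts after λᵢ.

L-sequence : List ℕ → List ℕ
L-sequence []       = []
L-sequence (r ∷ rs) = (r + length rs) ∷ L-sequence rs

-- Read from right to left, the evens become 0, 2, 4, … and the odds
-- 1, 3, 5, …, so an entry's new value is given by the number of entries of
-- the same parity to its right.

M-sequence : List ℕ → List ℕ
M-sequence []       = []
M-sequence (l ∷ ls) =
  (if does (Even? l) then 2 * length (filter Even? ls)
                     else 1 + 2 * length (filter Odd? ls))
  ∷ M-sequence ls

twoQuotient : List ℕ → List ℕ × List ℕ
twoQuotient sh = part Even? , part Odd?
  where
  L = L-sequence sh

  part : ∀ {P : Pred ℕ 0ℓ} → Decidable P → List ℕ
  part P? = filter (0 ℕ.<?_) (map (λ (l , m) → (l ∸ m) / 2)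
                                (filter (P? ∘ proj₁) (zip L (M-sequence L))))

LastPart≥Length : List ℕ → Set
LastPart≥Length sh = ∀ {m} → last sh ≡ just m → length sh ≤ m

record ShiftedPavable (sh : List ℕ) : Set where
  field
    isPartition : IsPartition sh
    pavable     : Pavable sh
    quotient₁   : LastPart≥Length (proj₁ (twoQuotient sh))
    quotient₂   : LastPart≥Length (proj₂ (twoQuotient sh))

------------------------------------------------------------------------
-- Pavings

IsPaving : List ℕ → List Domino → Set
IsPaving sh ds = concatMap dominoCells ds ↭ cells sh

LeftAdjacent : Domino → Domino → Set
LeftAdjacent e d =
  ∃₂ λ x y → (x , y) ∈ dominoCells e × (suc x , y) ∈ dominoCells d

-- The forbidden situation, for a vertical domino with lower-left cell c.

record Blocked (ds : List Domino) (c : Cell) : Set where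
  field
    present : vertical c ∈ ds
    onD₀    : On₂ 0ℤ (vertical c)
    hasLeft : ∃[ e ] e ∈ ds × LeftAdjacent e (vertical c)
    allUp   : ∀ {e} → e ∈ ds → LeftAdjacent e (vertical c) → InUp′ e

Admissible : List Domino → Set
Admissible ds = ∀ c → ¬ Blocked ds c

------------------------------------------------------------------------
-- Letters and fillings

-- The letters of 1′ < 1 < 2′ < 2 < ⋯ are indexed from 0: primed k is
-- (k+1)′ and unprimed k is k+1.

data Letter : Set where
  primed unprimed : ℕ → Letter

index : Letter → ℕ
index (primed k)   = k
index (unprimed k) = k

rank : Letter → ℕ
rank (primed k)   = 2 * k
rank (unprimed k) = suc (2 * k)

_≤ᴸ_ : Letter → Letter → Set
_≤ᴸ_ = _≤_ on rank

Entry : Set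
Entry = Maybe Letter

pattern X = nothing

Filling : Set → Set
Filling P = List (P × Entry)

labelled : ∀ {P} → Filling P → List (P × Letter)
labelled = mapMaybe λ (p , e) → Maybe.map (p ,_) e

-- Common to Young tableaux (a tile is a single cell) and domino tableaux:
-- 'tile' lists the cells of a tile and 'Up' says which tiles hold X.

record IsTableau {P : Set} (tile : P → List Cell) (Up : P → Set)
                 (t : Filling P) : Set where
  field
    up       : ∀ {p e} → (p , e) ∈ t → Up p → e ≡ X
    down     : ∀ {p e} → (p , e) ∈ t → ¬ Up p → Is-just e
    rows     : ∀ {p q a b c d} →
               (p , a) ∈ labelled t → (q , b) ∈ labelled t →
               c ∈ tile p → d ∈ tile q →
               row c ≡ row d → col c < col d → a ≤ᴸ b
    columns  : ∀ {p q a b c d} →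
               (p , a) ∈ labelled t → (q , b) ∈ labelled t →
               c ∈ tile p → d ∈ tile q →
               col c ≡ col d → row c < row d → a ≤ᴸ b
    unprimedOnce : ∀ {p q k c d} →
               (p , unprimed k) ∈ labelled t → (q , unprimed k) ∈ labelled t →
               c ∈ tile p → d ∈ tile q → col c ≡ col d → p ≡ q
    primedOnce : ∀ {p q k c d} →
               (p , primed k) ∈ labelled t → (q , primed k) ∈ labelled t →
               c ∈ tile p → d ∈ tile q → row c ≡ row d → p ≡ q

-- The exponent of x_{k+1} in x^t.

content : ∀ {P} → Filling P → ℕ → ℕ
content t k = length (filter (λ (p , a) → index a ℕ.≟ k) (labelled t))

------------------------------------------------------------------------
-- Formal power series in x₁, x₂, …

-- The list a₁ ∷ ⋯ ∷ aₙ ∷ [] stands for the monomial x₁^a₁ ⋯ xₙ^aₙ.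

Monomial : Set
Monomial = List ℕ

exponent : Monomial → ℕ → ℕ
exponent []      _       = 0
exponent (n ∷ _) zero    = n
exponent (_ ∷ a) (suc k) = exponent a k

PowerSeries : Set
PowerSeries = Monomial → ℕ

-- All (b , c) of the same length as a with x^b x^c = x^a.

factorisations : Monomial → List (Monomial × Monomial)
factorisations []      = ([] , []) ∷ []
factorisations (n ∷ a) =
  cartesianProductWith (λ i (b , c) → (i ∷ b) , ((n ∸ i) ∷ c))
                       (upTo (suc n)) (factorisations a)

infixl 7 _⊛_

_⊛_ : PowerSeries → PowerSeries → PowerSeries
(F ⊛ G) a = sum (map (λ (b , c) → F b * G c) (factorisations a))

-- 'Sum S w F' is Σ_{s ∈ S} x^{w(s)} = F: for every a, exactly F a elements
-- of S, counted up to the equality of S, have weight x^a.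

module _ (S : Setoid 0ℓ 0ℓ) (w : Setoid.Carrier S → ℕ → ℕ) where

  OfWeight : Monomial → Setoid 0ℓ 0ℓ
  OfWeight a = On.setoid S
    (proj₁ {B = λ s → ∀ k → w s k ≡ exponent a k})

  Sum : PowerSeries → Set
  Sum F = ∀ a → Inverse (OfWeight a) (setoid (Fin (F a)))

------------------------------------------------------------------------
-- Shifted domino tableaux

record ShiftedDominoTableau (sh : List ℕ) : Set where
  field
    filling    : Filling Domino
    paving     : IsPaving sh (map proj₁ filling)
    admissible : Admissible (map proj₁ filling)
    isTableau  : IsTableau dominoCells InUp′ filling

  weight : ℕ → ℕ
  weight = content filling

-- Only the labelled dominoes (those of down′) matter for equality.

shiftedDominoTableaux : List ℕ → Setoid 0ℓ 0ℓ
shiftedDominoTableaux sh = record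
  { Carrier       = ShiftedDominoTableau sh
  ; _≈_           = λ T U → ∀ u → u ∈ labelled (filling T) ⇔ u ∈ labelled (filling U)
  ; isEquivalence = record
    { refl  = λ _ → mk⇔ (λ p → p) (λ p → p)
    ; sym   = λ e u → mk⇔ (from (e u)) (to (e u))
    ; trans = λ e f u → mk⇔ (to (f u) ∘ to (e u)) (from (e u) ∘ from (f u))
    }
  }
  where open ShiftedDominoTableau; open Equivalence

------------------------------------------------------------------------
-- Shifted Young tableaux and the functions Q_μ

IsShiftedYoungTableau : Filling Cell → Set
IsShiftedYoungTableau = IsTableau [_] InUp

record ShiftedYoungTableau (sh : List ℕ) : Set where
  field
    filling   : Filling Cell
    shape     : map proj₁ filling ≡ cells sh
    isTableau : IsShiftedYoungTableau filling

  weight : ℕ → ℕ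
  weight = content filling

shiftedYoungTableaux : List ℕ → Setoid 0ℓ 0ℓ
shiftedYoungTableaux sh =
  On.setoid (setoid (Filling Cell)) (ShiftedYoungTableau.filling {sh})

private
  isX? : (e : Entry) → Dec (e ≡ X)
  isX? X        = yes refl
  isX? (just _) = no λ ()

  isJust? : (e : Entry) → Dec (Is-just e)
  isJust? = MaybeAny.dec λ _ → yes tt

  inUp? : Decidable InUp
  inUp? c = 0ℤ ℤ.<? diagonal c

  _≟ᶜ_ : DecidableEquality Cell
  _≟ᶜ_ = ≡-dec ℕ._≟_ ℕ._≟_

  LabelledCell : Set
  LabelledCell = Cell × Letter

  Monotone : (f g : Cell → ℕ) → LabelledCell → LabelledCell → Set
  Monotone f g (c , a) (d , b) = f c ≡ f d → g c < g d → a ≤ᴸ b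

  Once : (ℕ → Letter) → (Cell → ℕ) → LabelledCell → LabelledCell → Set
  Once l f (c , a) (d , b) = ∀ k → a ≡ l k → b ≡ l k → f c ≡ f d → c ≡ d

  monotone? : ∀ f g u v → Dec (Monotone f g u v)
  monotone? f g (c , a) (d , b) =
    (f c ℕ.≟ f d) →-dec (g c ℕ.<? g d) →-dec (rank a ℕ.≤? rank b)

  once? : ∀ l → (∀ a → Dec (∃[ k ] a ≡ l k)) → (∀ {j k} → l j ≡ l k → j ≡ k) →
          ∀ f u v → Dec (Once l f u v)
  once? l l? inj f (c , a) (d , b) with l? a | l? b
  ... | no ¬a | _ = yes λ k eq → ⊥-elim (¬a (k , eq))
  ... | _ | no ¬b = yes λ k _ eq → ⊥-elim (¬b (k , eq))
  ... | yes (i , refl) | yes (j , refl) =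
    map′ (λ h k p q → h (trans (inj p) (sym (inj q))))
         (λ { h refl → h i refl refl })
         ((i ℕ.≟ j) →-dec (f c ℕ.≟ f d) →-dec (c ≟ᶜ d))

  primed? : ∀ a → Dec (∃[ k ] a ≡ primed k)
  primed? (primed k)   = yes (k , refl)
  primed? (unprimed k) = no λ ()

  unprimed? : ∀ a → Dec (∃[ k ] a ≡ unprimed k)
  unprimed? (primed k)   = no λ ()
  unprimed? (unprimed k) = yes (k , refl)

  AllPairs : ∀ {A : Set} → (A → A → Set) → List A → Set
  AllPairs R xs = All (λ u → All (R u) xs) xs

  allPairs? : ∀ {A : Set} {R : A → A → Set} → (∀ u v → Dec (R u v)) →
              Decidable (AllPairs R)
  allPairs? R? xs = All.all? (λ u → All.all? (R? u) xs) xs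

  lookup₂ : ∀ {A : Set} {R : A → A → Set} {xs u v} →
            AllPairs R xs → u ∈ xs → v ∈ xs → R u v
  lookup₂ h u∈ v∈ = All.lookup (All.lookup h u∈) v∈

  tabulate₂ : ∀ {A : Set} {R : A → A → Set} {xs} →
              (∀ {u v} → u ∈ xs → v ∈ xs → R u v) → AllPairs R xs
  tabulate₂ h = All.tabulate λ u∈ → All.tabulate λ v∈ → h u∈ v∈

isShiftedYoungTableau? : Decidable IsShiftedYoungTableau
isShiftedYoungTableau? t = map′
  (λ (u , d , r , c , o , p) → record
    { up           = All.lookup u
    ; down         = All.lookup d
    ; rows         = λ { i j (here refl) (here refl) → lookup₂ r i j }
    ; columns      = λ { i j (here refl) (here refl) → lookup₂ c i j }
    ; unprimedOnce = λ { i j (here refl) (here refl) → lookup₂ o i j _ refl refl }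
    ; primedOnce   = λ { i j (here refl) (here refl) → lookup₂ p i j _ refl refl }
    })
  (λ T → let open IsTableau T in
      All.tabulate up , All.tabulate down
    , tabulate₂ (λ i j → rows i j (here refl) (here refl))
    , tabulate₂ (λ i j → columns i j (here refl) (here refl))
    , tabulate₂ (λ { i j k refl refl → unprimedOnce i j (here refl) (here refl) })
    , tabulate₂ (λ { i j k refl refl → primedOnce i j (here refl) (here refl) }))
  (   All.all? (λ (p , e) → inUp? p →-dec isX? e) t
  ×-dec All.all? (λ (p , e) → ¬? (inUp? p) →-dec isJust? e) t
  ×-dec allPairs? (monotone? row col) s
  ×-dec allPairs? (monotone? col row) s
  ×-dec allPairs? (once? unprimed unprimed? (λ { refl → refl }) col) s
  ×-dec allPairs? (once? primed primed? (λ { refl → refl }) row) s)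
  where s = labelled t

-- Every letter of index at least n is left out: a tableau of weight x^a
-- has none of these for n = length a.

letters : ℕ → List Letter
letters n = map primed (upTo n) ++ map unprimed (upTo n)

fillings : ℕ → List Cell → List (Filling Cell)
fillings n []       = [] ∷ []
fillings n (c ∷ cs) =
  cartesianProductWith (λ e t → (c , e) ∷ t)
                       (X ∷ map just (letters n)) (fillings n cs)

HasWeight : Monomial → Filling Cell → Set
HasWeight a t = All (λ k → content t k ≡ exponent a k) (upTo (length a))

hasWeight? : ∀ a → Decidable (HasWeight a)
hasWeight? a t = All.all? (λ k → content t k ℕ.≟ exponent a k) _

youngTableaux : List ℕ → Monomial → List (Filling Cell)
youngTableaux sh a =
  filter (λ t → isShiftedYoungTableau? t ×-dec hasWeight? a t)
         (fillings (length a) (cells sh))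

-- See Q-sum at the end for Q sh = Σ_t x^t over all shifted Young tableaux t
-- of shape sh.

Q : List ℕ → PowerSeries
Q sh a = length (youngTableaux sh a)

private
  IndicesBelow : ℕ → Filling Cell → Set
  IndicesBelow n t = ∀ {p l} → (p , l) ∈ labelled t → index l < n

  exponent-beyond : ∀ a {k} → length a ≤ k → exponent a k ≡ 0
  exponent-beyond []      _         = refl
  exponent-beyond (_ ∷ a) (s≤s len) = exponent-beyond a len

  content-beyond : ∀ {n t k} → IndicesBelow n t → n ≤ k → content t k ≡ 0
  content-beyond {t = t} {k} below n≤k = cong length
    (filter-none (λ (p , a) → index a ℕ.≟ k) {xs = labelled t}
      (All.tabulate λ { u∈ refl → ℕ.<⇒≱ (below u∈) n≤k }))

  content-positive : ∀ {t : Filling Cell} {p l} →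
                     (p , l) ∈ labelled t → content t (index l) ≢ 0
  content-positive {t} {l = l} u∈ eq
    with filter (λ (p , a) → index a ℕ.≟ index l) (labelled t)
       | ∈-filter⁺ (λ (p , a) → index a ℕ.≟ index l) u∈ refl
  content-positive u∈ () | _ ∷ _ | _

  ∈-letters⁺ : ∀ {n} l → index l < n → l ∈ letters n
  ∈-letters⁺ {n} (primed k)   k<n = ∈-++⁺ˡ (∈-map⁺ primed (∈-upTo⁺ k<n))
  ∈-letters⁺ {n} (unprimed k) k<n =
    ∈-++⁺ʳ (map primed (upTo n)) (∈-map⁺ unprimed (∈-upTo⁺ k<n))

  ∈-letters⁻ : ∀ {n} l → l ∈ letters n → index l < n
  ∈-letters⁻ {n} l l∈ with ∈-++⁻ (map primed (upTo n)) l∈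
  ... | inj₁ q with k , k∈ , refl ← ∈-map⁻ primed q   = ∈-upTo⁻ k∈
  ... | inj₂ q with k , k∈ , refl ← ∈-map⁻ unprimed q = ∈-upTo⁻ k∈

  ∈-fillings⁺ : ∀ {n} t → IndicesBelow n t → t ∈ fillings n (map proj₁ t)
  ∈-fillings⁺ []             below = here refl
  ∈-fillings⁺ {n} ((p , X) ∷ t) below =
    ∈-cartesianProductWith⁺ _ {xs = X ∷ map just (letters n)} (here refl) (∈-fillings⁺ t below)
  ∈-fillings⁺ ((p , just l) ∷ t) below =
    ∈-cartesianProductWith⁺ _
      (there (∈-map⁺ just (∈-letters⁺ l (below (here refl)))))
      (∈-fillings⁺ t (λ u∈ → below (there u∈)))

  ∈-fillings⁻ : ∀ {n} cs {t} → t ∈ fillings n cs →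
                map proj₁ t ≡ cs × IndicesBelow n t
  ∈-fillings⁻ [] (here refl) = refl , λ ()
  ∈-fillings⁻ {n} (c ∷ cs) t∈
    with ∈-cartesianProductWith⁻ _ (X ∷ map just (letters n)) (fillings n cs) t∈
  ... | _ , t , here refl , t∈' , refl
    with eq , below ← ∈-fillings⁻ cs t∈' = cong (c ∷_) eq , below
  ... | e , t , there e∈ , t∈' , refl
    with l , l∈ , refl ← ∈-map⁻ just e∈ | eq , below ← ∈-fillings⁻ cs t∈' =
      cong (c ∷_) eq
    , λ { (here refl) → ∈-letters⁻ l l∈ ; (there u∈) → below u∈ }

  letters-unique : ∀ n → Unique (letters n)
  letters-unique n = Unique.++⁺
    (Unique.map⁺ (λ { refl → refl }) (Unique.upTo⁺ n))
    (Unique.map⁺ (λ { refl → refl }) (Unique.upTo⁺ n))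
    λ (p , q) → case ∈-map⁻ primed p of λ { (_ , _ , refl) →
                case ∈-map⁻ unprimed q of λ { (_ , _ , ()) } }

  fillings-unique : ∀ n cs → Unique (fillings n cs)
  fillings-unique n []       = [] ∷ []
  fillings-unique n (c ∷ cs) = Unique.cartesianProductWith⁺ _
    (λ { refl → refl , refl })
    (All.tabulate (λ j∈ eq → case ∈-map⁻ just j∈ of λ { (_ , _ , refl) → case eq of λ () })
      ∷ Unique.map⁺ (λ { refl → refl }) (letters-unique n))
    (fillings-unique n cs)

  youngTableaux-unique : ∀ sh a → Unique (youngTableaux sh a)
  youngTableaux-unique sh a =
    Unique.filter⁺ _ (fillings-unique (length a) (cells sh))

  module _ (sh : List ℕ) (a : Monomial) where

    open ShiftedYoungTableau

    complete : (T : ShiftedYoungTableau sh) →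
               (∀ k → weight T k ≡ exponent a k) → filling T ∈ youngTableaux sh a
    complete T w = ∈-filter⁺ _
      (subst (λ cs → filling T ∈ fillings (length a) cs) (shape T)
        (∈-fillings⁺ (filling T) below))
      (isTableau T , All.tabulate (λ {k} _ → w k))
      where
      below : IndicesBelow (length a) (filling T)
      below {l = l} u∈ with index l ℕ.<? length a
      ... | yes l<  = l<
      ... | no  l≮ = ⊥-elim (content-positive {filling T} u∈
                       (trans (w (index l)) (exponent-beyond a (ℕ.≮⇒≥ l≮))))

    sound : ∀ {t} → t ∈ youngTableaux sh a →
            Setoid.Carrier (OfWeight (shiftedYoungTableaux sh) weight a)
    sound {t} t∈ with ∈-filter⁻ _ {xs = fillings (length a) (cells sh)} t∈
    ... | t∈' , tab , w with eq , below ← ∈-fillings⁻ (cells sh) t∈' =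
        record { filling = t ; shape = eq ; isTableau = tab }
      , λ k → case k ℕ.<? length a of λ
          { (yes k<) → All.lookup w (∈-upTo⁺ k<)
          ; (no k≮)  → trans (content-beyond {t = t} below (ℕ.≮⇒≥ k≮))
                             (sym (exponent-beyond a (ℕ.≮⇒≥ k≮))) }

  lookup-injective : ∀ {A : Set} {xs : List A} → Unique xs →
                     ∀ i j → lookup xs i ≡ lookup xs j → i ≡ j
  lookup-injective (_ ∷ _)  zero    zero    _  = refl
  lookup-injective (x∉ ∷ _) zero    (suc j) eq =
    contradiction eq (All.lookup x∉ (∈-lookup j))
  lookup-injective (x∉ ∷ _) (suc i) zero    eq =
    contradiction (sym eq) (All.lookup x∉ (∈-lookup i))
  lookup-injective (_ ∷ u)  (suc i) (suc j) eq = cong suc (lookup-injective u i j eq)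

Q-sum : ∀ sh → Sum (shiftedYoungTableaux sh) ShiftedYoungTableau.weight (Q sh)
Q-sum sh a = record
  { to        = position
  ; from      = λ i → sound sh a (∈-lookup i)
  ; to-cong   = λ {T} {U} T≡U → same (trans (sym (at T)) (trans T≡U (at U)))
  ; from-cong = λ { refl → refl }
  ; inverse   = (λ {_} {T} T≡ → same (trans (sym (at T)) T≡))
              , (λ { {T} refl → sym (at T) })
  }
  where
  open ShiftedYoungTableau

  position : Setoid.Carrier (OfWeight (shiftedYoungTableaux sh) weight a) →
             Fin (Q sh a)
  position (T , w) = Any.index (complete sh a T w)

  at : ∀ T → filling (proj₁ T) ≡ lookup (youngTableaux sh a) (position T)
  at (T , w) = lookup-index (complete sh a T w)

  same : ∀ {i j} → lookup (youngTableaux sh a) i ≡ lookup (youngTableaux sh a) j →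
         i ≡ j
  same = lookup-injective (youngTableaux-unique sh a) _ _

{-# OPTIONS --safe #-}
-- A domino covers cells of two neighbouring diagonals x - y = i - 1 and
-- x - y = i; call i its type.  Labelled dominoes have type i ≥ 0; those of
-- even type 2k correspond to the cells of one quotient on its diagonal
-- x - y = k, those of odd type 2k + 1 to the cells of the other.  Breaking
-- ties between equal letters by the type (increasing for unprimed letters,
-- decreasing for primed ones) standardises the labels, so that a tableau
-- becomes a set of beads (type, letter) with distinct keys.
--
-- Let N i z be the number of beads of type i with key below z.  Diagonal e
-- has N e z + N (e + 1) z cells with key below z, and these cells form an
-- order ideal, which says that the numbers on diagonals e and e + 1 differ
-- by 0 or 1.  The type e + 1 is common to both, so this is
-- N (e + 2) z ≤ N e z ≤ N (e + 2) z + 1, which is also the condition for the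
-- beads of one parity to come from a shifted Young tableau.  Conversely
-- these counts give the place of every domino.  Dominoes of type 0 reach
-- into the upper half: admissibility makes them vertical exactly when no
-- bead of type 1 is smaller.  The upper half is then paved by continuing the
-- pattern, type i - 2 being type i without its smallest bead.
--
-- Pavability enters only through the chessboard colouring, which gives the
-- numbers of even and odd entries of the L-sequence.

module Submission where

open import Data.Bool.Base using (if_then_else_)
open import Data.Empty using (⊥; ⊥-elim)
import Data.Fin.Base as Fin using (splitAt)
open import Data.Fin.Base using (Fin; _↑ˡ_; _↑ʳ_; combine; remQuot)
import Data.Fin.Properties as Fin
import Data.Integer.Base as ℤ
import Data.Integer.Properties as ℤ
open import Data.List.Base hiding (sum)
open import Data.List.Membership.Propositional as Membership using (_∈_)
open import Data.List.Membership.Propositional.Properties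
open import Data.List.Membership.Propositional.Properties.WithK using (unique∧set⇒bag; unique⇒irrelevant)
open import Data.List.Properties
  using (length-++; length-map; length-upTo; length-filter; filter-++; filter-accept; filter-reject;
         ∷-injectiveˡ; ∷-injectiveʳ; map-∘; map-id; concatMap-map; length-drop; map-++; upTo-∷ʳ; filter-all)
open import Data.List.Relation.Binary.BagAndSetEquality using (∼bag⇒↭)
open import Data.List.Relation.Binary.Permutation.Propositional using (_↭_; ↭-sym; ↭-trans; ↭⇒↭ₛ; ↭-reflexive)
open import Data.List.Relation.Binary.Permutation.Propositional.Properties using (↭-length; filter-↭; ∈-resp-↭)
import Data.List.Relation.Binary.Permutation.Setoid.Properties as Permutation
open import Data.List.Relation.Unary.All as All using (All; []; _∷_)
import Data.List.Relation.Unary.All.Properties as All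
open import Data.List.Relation.Unary.AllPairs as AllPairs using (AllPairs; []; _∷_)
import Data.List.Relation.Unary.AllPairs.Properties as AllPairsₚ
open import Data.List.Relation.Unary.Any as Any using (Any; here; there)
open import Data.List.Relation.Unary.Linked using (Linked; []; [-]; _∷_)
open import Data.List.Relation.Unary.Linked.Properties using (Linked⇒AllPairs)
open import Data.List.Relation.Unary.Unique.Propositional using (Unique)
import Data.List.Relation.Unary.Unique.Propositional.Properties as Unique
import Data.List.Sort
open import Data.Maybe using (Is-just)
open import Data.Maybe.Base using (just; nothing)
open import Data.Maybe.Relation.Unary.Any using (just)
open import Data.Nat.Base
open import Data.Nat.DivMod using (m*n/n≡m)
open import Data.Nat.Divisibility using (_∣_; divides)
open import Data.Nat.ListAction using (sum)
import Data.Nat.Properties as ℕ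
open import Data.Nat.Tactic.RingSolver using (solve-∀)
open import Data.Product.Base using (_×_; _,_; proj₁; proj₂; ∃-syntax; Σ-syntax; swap)
open import Data.Product.Properties using (≡-dec)
open import Data.Product.Relation.Binary.Pointwise.NonDependent using (×-setoid)
open import Data.Sum.Base using (_⊎_; inj₁; inj₂)
open import Function.Base using (_∘_; case_of_)
open import Function.Bundles using (mk⇔; Inverse; Equivalence)
open import Level using (0ℓ)
open import Relation.Binary.Bundles using (Setoid)
open import Relation.Binary.Construct.Closure.ReflexiveTransitive using (Star; ε; _◅_)
import Relation.Binary.Construct.On as On
open import Relation.Binary.Definitions using (tri<; tri≈; tri>)
open import Relation.Binary.PropositionalEquality hiding ([_])
open import Relation.Nullary.Decidable using (Dec; yes; no; _×-dec_; does; dec-true; dec-false)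
open import Relation.Nullary.Negation using (¬_; contradiction)
open import Relation.Unary using (Decidable)
open import Algebra.Properties.CommutativeSemigroup ℕ.+-commutativeSemigroup using (interchange)
open import Defs

-- The shape and its quotients are compared inside one list. For a shape with ℓ parts and L-sequence
-- L, let `m i` be the number of entries of L that are at least ℓ + i and have the parity of ℓ + i.
-- Then diagonal x - y = e of the shape has `m e + m (suc e)` cells, while the diagonals x - y = k
-- of the two quotients have `m (dbl k)` and `m (suc (dbl k))` cells. So the same number of beads of
-- each type is prescribed on both sides. The parity of ℓ decides which quotient receives the even
-- types. The obstacle is type 0: such a domino has only one cell on or below the main diagonal, so
-- the counts locate that cell but not the direction of the domino. The condition on the last parts
-- of the quotients is what makes the upper half fit. It forces the diagonals of a quotient above
-- its main one to lose exactly one cell per step until they are empty, and this is the rate at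
-- which the continued pattern drops beads.

private variable
  Elt Img : Set

-- Counting in finite lists

χ : {P : Set} → Dec P → ℕ
χ (yes _) = 1
χ (no  _) = 0

χ-cong : {P Q : Set} {p : Dec P} {q : Dec Q} → (P → Q) → (Q → P) → χ p ≡ χ q
χ-cong {p = yes _} {yes _} f g = refl
χ-cong {p = yes p} {no ¬q} f g = ⊥-elim (¬q (f p))
χ-cong {p = no ¬p} {yes q} f g = ⊥-elim (¬p (g q))
χ-cong {p = no _}  {no _}  f g = refl

χ-no : {P : Set} {p : Dec P} → ¬ P → χ p ≡ 0
χ-no {p = yes p} ¬p = ⊥-elim (¬p p)
χ-no {p = no _}  ¬p = refl

χ-yes : {P : Set} {p : Dec P} → P → χ p ≡ 1
χ-yes {p = yes _} _ = refl
χ-yes {p = no ¬p} p = ⊥-elim (¬p p)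

χ-mono : {P Q : Set} {p : Dec P} {q : Dec Q} → (P → Q) → χ p ≤ χ q
χ-mono {p = yes _} {yes _} f = ℕ.≤-refl
χ-mono {p = yes p} {no ¬q} f = ⊥-elim (¬q (f p))
χ-mono {p = no _}          f = z≤n

count : {P : Elt → Set} → Decidable P → List Elt → ℕ
count P? xs = length (filter P? xs)

count-∷ : {P : Elt → Set} (P? : Decidable P) (x : Elt) (xs : List Elt) →
          count P? (x ∷ xs) ≡ χ (P? x) + count P? xs
count-∷ P? x xs with P? x
... | yes _ = refl
... | no  _ = refl

count-cong : {P R : Elt → Set} (P? : Decidable P) (R? : Decidable R) (xs : List Elt) →
             (∀ {x} → x ∈ xs → P x → R x) → (∀ {x} → x ∈ xs → R x → P x) →
             count P? xs ≡ count R? xs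
count-cong P? R? []       f g = refl
count-cong P? R? (x ∷ xs) f g
  rewrite count-∷ P? x xs | count-∷ R? x xs =
  cong₂ _+_ (χ-cong (f (here refl)) (g (here refl)))
            (count-cong P? R? xs (f ∘ there) (g ∘ there))

count-mono : {P R : Elt → Set} (P? : Decidable P) (R? : Decidable R) (xs : List Elt) →
             (∀ {x} → x ∈ xs → P x → R x) → count P? xs ≤ count R? xs
count-mono P? R? []       f = z≤n
count-mono P? R? (x ∷ xs) f
  rewrite count-∷ P? x xs | count-∷ R? x xs =
  ℕ.+-mono-≤ (χ-mono (f (here refl))) (count-mono P? R? xs (f ∘ there))

count-strict : {P R : Elt → Set} (P? : Decidable P) (R? : Decidable R) (xs : List Elt) →
               (∀ {x} → x ∈ xs → P x → R x) →
               ∀ {x} → x ∈ xs → R x → ¬ P x → count P? xs < count R? xs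
count-strict P? R? (x ∷ xs) f (here refl) r ¬p
  rewrite count-∷ P? x xs | count-∷ R? x xs | χ-no {p = P? x} ¬p | χ-yes {p = R? x} r =
  s≤s (count-mono P? R? xs (f ∘ there))
count-strict P? R? (x ∷ xs) f (there x∈) r ¬p
  rewrite count-∷ P? x xs | count-∷ R? x xs =
  ℕ.+-mono-≤-< (χ-mono (f (here refl))) (count-strict P? R? xs (f ∘ there) x∈ r ¬p)

count-none : {P : Elt → Set} (P? : Decidable P) (xs : List Elt) → (∀ {x} → x ∈ xs → ¬ P x) → count P? xs ≡ 0
count-none P? []       f = refl
count-none P? (x ∷ xs) f rewrite count-∷ P? x xs | χ-no {p = P? x} (f (here refl)) =
  count-none P? xs (f ∘ there)

count-positive : {P : Elt → Set} (P? : Decidable P) (xs : List Elt) → 0 < count P? xs → ∃[ x ] x ∈ xs × P x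
count-positive P? xs 0<n with filter P? xs in eq
... | y ∷ ys with y∈ , py ← ∈-filter⁻ P? {xs = xs} (subst (y ∈_) (sym eq) (here refl)) = y , y∈ , py

count-++ : {P : Elt → Set} (P? : Decidable P) (xs ys : List Elt) →
           count P? (xs ++ ys) ≡ count P? xs + count P? ys
count-++ P? xs ys = trans (cong length (filter-++ P? xs ys)) (length-++ (filter P? xs))

count-map : {P : Elt → Set} (f : Img → Elt) (P? : Decidable P) (xs : List Img) →
            count P? (map f xs) ≡ count (P? ∘ f) xs
count-map f P? []       = refl
count-map f P? (x ∷ xs) rewrite count-∷ P? (f x) (map f xs) | count-∷ (P? ∘ f) x xs =
  cong (χ (P? (f x)) +_) (count-map f P? xs)

count-filter : {P R : Elt → Set} (P? : Decidable P) (R? : Decidable R) (xs : List Elt) →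
               count R? (filter P? xs) ≡ count (λ x → P? x ×-dec R? x) xs
count-filter P? R? []       = refl
count-filter P? R? (x ∷ xs) with P? x
... | no _ = count-filter P? R? xs
... | yes p with R? x
...   | yes _ = cong suc (count-filter P? R? xs)
...   | no  _ = count-filter P? R? xs

count-↭ : {P : Elt → Set} (P? : Decidable P) {xs ys : List Elt} → xs ↭ ys → count P? xs ≡ count P? ys
count-↭ P? p = ↭-length (filter-↭ P? p)

same-members⇒↭ : {xs ys : List Elt} → Unique xs → Unique ys →
                 (∀ {x} → x ∈ xs → x ∈ ys) → (∀ {x} → x ∈ ys → x ∈ xs) → xs ↭ ys
same-members⇒↭ u v f g = ∼bag⇒↭ (unique∧set⇒bag u v (mk⇔ f g))

length-⊆ : {xs ys : List Elt} → Unique xs → (∀ {x} → x ∈ xs → x ∈ ys) → length xs ≤ length ys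
length-⊆ {xs = []}     _        _   = z≤n
length-⊆ {xs = x ∷ xs} {ys} (x∉ ∷ u) sub with as , bs , refl ← ∈-∃++ (sub (here refl)) =
  subst (suc (length xs) ≤_) (sym (trans (length-++ as) (ℕ.+-suc _ _)))
    (s≤s (subst (length xs ≤_) (length-++ as) (length-⊆ u sub′)))
  where
  sub′ : ∀ {y} → y ∈ xs → y ∈ as ++ bs
  sub′ y∈ with ∈-++⁻ as (sub (there y∈))
  ... | inj₁ p           = ∈-++⁺ˡ p
  ... | inj₂ (here refl) = contradiction refl (All.lookup x∉ y∈)
  ... | inj₂ (there p)   = ∈-++⁺ʳ as p

module _ {xs : List ℕ} (u : Unique xs) (closed : ∀ {q} → suc q ∈ xs → q ∈ xs) where

  closed-≤ : ∀ {q r} → q ≤ r → r ∈ xs → q ∈ xs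
  closed-≤ {q} {zero}  z≤n r∈ = r∈
  closed-≤ {q} {suc r} q≤r r∈ with ℕ.m≤n⇒m<n∨m≡n q≤r
  ... | inj₁ (s≤s q≤) = closed-≤ q≤ (closed r∈)
  ... | inj₂ refl     = r∈

  -- Everything below a member is a member, so `upTo (suc q)` embeds in the list. Together with
  -- `segment⁺` this makes the list an initial segment of ℕ, known once its length is known.
  segment⁻ : ∀ {q} → q ∈ xs → q < length xs
  segment⁻ {q} q∈ = subst (_≤ length xs) (length-upTo (suc q))
    (length-⊆ (Unique.upTo⁺ (suc q)) λ r∈ → closed-≤ (ℕ.≤-pred (∈-upTo⁻ r∈)) q∈)

  segment⁺ : ∀ {q} → q < length xs → q ∈ xs
  segment⁺ {q} q< with Any.any? (q ℕ.≟_) xs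
  ... | yes q∈ = q∈
  ... | no  q∉ = ⊥-elim (ℕ.<⇒≱ q< (subst (length xs ≤_) (length-upTo q)
    (length-⊆ u λ {r} r∈ → ∈-upTo⁺ (ℕ.≰⇒> λ q≤r → q∉ (closed-≤ q≤r r∈)))))

-- A missing `q` could be added to the list, which would give one distinct number too many below
-- `length xs`.
pigeonhole : {xs : List ℕ} → Unique xs → (∀ {q} → q ∈ xs → q < length xs) →
             ∀ {q} → q < length xs → q ∈ xs
pigeonhole {xs} u bound {q} q< with Any.any? (q ℕ.≟_) xs
... | yes q∈ = q∈
... | no  q∉ = ⊥-elim (ℕ.<⇒≱ {length xs} ℕ.≤-refl
  (subst (suc (length xs) ≤_) (length-upTo (length xs))
    (length-⊆ {xs = q ∷ xs} (All.¬Any⇒All¬ xs q∉ ∷ u)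
      λ { (here refl) → ∈-upTo⁺ q< ; (there r∈) → ∈-upTo⁺ (bound r∈) })))

allPairs-distinct : {S : Elt → Elt → Set} {xs : List Elt} → Unique xs →
                    (∀ {x y} → x ∈ xs → y ∈ xs → x ≢ y → S x y) → AllPairs S xs
allPairs-distinct []       f = []
allPairs-distinct (x∉ ∷ u) f =
  All.tabulate (λ y∈ → f (here refl) (there y∈) (All.lookup x∉ y∈)) ∷
  allPairs-distinct u (λ x∈ y∈ → f (there x∈) (there y∈))

allPairs-map : {S : Img → Img → Set} {f : Elt → Img} {xs : List Elt} →
               AllPairs (λ x y → S (f x) (f y)) xs → AllPairs S (map f xs)
allPairs-map []       = []
allPairs-map (p ∷ ps) = All.map⁺ p ∷ allPairs-map ps

unique-map : {f : Elt → Img} {xs : List Elt} → Unique xs →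
             (∀ {x y} → x ∈ xs → y ∈ xs → f x ≡ f y → x ≡ y) → Unique (map f xs)
unique-map u inj = allPairs-map (allPairs-distinct u λ x∈ y∈ x≢y eq → x≢y (inj x∈ y∈ eq))

unique-map-injective : {f : Elt → Img} {xs : List Elt} → Unique (map f xs) →
                       ∀ {x y} → x ∈ xs → y ∈ xs → f x ≡ f y → x ≡ y
unique-map-injective         (_ ∷ _)  (here refl) (here refl) _  = refl
unique-map-injective {f = f} (x∉ ∷ _) (here refl) (there y∈) eq =
  contradiction eq (All.lookup x∉ (∈-map⁺ f y∈))
unique-map-injective {f = f} (x∉ ∷ _) (there x∈) (here refl) eq =
  contradiction (sym eq) (All.lookup x∉ (∈-map⁺ f x∈))
unique-map-injective         (_ ∷ u)  (there x∈) (there y∈) eq = unique-map-injective u x∈ y∈ eq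

unique-++⁻ʳ : (xs : List Elt) {ys : List Elt} → Unique (xs ++ ys) → Unique ys
unique-++⁻ʳ []       u       = u
unique-++⁻ʳ (x ∷ xs) (_ ∷ u) = unique-++⁻ʳ xs u

unique-++-disjoint : (xs : List Elt) {ys : List Elt} → Unique (xs ++ ys) →
                     ∀ {c} → c ∈ xs → c ∈ ys → ⊥
unique-++-disjoint (x ∷ xs) (x∉ ∷ u) (here refl) q = All.lookup x∉ (∈-++⁺ʳ xs q) refl
unique-++-disjoint (x ∷ xs) (x∉ ∷ u) (there p)   q = unique-++-disjoint xs u p q

module _ (f : Elt → List Img) where

  unique-concatMap-owner : ∀ {xs} → Unique (concatMap f xs) → ∀ {x y c} →
                           x ∈ xs → y ∈ xs → c ∈ f x → c ∈ f y → x ≡ y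
  unique-concatMap-owner {x ∷ xs} u (here refl) (here refl) _ _ = refl
  unique-concatMap-owner {x ∷ xs} u (here refl) (there y∈) p q =
    ⊥-elim (unique-++-disjoint (f x) u p (∈-concatMap⁺ f (Any.map (λ { refl → q }) y∈)))
  unique-concatMap-owner {x ∷ xs} u (there x∈) (here refl) p q =
    ⊥-elim (unique-++-disjoint (f x) u q (∈-concatMap⁺ f (Any.map (λ { refl → p }) x∈)))
  unique-concatMap-owner {x ∷ xs} u (there x∈) (there y∈) p q =
    unique-concatMap-owner (unique-++⁻ʳ (f x) u) x∈ y∈ p q

  unique-concatMap-base : (∀ x → ∃[ c ] c ∈ f x) → ∀ {xs} → Unique (concatMap f xs) → Unique xs
  unique-concatMap-base ne {[]}     u = []
  unique-concatMap-base ne {x ∷ xs} u =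
    All.tabulate (λ { y∈ refl → let c , c∈ = ne x in
      unique-++-disjoint (f x) u c∈ (∈-concatMap⁺ f (Any.map (λ { refl → c∈ }) y∈)) })
    ∷ unique-concatMap-base ne (unique-++⁻ʳ (f x) u)

  unique-concatMap : ∀ {xs} → Unique xs → (∀ {x} → x ∈ xs → Unique (f x)) →
                     (∀ {x y c} → x ∈ xs → y ∈ xs → c ∈ f x → c ∈ f y → x ≡ y) →
                     Unique (concatMap f xs)
  unique-concatMap u each own = Unique.concat⁺
    (All.map⁺ (All.tabulate each))
    (allPairs-map (allPairs-distinct u λ x∈ y∈ x≢y (p , q) → x≢y (own x∈ y∈ p q)))

  ∈-concatMap-intro : ∀ {xs x c} → x ∈ xs → c ∈ f x → c ∈ concatMap f xs
  ∈-concatMap-intro x∈ c∈ = ∈-concatMap⁺ f (Any.map (λ { refl → c∈ }) x∈)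

  ∈-concatMap-elim : ∀ xs {c} → c ∈ concatMap f xs → ∃[ x ] x ∈ xs × c ∈ f x
  ∈-concatMap-elim xs c∈ = Membership.find (∈-concatMap⁻ f {xs = xs} c∈)

module _ (f : Elt → ℕ) (xs : List Elt) where

  -- At `f x` this is the position of `x` when the list is ordered by `f`; the places of beads and
  -- marks are numbers of this kind.
  below : ℕ → ℕ
  below z = count (λ x → f x ℕ.<? z) xs

  below-mono : ∀ {z z′} → z ≤ z′ → below z ≤ below z′
  below-mono z≤ = count-mono _ _ xs λ _ p → ℕ.<-≤-trans p z≤

  below-strict : ∀ {x z} → x ∈ xs → f x < z → below (f x) < below z
  below-strict x∈ fx<z = count-strict _ _ xs (λ _ p → ℕ.<-trans p fx<z) x∈ fx<z (ℕ.<-irrefl refl)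

  below-length : ∀ {x} → x ∈ xs → below (f x) < length xs
  below-length {x} x∈ = ℕ.<-≤-trans (below-strict x∈ ℕ.≤-refl) (length-filter _ xs)

  module _ (u : Unique (map f xs)) where

    below-injective : ∀ {x y} → x ∈ xs → y ∈ xs → below (f x) ≡ below (f y) → x ≡ y
    below-injective {x} {y} x∈ y∈ eq with ℕ.<-cmp (f x) (f y)
    ... | tri< lt _ _ = ⊥-elim (ℕ.<-irrefl eq (below-strict x∈ lt))
    ... | tri≈ _ e _  = unique-map-injective u x∈ y∈ e
    ... | tri> _ _ gt = ⊥-elim (ℕ.<-irrefl (sym eq) (below-strict y∈ gt))

    -- Positions are distinct and smaller than the length, so by the pigeonhole principle each one
    -- is taken.
    select : ∀ {q} → q < length xs → ∃[ x ] x ∈ xs × below (f x) ≡ q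
    select {q} q< = let x , x∈ , eq = ∈-map⁻ (below ∘ f) q∈ in x , x∈ , sym eq
      where
      q∈ : q ∈ map (below ∘ f) xs
      q∈ = pigeonhole (unique-map (Unique.map⁻ u) below-injective)
        (λ r∈ → case ∈-map⁻ (below ∘ f) r∈ of λ { (x , x∈ , refl) →
          subst (below (f x) <_) (sym (length-map (below ∘ f) xs)) (below-length x∈) })
        (subst (q <_) (sym (length-map (below ∘ f) xs)) q<)

-- Letters, beads and the order of their keys

rank-injective : ∀ l m → rank l ≡ rank m → l ≡ m
rank-injective (primed j)   (primed k)   eq = cong primed (ℕ.*-cancelˡ-≡ j k 2 eq)
rank-injective (unprimed j) (unprimed k) eq = cong unprimed (ℕ.*-cancelˡ-≡ j k 2 (ℕ.suc-injective eq))
rank-injective (primed j)   (unprimed k) eq = ⊥-elim (ℕ.even≢odd j k eq)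
rank-injective (unprimed j) (primed k)   eq = ⊥-elim (ℕ.even≢odd k j (sym eq))

Bead : Set
Bead = ℕ × Letter

upperBound : {A : Set} (f : A → ℕ) (xs : List A) → ∃[ z ] (∀ {x} → x ∈ xs → f x < z)
upperBound f []       = 0 , λ ()
upperBound f (x ∷ xs) with z , h ← upperBound f xs = suc (f x) ⊔ z , λ
  { (here refl) → ℕ.m≤m⊔n (suc (f x)) z
  ; (there x∈)  → ℕ.<-≤-trans (h x∈) (ℕ.m≤n⊔m (suc (f x)) z) }

module Keys (K : ℕ) where

  -- Types grow to the right and fall upwards. Equal unprimed letters occur once per column, so they
  -- are read from left to right; equal primed letters occur once per row, so they are read from
  -- bottom to top. Hence the two opposite directions.
  offset : Bead → ℕ
  offset (i , unprimed _) = i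
  offset (i , primed _)   = K ∸ suc i

  opaque

    -- A number in base `K`: the letter is the leading digit and the offset, which is below `K` for
    -- types below `K`, the last one.
    key : Bead → ℕ
    key (i , l) = rank l * K + offset (i , l)

  offset< : ∀ {i} → i < K → ∀ l → offset (i , l) < K
  offset< i<K (unprimed _) = i<K
  offset< {i} (s≤s i≤K) (primed _) = s≤s (ℕ.m∸n≤m _ i)

  opaque
    unfolding key

    key-< : ∀ {i j l m} → i < K → rank l < rank m → key (i , l) < key (j , m)
    key-< {i} {j} {l} {m} i<K l<m = begin-strict
      rank l * K + offset (i , l) <⟨ ℕ.+-monoʳ-< (rank l * K) (offset< i<K l) ⟩
      rank l * K + K              ≡⟨ ℕ.+-comm (rank l * K) K ⟩
      suc (rank l) * K            ≤⟨ ℕ.*-monoˡ-≤ K l<m ⟩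
      rank m * K                  ≤⟨ ℕ.m≤m+n _ _ ⟩
      rank m * K + offset (j , m) ∎
      where open ℕ.≤-Reasoning

  key-≤⇒rank-≤ : ∀ {i j l m} → j < K → key (i , l) ≤ key (j , m) → rank l ≤ rank m
  key-≤⇒rank-≤ {i} {j} {l} {m} j<K le = ℕ.≮⇒≥ λ m<l →
    ℕ.<⇒≱ (key-< {j} {i} {m} {l} j<K m<l) le

  opaque
    unfolding key

    key-≤-unprimed : ∀ {i j k} → key (i , unprimed k) ≤ key (j , unprimed k) → i ≤ j
    key-≤-unprimed {k = k} = ℕ.+-cancelˡ-≤ (rank (unprimed k) * K) _ _

  opaque
    unfolding key

    key-≤-primed : ∀ {i j k} → j < K → key (i , primed k) ≤ key (j , primed k) → j ≤ i
    key-≤-primed {i} {j} {k} j<K le = ℕ.≤-pred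
      (ℕ.∸-cancelʳ-≤ j<K (ℕ.+-cancelˡ-≤ (rank (primed k) * K) _ _ le))

  opaque
    unfolding key

    key-<-unprimed : ∀ {i j k} → i < j → key (i , unprimed k) < key (j , unprimed k)
    key-<-unprimed {k = k} = ℕ.+-monoʳ-< (rank (unprimed k) * K)

  opaque
    unfolding key

    key-<-primed : ∀ {i j k} → j < i → i < K → key (i , primed k) < key (j , primed k)
    key-<-primed {k = k} j<i i<K = ℕ.+-monoʳ-< (rank (primed k) * K) (ℕ.∸-monoʳ-< (s≤s j<i) i<K)

  -- A tie between the letters cannot be primed, by the last hypothesis, and between equal unprimed
  -- letters the larger type wins. `key-<-up` exchanges the roles of the two kinds of letters.
  key-<-right : ∀ {i j l m} → i < j → i < K → rank l ≤ rank m →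
                (∀ {k} → l ≡ primed k → m ≡ primed k → ⊥) → key (i , l) < key (j , m)
  key-<-right {i} {j} {l} {m} i<j i<K l≤m once with ℕ.m≤n⇒m<n∨m≡n l≤m
  ... | inj₁ l<m = key-< {i} {j} {l} {m} i<K l<m
  ... | inj₂ eq with rank-injective l m eq
  key-<-right {l = primed k}   i<j i<K l≤m once | inj₂ _ | refl = ⊥-elim (once refl refl)
  key-<-right {l = unprimed k} i<j i<K l≤m once | inj₂ _ | refl = key-<-unprimed {k = k} i<j

  key-<-up : ∀ {i j l m} → j < i → i < K → rank l ≤ rank m →
             (∀ {k} → l ≡ unprimed k → m ≡ unprimed k → ⊥) → key (i , l) < key (j , m)
  key-<-up {i} {j} {l} {m} j<i i<K l≤m once with ℕ.m≤n⇒m<n∨m≡n l≤m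
  ... | inj₁ l<m = key-< {i} {j} {l} {m} i<K l<m
  ... | inj₂ eq with rank-injective l m eq
  key-<-up {l = primed k}   j<i i<K l≤m once | inj₂ _ | refl = key-<-primed {k = k} j<i i<K
  key-<-up {l = unprimed k} j<i i<K l≤m once | inj₂ _ | refl = ⊥-elim (once refl refl)

  key-injective : ∀ {b c} → proj₁ b < K → proj₁ c < K → key b ≡ key c → b ≡ c
  key-injective {i , l} {j , m} i<K j<K eq
    with refl ← rank-injective l m (ℕ.≤-antisym
      (key-≤⇒rank-≤ {i} {j} {l} {m} j<K (ℕ.≤-reflexive eq))
      (key-≤⇒rank-≤ {j} {i} {m} {l} i<K (ℕ.≤-reflexive (sym eq)))) = cong (_, l) (type≡ l eq)
    where
    type≡ : ∀ l → key (i , l) ≡ key (j , l) → i ≡ j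
    type≡ (unprimed k) eq = ℕ.≤-antisym
      (key-≤-unprimed {k = k} (ℕ.≤-reflexive eq))
      (key-≤-unprimed {k = k} (ℕ.≤-reflexive (sym eq)))
    type≡ (primed k) eq = ℕ.≤-antisym
      (key-≤-primed {k = k} i<K (ℕ.≤-reflexive (sym eq)))
      (key-≤-primed {k = k} j<K (ℕ.≤-reflexive eq))

  ofType : ℕ → List Bead → List Bead
  ofType i = filter (λ b → proj₁ b ℕ.≟ i)

  opaque

    N : List Bead → ℕ → ℕ → ℕ
    N G i z = count (λ b → (proj₁ b ℕ.≟ i) ×-dec (key b ℕ.<? z)) G

    N≡count : ∀ G i z → N G i z ≡ count (λ b → (proj₁ b ℕ.≟ i) ×-dec (key b ℕ.<? z)) G
    N≡count G i z = refl

    N≡below : ∀ G i z → N G i z ≡ below key (ofType i G) z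
    N≡below G i z = sym (count-filter (λ b → proj₁ b ℕ.≟ i) (λ b → key b ℕ.<? z) G)

    N-mono : ∀ G i {z z′} → z ≤ z′ → N G i z ≤ N G i z′
    N-mono G i z≤ = count-mono _ _ G λ _ (t , p) → t , ℕ.<-≤-trans p z≤

    N-strict : ∀ {G i l z} → (i , l) ∈ G → key (i , l) < z → N G i (key (i , l)) < N G i z
    N-strict {G} b∈ b<z = count-strict _ _ G (λ _ (t , p) → t , ℕ.<-trans p b<z)
      b∈ (refl , b<z) λ (_ , p) → ℕ.<-irrefl refl p

    N-↭ : ∀ {G H} → G ↭ H → ∀ i z → N G i z ≡ N H i z
    N-↭ G↭H i z = count-↭ _ G↭H

    N-++ : ∀ G H i z → N (G ++ H) i z ≡ N G i z + N H i z
    N-++ G H i z = count-++ _ G H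

    N-none : ∀ G {i} z → (∀ {b} → b ∈ G → proj₁ b ≢ i) → N G i z ≡ 0
    N-none G z none = count-none _ G λ b∈ (eq , _) → none b∈ eq

  -- The common invariant: the beads of a domino tableau and those of a pair of Young tableaux
  -- satisfy it, and tableaux of both kinds are rebuilt from it. `total` reads off the number of
  -- beads of each type at any `z` past all keys.
  record Valid (m : ℕ → ℕ) (G : List Bead) : Set where
    field
      unique     : Unique G
      bounded    : ∀ {i l} → (i , l) ∈ G → i < K
      interlace≥ : ∀ i z → N G (2 + i) z ≤ N G i z
      interlace≤ : ∀ i z → N G i z ≤ suc (N G (2 + i) z)
      total      : ∀ i {z} → (∀ {b} → b ∈ G → key b < z) → N G i z ≡ m i

    key-inj : ∀ {b c} → b ∈ G → c ∈ G → key b ≡ key c → b ≡ c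
    key-inj b∈ c∈ = key-injective (bounded b∈) (bounded c∈)

    length-ofType : ∀ i → length (ofType i G) ≡ m i
    length-ofType i with z , h ← upperBound key G = begin
      length (ofType i G)      ≡⟨ cong length (sym (filter-all _ (All.tabulate λ b∈ → h (proj₁ (∈-filter⁻ (λ b → proj₁ b ℕ.≟ i) {xs = G} b∈))))) ⟩
      below key (ofType i G) z ≡⟨ N≡below G i z ⟨
      N G i z                  ≡⟨ total i h ⟩
      m i                      ∎
      where open ≡-Reasoning

    position< : ∀ {i l} → (i , l) ∈ G → N G i (key (i , l)) < m i
    position< {i} {l} b∈ with z , h ← upperBound key G =
      subst (N G i (key (i , l)) <_) (total i h) (N-strict b∈ (h b∈))

    at-position : ∀ i {q} → q < m i → ∃[ l ] (i , l) ∈ G × N G i (key (i , l)) ≡ q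
    at-position i {q} q<
      with (j , l) , b∈ , eq ← select key (ofType i G)
             (unique-map (Unique.filter⁺ _ unique) λ b∈ c∈ →
               key-inj (proj₁ (∈-filter⁻ (λ b → proj₁ b ℕ.≟ i) {xs = G} b∈))
                       (proj₁ (∈-filter⁻ (λ b → proj₁ b ℕ.≟ i) {xs = G} c∈)))
             (subst (q <_) (sym (length-ofType i)) q<)
      with l∈ , refl ← ∈-filter⁻ (λ b → proj₁ b ℕ.≟ i) {xs = G} b∈ =
      l , l∈ , trans (N≡below G i _) eq

-- Order ideals and the lengths of their diagonals

-- The cells weakly right of the main diagonal with key below z form an
-- order ideal, so on each diagonal they are an initial segment.
module Ideal
  (C : List (Cell × ℕ)) (unique : Unique (map proj₁ C))
  (left : ∀ {x y κ} → ((suc x , y) , κ) ∈ C → y ≤ x → ∃[ κ′ ] κ′ ≤ κ × ((x , y) , κ′) ∈ C)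
  (down : ∀ {x y κ} → ((x , suc y) , κ) ∈ C → suc y ≤ x → ∃[ κ′ ] κ′ ≤ κ × ((x , y) , κ′) ∈ C)
  (diag : ∀ {x y κ} → ((suc x , suc y) , κ) ∈ C → y ≤ x → ∃[ κ′ ] κ′ < κ × ((x , y) , κ′) ∈ C)
  where

  OnBelow : ℕ → ℕ → Cell × ℕ → Set
  OnBelow e z (c , κ) = col c ≡ row c + e × κ < z

  onBelow? : ∀ e z → Decidable (OnBelow e z)
  onBelow? e z (c , κ) = (col c ℕ.≟ row c + e) ×-dec (κ ℕ.<? z)

  n : ℕ → ℕ → ℕ
  n e z = count (onBelow? e z) C

  private
    rowsOf : ℕ → ℕ → List ℕ
    rowsOf e z = map (row ∘ proj₁) (filter (onBelow? e z) C)

    length-rowsOf : ∀ e z → length (rowsOf e z) ≡ n e z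
    length-rowsOf e z = length-map _ (filter (onBelow? e z) C)

    ∈-rows⁻ : ∀ {e z q} → q ∈ rowsOf e z → ∃[ κ ] κ < z × ((q + e , q) , κ) ∈ C
    ∈-rows⁻ {e} {z} q∈ with _ , p∈ , refl ← ∈-map⁻ (row ∘ proj₁) q∈
      with c∈ , refl , lt ← ∈-filter⁻ (onBelow? e z) {xs = C} p∈ = _ , lt , c∈

    ∈-rows⁺ : ∀ {e z q κ} → κ < z → ((q + e , q) , κ) ∈ C → q ∈ rowsOf e z
    ∈-rows⁺ {e} {z} lt c∈ = ∈-map⁺ (row ∘ proj₁) (∈-filter⁺ (onBelow? e z) c∈ (refl , lt))

    unique-rows : ∀ e z → Unique (rowsOf e z)
    unique-rows e z = unique-map (Unique.filter⁺ _ (Unique.map⁻ unique)) λ p∈ q∈ eq →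
      let c∈ , ec , _ = ∈-filter⁻ (onBelow? e z) {xs = C} p∈
          d∈ , ed , _ = ∈-filter⁻ (onBelow? e z) {xs = C} q∈
      in unique-map-injective unique c∈ d∈
           (cong₂ _,_ (trans ec (trans (cong (_+ e) eq) (sym ed))) eq)

    closed : ∀ {e z q} → suc q ∈ rowsOf e z → q ∈ rowsOf e z
    closed q∈ with κ , lt , c∈ ← ∈-rows⁻ q∈ with κ′ , lt′ , d∈ ← diag c∈ (ℕ.m≤m+n _ _) =
      ∈-rows⁺ (ℕ.<-trans lt′ lt) d∈

  n⁻ : ∀ {e z q} → q < n e z → ∃[ κ ] κ < z × ((q + e , q) , κ) ∈ C
  n⁻ {e} {z} {q} q< = ∈-rows⁻ (segment⁺ (unique-rows e z) closed
    (subst (q <_) (sym (length-rowsOf e z)) q<))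

  n⁺ : ∀ {e z q κ} → κ < z → ((q + e , q) , κ) ∈ C → q < n e z
  n⁺ {e} {z} {q} lt c∈ = subst (q <_) (length-rowsOf e z)
    (segment⁻ (unique-rows e z) closed (∈-rows⁺ lt c∈))

  -- Along a diagonal the keys increase strictly with the row, so the smaller keys on it are exactly
  -- those of the lower rows.
  position : ∀ {e y κ} → ((y + e , y) , κ) ∈ C → n e κ ≡ y
  position {e} {y} {κ} c∈ = ℕ.≤-antisym (ℕ.≮⇒≥ no-more) (all-below y c∈)
    where
    no-more : ¬ (y < n e κ)
    no-more y< with κ′ , lt , d∈ ← n⁻ y<
      with refl ← unique-map-injective unique c∈ d∈ refl = ℕ.<-irrefl refl lt

    all-below : ∀ y → ((y + e , y) , κ) ∈ C → y ≤ n e κ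
    all-below zero    _  = z≤n
    all-below (suc y) c∈ with κ′ , lt , d∈ ← diag c∈ (ℕ.m≤m+n _ _) = n⁺ lt d∈

  -- One step to the left leads from diagonal e + 1 to diagonal e in the same row and does not raise
  -- the key.
  n-anti : ∀ e z → n (suc e) z ≤ n e z
  n-anti e z = below⇒≤ λ {q} q< → case n⁻ q< of λ (κ , lt , c∈) →
    case left (subst (λ x → ((x , q) , κ) ∈ C) (ℕ.+-suc q e) c∈) (ℕ.m≤m+n q e) of λ
      (κ′ , le , d∈) → n⁺ (ℕ.≤-<-trans le lt) d∈
    where
    below⇒≤ : ∀ {a b} → (∀ {q} → q < a → q < b) → a ≤ b
    below⇒≤ {zero}  f = z≤n
    below⇒≤ {suc a} f = f ℕ.≤-refl

  -- One step down leads from diagonal e to diagonal e + 1 and lowers the row by one, whence the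
  -- loss of at most one.
  n-step : ∀ e z → n e z ≤ suc (n (suc e) z)
  n-step e z = below⇒≤suc λ {q} q< → case n⁻ q< of λ (κ , lt , c∈) →
    case down c∈ (s≤s (ℕ.m≤m+n q e)) of λ
      (κ′ , le , d∈) → n⁺ (ℕ.≤-<-trans le lt)
        (subst (λ x → ((x , q) , κ′) ∈ C) (sym (ℕ.+-suc q e)) d∈)
    where
    below⇒≤suc : ∀ {a b} → (∀ {q} → suc q < a → q < b) → a ≤ suc b
    below⇒≤suc {zero}        f = z≤n
    below⇒≤suc {suc zero}    f = s≤s z≤n
    below⇒≤suc {suc (suc a)} f = s≤s (f ℕ.≤-refl)

-- Cells of a diagram and labels of a filling

inUp⁺ : ∀ {x y} → x < y → InUp (x , y)
inUp⁺ {x} {y} x<y = subst (ℤ._< (y ℤ.⊖ x)) (ℤ.n⊖n≡0 x) (ℤ.⊖-monoˡ-< x x<y)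

inUp⁻ : ∀ {x y} → InUp (x , y) → x < y
inUp⁻ {x} {y} up = ℕ.≰⇒> λ y≤x →
  ℤ.<⇒≱ up (subst (y ℤ.⊖ x ℤ.≤_) (ℤ.n⊖n≡0 x) (ℤ.⊖-monoˡ-≤ x y≤x))

module _ {P : Set} where

  ∈-labelled⁺ : ∀ {t : Filling P} {p l} → (p , just l) ∈ t → (p , l) ∈ labelled t
  ∈-labelled⁺ {(_ , just _)  ∷ t} (here refl) = here refl
  ∈-labelled⁺ {(_ , just _)  ∷ t} (there i)   = there (∈-labelled⁺ i)
  ∈-labelled⁺ {(_ , nothing) ∷ t} (there i)   = ∈-labelled⁺ i

  ∈-labelled⁻ : ∀ (t : Filling P) {p l} → (p , l) ∈ labelled t → (p , just l) ∈ t
  ∈-labelled⁻ ((_ , just _)  ∷ t) (here refl) = here refl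
  ∈-labelled⁻ ((_ , just _)  ∷ t) (there i)   = there (∈-labelled⁻ t i)
  ∈-labelled⁻ ((_ , nothing) ∷ t) i           = there (∈-labelled⁻ t i)

  labelled-unique : ∀ {t : Filling P} → Unique t → Unique (labelled t)
  labelled-unique {[]}                []      = []
  labelled-unique {(_ , nothing) ∷ t} (_ ∷ u) = labelled-unique u
  labelled-unique {(p , just l) ∷ t} (p∉ ∷ u) =
    All.tabulate (λ { q∈ refl → All.lookup p∉ (∈-labelled⁻ t q∈) refl }) ∷ labelled-unique u

cellsFrom-row : ∀ y₀ rs {x y} → (x , y) ∈ cellsFrom y₀ rs → y₀ ≤ y
cellsFrom-row y₀ (r ∷ rs) c∈ with ∈-++⁻ (map (_, y₀) (upTo r)) c∈
... | inj₁ p with _ , _ , refl ← ∈-map⁻ (_, y₀) p = ℕ.≤-refl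
... | inj₂ p = ℕ.<⇒≤ (cellsFrom-row (suc y₀) rs p)

cellsFrom-unique : ∀ y₀ rs → Unique (cellsFrom y₀ rs)
cellsFrom-unique y₀ []       = []
cellsFrom-unique y₀ (r ∷ rs) = Unique.++⁺
  (Unique.map⁺ (cong proj₁) (Unique.upTo⁺ r)) (cellsFrom-unique (suc y₀) rs)
  λ (p , q) → case ∈-map⁻ (_, y₀) p of λ { (_ , _ , refl) →
    ℕ.<-irrefl refl (cellsFrom-row (suc y₀) rs q) }

cells-unique : ∀ sh → Unique (cells sh)
cells-unique = cellsFrom-unique 0

-- `m k` is the length of the diagonal x - y = k. The rows met by such a diagonal start at 0, so its
-- length tells which of its cells are present.
record Lower (sh : List ℕ) (m : ℕ → ℕ) : Set where
  field
    leftClosed : ∀ {x y} → (suc x , y) ∈ cells sh → (x , y) ∈ cells sh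
    downClosed : ∀ {x y} → (x , suc y) ∈ cells sh → (x , y) ∈ cells sh
    mem⁺ : ∀ k {y} → y < m k → (y + k , y) ∈ cells sh
    mem⁻ : ∀ k {y} → (y + k , y) ∈ cells sh → y < m k

below⇒≤ : ∀ {a b} → (∀ {q} → q < a → q < b) → a ≤ b
below⇒≤ {zero}  f = z≤n
below⇒≤ {suc a} f = f ℕ.≤-refl

-- Shifted Young tableaux as sets of beads

module Young (K : ℕ) (τ : ℕ → ℕ) (τ-suc : ∀ k → τ (suc k) ≡ 2 + τ k) where

  open Keys K

  τ-mono : ∀ {j k} → j < k → τ j < τ k
  τ-mono {j} {suc k} (s≤s j≤k) rewrite τ-suc k with ℕ.m≤n⇒m<n∨m≡n j≤k
  ... | inj₁ j<k  = ℕ.<-trans (τ-mono j<k) (s≤s (ℕ.n≤1+n _))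
  ... | inj₂ refl = s≤s (ℕ.n≤1+n _)

  τ-injective : ∀ {j k} → τ j ≡ τ k → j ≡ k
  τ-injective {j} {k} eq with ℕ.<-cmp j k
  ... | tri< lt _ _ = ⊥-elim (ℕ.<-irrefl eq (τ-mono lt))
  ... | tri≈ _ e _  = e
  ... | tri> _ _ gt = ⊥-elim (ℕ.<-irrefl (sym eq) (τ-mono gt))

  -- `τ` is `dbl` for one quotient and `suc ∘ dbl` for the other, so the beads of both can be merged
  -- without losing their origin.
  cellBead : Cell × Letter → Bead
  cellBead ((x , y) , l) = τ (x ∸ y) , l

  youngBeads : Filling Cell → List Bead
  youngBeads t = map cellBead (labelled t)

  module FromTableau {sh m} (L : Lower sh m) (bound : ∀ k → 0 < m k → τ k < K)
                     (T : ShiftedYoungTableau sh) where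

    open Lower L
    open ShiftedYoungTableau T renaming (filling to t)
    open IsTableau isTableau

    unique-cells : Unique (map proj₁ t)
    unique-cells = subst Unique (sym shape) (cells-unique sh)

    functional : ∀ {c l m} → (c , l) ∈ labelled t → (c , m) ∈ labelled t → l ≡ m
    functional p q with refl ← unique-map-injective unique-cells (∈-labelled⁻ t p) (∈-labelled⁻ t q) refl = refl

    inside : ∀ {c l} → (c , l) ∈ labelled t → c ∈ cells sh
    inside {c} p = subst (c ∈_) shape (∈-map⁺ proj₁ (∈-labelled⁻ t p))

    lower : ∀ {x y l} → ((x , y) , l) ∈ labelled t → y ≤ x
    lower p = ℕ.≮⇒≥ λ x<y → case up (∈-labelled⁻ t p) (inUp⁺ x<y) of λ ()

    label : ∀ {x y} → (x , y) ∈ cells sh → y ≤ x → ∃[ l ] ((x , y) , l) ∈ labelled t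
    label {x} {y} c∈ y≤x with ∈-map⁻ proj₁ (subst ((x , y) ∈_) (sym shape) c∈)
    ... | (_ , just l) , p , refl = l , ∈-labelled⁺ p
    ... | (_ , nothing) , p , refl with () ← down p (λ u → ℕ.<⇒≱ (inUp⁻ u) y≤x)

    type< : ∀ {x y l} → ((x , y) , l) ∈ labelled t → τ (x ∸ y) < K
    type< {x} {y} p = bound (x ∸ y) (ℕ.≤-<-trans z≤n (mem⁻ (x ∸ y)
      (subst (λ v → (v , y) ∈ cells sh) (sym (ℕ.m+[n∸m]≡n (lower p))) (inside p))))

    keyed : Cell × Letter → Cell × ℕ
    keyed u = proj₁ u , key (cellBead u)

    C : List (Cell × ℕ)
    C = map keyed (labelled t)

    C-unique : Unique (map proj₁ C)
    C-unique = unique-map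
      (unique-map (labelled-unique (Unique.map⁻ unique-cells))
        λ { p q refl₁ → inj p q (cong proj₁ refl₁) })
      λ p q eq → case ∈-map⁻ keyed p of λ { (u , u∈ , refl) →
        case ∈-map⁻ keyed q of λ { (v , v∈ , refl) → cong keyed (inj u∈ v∈ eq) } }
      where
      inj : ∀ {u v} → u ∈ labelled t → v ∈ labelled t → proj₁ u ≡ proj₁ v → u ≡ v
      inj {c , _} p q refl = cong (c ,_) (functional p q)

    right-step : ∀ {x y l} → ((suc x , y) , l) ∈ labelled t → y ≤ x →
                 ∃[ l′ ] ((x , y) , l′) ∈ labelled t × key (τ (x ∸ y) , l′) < key (τ (suc x ∸ y) , l)
    right-step {x} {y} {l} p y≤x with l′ , q ← label (leftClosed (inside p)) y≤x =
      l′ , q , key-<-right {l = l′} {m = l} (τ-mono (ℕ.∸-monoˡ-< (s≤s ℕ.≤-refl) y≤x)) (type< q)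
        (rows q p (here refl) (here refl) refl ℕ.≤-refl)
        λ { refl refl → case primedOnce q p (here refl) (here refl) refl of λ () }

    up-step : ∀ {x y l} → ((x , suc y) , l) ∈ labelled t →
              ∃[ l′ ] ((x , y) , l′) ∈ labelled t × key (τ (x ∸ y) , l′) < key (τ (x ∸ suc y) , l)
    up-step {x} {y} {l} p with l′ , q ← label (downClosed (inside p)) (ℕ.<⇒≤ (lower p)) =
      l′ , q , key-<-up {l = l′} {m = l} (τ-mono (ℕ.∸-monoʳ-< (ℕ.n<1+n y) (lower p))) (type< q)
        (columns q p (here refl) (here refl) refl ℕ.≤-refl)
        λ { refl refl → case unprimedOnce q p (here refl) (here refl) refl of λ () }

    fromC : ∀ {c κ} → (c , κ) ∈ C → ∃[ l ] (c , l) ∈ labelled t × κ ≡ key (cellBead (c , l))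
    fromC p with (_ , l) , q , refl ← ∈-map⁻ keyed p = l , q , refl

    left-step : ∀ {x y κ} → ((suc x , y) , κ) ∈ C → y ≤ x → ∃[ κ′ ] κ′ < κ × ((x , y) , κ′) ∈ C
    left-step p y≤x with l , q , refl ← fromC p with l′ , r , lt ← right-step q y≤x =
      _ , lt , ∈-map⁺ keyed r

    down-step : ∀ {x y κ} → ((x , suc y) , κ) ∈ C → ∃[ κ′ ] κ′ < κ × ((x , y) , κ′) ∈ C
    down-step p with l , q , refl ← fromC p with l′ , r , lt ← up-step q = _ , lt , ∈-map⁺ keyed r

    left-C : ∀ {x y κ} → ((suc x , y) , κ) ∈ C → y ≤ x → ∃[ κ′ ] κ′ ≤ κ × ((x , y) , κ′) ∈ C
    left-C p y≤x = let κ , lt , q = left-step p y≤x in κ , ℕ.<⇒≤ lt , q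

    down-C : ∀ {x y κ} → ((x , suc y) , κ) ∈ C → suc y ≤ x → ∃[ κ′ ] κ′ ≤ κ × ((x , y) , κ′) ∈ C
    down-C p _ = let κ , lt , q = down-step p in κ , ℕ.<⇒≤ lt , q

    diag-C : ∀ {x y κ} → ((suc x , suc y) , κ) ∈ C → y ≤ x → ∃[ κ′ ] κ′ < κ × ((x , y) , κ′) ∈ C
    diag-C p y≤x =
      let κ , lt , q = down-step p
          κ′ , lt′ , r = left-step q y≤x
      in κ′ , ℕ.<-trans lt′ lt , r

    open Ideal C C-unique left-C down-C diag-C

    G : List Bead
    G = youngBeads t

    n≡N : ∀ k z → n k z ≡ N G (τ k) z
    n≡N k z = begin
      n k z                                          ≡⟨ count-map keyed (onBelow? k z) (labelled t) ⟩
      count (λ u → onBelow? k z (keyed u)) (labelled t)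
        ≡⟨ count-cong (λ u → onBelow? k z (keyed u))
             (λ u → (proj₁ (cellBead u) ℕ.≟ τ k) ×-dec (key (cellBead u) ℕ.<? z)) (labelled t)
             (λ { {(x , y) , l} p (eq , lt) → cong τ (trans (cong (_∸ y) eq) (ℕ.m+n∸m≡n y k)) , lt })
             (λ { {(x , y) , l} p (eq , lt) →
                trans (sym (ℕ.m+[n∸m]≡n (lower p))) (cong (y +_) (τ-injective eq)) , lt }) ⟩
      count (λ u → (proj₁ (cellBead u) ℕ.≟ τ k) ×-dec (key (cellBead u) ℕ.<? z)) (labelled t)
        ≡⟨ count-map cellBead (λ b → (proj₁ b ℕ.≟ τ k) ×-dec (key b ℕ.<? z)) (labelled t) ⟨
      count (λ b → (proj₁ b ℕ.≟ τ k) ×-dec (key b ℕ.<? z)) G ≡⟨ N≡count G (τ k) z ⟨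
      N G (τ k) z ∎
      where open ≡-Reasoning

    row≡N : ∀ {x y l} → ((x , y) , l) ∈ labelled t → N G (τ (x ∸ y)) (key (τ (x ∸ y) , l)) ≡ y
    row≡N {x} {y} {l} p = trans (sym (n≡N (x ∸ y) _)) (position
      (subst (λ v → ((v , y) , key (τ (x ∸ y) , l)) ∈ C) (sym (ℕ.m+[n∸m]≡n (lower p))) (∈-map⁺ keyed p)))

    N-anti : ∀ k z → N G (τ (suc k)) z ≤ N G (τ k) z
    N-anti k z = subst₂ _≤_ (n≡N (suc k) z) (n≡N k z) (n-anti k z)

    N-step : ∀ k z → N G (τ k) z ≤ suc (N G (τ (suc k)) z)
    N-step k z = subst₂ _≤_ (n≡N k z) (cong suc (n≡N (suc k) z)) (n-step k z)

    N-total : ∀ k {z} → (∀ {b} → b ∈ G → key b < z) → N G (τ k) z ≡ m k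
    N-total k {z} h = trans (sym (n≡N k z)) (ℕ.≤-antisym
      (below⇒≤ λ q< → case n⁻ q< of λ (κ , _ , c∈) → case fromC c∈ of λ (_ , p , _) → mem⁻ k (inside p))
      (below⇒≤ λ {q} q< → case label (mem⁺ k q<) (ℕ.m≤m+n q k) of λ (l , p) →
         n⁺ (h (∈-map⁺ cellBead p)) (∈-map⁺ keyed p)))

    bead⁻ : ∀ {b} → b ∈ G → ∃[ k ] ∃[ l ] b ≡ (τ k , l) × τ k < K
    bead⁻ b∈ with ((x , y) , l) , p , refl ← ∈-map⁻ cellBead b∈ = x ∸ y , l , refl , type< p

    -- The type of a bead gives the diagonal of its cell, and the number of smaller beads of that
    -- type gives its row; two cells cannot share a bead.
    G-unique : Unique G
    G-unique = unique-map (labelled-unique (Unique.map⁻ unique-cells)) inj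
      where
      inj : ∀ {u v} → u ∈ labelled t → v ∈ labelled t → cellBead u ≡ cellBead v → u ≡ v
      inj {(x , y) , l} {(x′ , y′) , l′} p q eq = cong₂ _,_ (cong₂ _,_ x≡x′ y≡y′) (cong proj₂ eq)
        where
        k≡k′ = τ-injective (cong proj₁ eq)
        y≡y′ : y ≡ y′
        y≡y′ = trans (sym (row≡N p))
          (trans (cong (λ b → N G (proj₁ b) (key b)) eq) (row≡N q))
        x≡x′ : x ≡ x′
        x≡x′ = trans (sym (ℕ.m+[n∸m]≡n (lower p))) (trans (cong₂ _+_ y≡y′ k≡k′) (ℕ.m+[n∸m]≡n (lower q)))

  module _ {sh m} (L : Lower sh m) (bound : ∀ k → 0 < m k → τ k < K) where

    -- Each letter sits in the cell that the beads dictate, and `X` fills the remaining cells of the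
    -- common shape.
    young-determined : (T U : ShiftedYoungTableau sh) → let open ShiftedYoungTableau in
                       youngBeads (filling T) ↭ youngBeads (filling U) → filling T ≡ filling U
    young-determined T U T↭U = filling-≡ T′.unique-cells (trans (shape T) (sym (shape U))) transfer
      where
      open ShiftedYoungTableau
      module T′ = FromTableau L bound T
      module U′ = FromTableau L bound U

      filling-≡ : ∀ {t u : Filling Cell} → Unique (map proj₁ t) → map proj₁ t ≡ map proj₁ u →
                  (∀ {c e} → (c , e) ∈ t → (c , e) ∈ u) → t ≡ u
      filling-≡ {[]} {[]} _ _ _ = refl
      filling-≡ {(c , e) ∷ t} {(d , f) ∷ u} (c∉ ∷ un) eq sub with refl ← ∷-injectiveˡ eq =
        cong₂ _∷_ (first (sub (here refl))) (filling-≡ un (∷-injectiveʳ eq) λ p → rest p (sub (there p)))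
        where
        first : (c , e) ∈ (c , f) ∷ u → (c , e) ≡ (c , f)
        first (here eq) = eq
        first (there p) = contradiction refl
          (All.lookup c∉ (subst (c ∈_) (sym (∷-injectiveʳ eq)) (∈-map⁺ proj₁ p)))
        rest : ∀ {x} → x ∈ t → x ∈ (c , f) ∷ u → x ∈ u
        rest p (there q)   = q
        rest p (here refl) = contradiction refl (All.lookup c∉ (∈-map⁺ proj₁ p))

      beadRow : ∀ {c d l} → (c , l) ∈ labelled (filling T) → (d , l) ∈ labelled (filling U) →
                cellBead (c , l) ≡ cellBead (d , l) → c ≡ d
      beadRow {x , y} {x′ , y′} {l} p q eq = cong₂ _,_
        (trans (sym (ℕ.m+[n∸m]≡n (T′.lower p)))
          (trans (cong₂ _+_ y≡y′ (τ-injective (cong proj₁ eq))) (ℕ.m+[n∸m]≡n (U′.lower q)))) y≡y′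
        where
        y≡y′ : y ≡ y′
        y≡y′ = trans (sym (T′.row≡N p)) (trans (N-↭ T↭U _ _)
          (trans (cong (λ b → N U′.G (proj₁ b) (key b)) eq) (U′.row≡N q)))

      same-cell : ∀ {c l u} → (c , l) ∈ labelled (filling T) → u ∈ labelled (filling U) →
                  cellBead (c , l) ≡ cellBead u → (c , just l) ∈ filling U
      same-cell {c} {l} {d , m} p q eq = subst (λ v → (v , just l) ∈ filling U) (sym (beadRow p q′ eq′))
        (∈-labelled⁻ (filling U) q′)
        where
        l≡m : l ≡ m
        l≡m = cong proj₂ eq
        q′ : (d , l) ∈ labelled (filling U)
        q′ = subst (λ n → (d , n) ∈ labelled (filling U)) (sym l≡m) q
        eq′ : cellBead (c , l) ≡ cellBead (d , l)
        eq′ = cong (_, l) (cong proj₁ eq)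

      same-X : ∀ {c} {u : Cell × Entry} → (c , X) ∈ filling T → u ∈ filling U → c ≡ proj₁ u →
               (c , X) ∈ filling U
      same-X {u = _ , nothing} p q refl = q
      same-X {u = (x , y) , just l} p q refl
        with () ← IsTableau.down (isTableau T) p (λ u → ℕ.<⇒≱ (inUp⁻ u) (U′.lower (∈-labelled⁺ q)))

      transfer : ∀ {c e} → (c , e) ∈ filling T → (c , e) ∈ filling U
      transfer {c} {just l} p =
        let _ , q , eq = ∈-map⁻ cellBead (∈-resp-↭ T↭U (∈-map⁺ cellBead (∈-labelled⁺ p)))
        in same-cell (∈-labelled⁺ p) q eq
      transfer {c} {nothing} p =
        let _ , q , eq = ∈-map⁻ proj₁
              (subst (c ∈_) (trans (shape T) (sym (shape U))) (∈-map⁺ proj₁ p))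
        in same-X p q eq

    module FromBeads {M G} (V : Valid M G) (M≡ : ∀ k → M (τ k) ≡ m k) where

      open Lower L
      open Valid V

      -- Forced by `row≡N`: row y of a diagonal must hold the bead that has y smaller ones of its
      -- type.
      entryAt : Cell → Entry
      entryAt (x , y) with y ℕ.≤? x | y ℕ.<? M (τ (x ∸ y))
      ... | yes _ | yes y< = just (proj₁ (at-position (τ (x ∸ y)) y<))
      ... | _     | _      = X

      t : Filling Cell
      t = map (λ c → c , entryAt c) (cells sh)

      shape : map proj₁ t ≡ cells sh
      shape = trans (sym (map-∘ (cells sh))) (map-id (cells sh))

      Placed : Cell → Letter → Set
      Placed (x , y) l = y ≤ x × (τ (x ∸ y) , l) ∈ G × N G (τ (x ∸ y)) (key (τ (x ∸ y) , l)) ≡ y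

      entry⁻ : ∀ c {l} → entryAt c ≡ just l → Placed c l
      entry⁻ (x , y) eq with y ℕ.≤? x | y ℕ.<? M (τ (x ∸ y))
      entry⁻ (x , y) refl | yes y≤x | yes y< =
        let _ , b∈ , r = at-position (τ (x ∸ y)) y< in y≤x , b∈ , r

      entry⁺ : ∀ c → proj₂ c ≤ proj₁ c → c ∈ cells sh → ∃[ l ] entryAt c ≡ just l
      entry⁺ (x , y) y≤x c∈ with y ℕ.≤? x | y ℕ.<? M (τ (x ∸ y))
      ... | yes _  | yes _ = _ , refl
      ... | no y≰x | _     = ⊥-elim (y≰x y≤x)
      ... | yes _  | no y≮ = ⊥-elim (y≮ (subst (y <_) (sym (M≡ (x ∸ y))) (mem⁻ (x ∸ y)
        (subst (λ v → (v , y) ∈ cells sh) (sym (ℕ.m+[n∸m]≡n y≤x)) c∈))))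

      labelled⁻ : ∀ {c l} → (c , l) ∈ labelled t → Placed c l
      labelled⁻ p with c , c∈ , eq ← ∈-map⁻ (λ c → c , entryAt c) (∈-labelled⁻ t p)
        with refl ← cong proj₁ eq = entry⁻ c (sym (cong proj₂ eq))

      placed-injective : ∀ {c l l′} → Placed c l → Placed c l′ → l ≡ l′
      placed-injective {x , y} {l} {l′} (_ , b∈ , r) (_ , b∈′ , r′)
        with ℕ.<-cmp (key (τ (x ∸ y) , l)) (key (τ (x ∸ y) , l′))
      ... | tri< lt _ _ = ⊥-elim (ℕ.<-irrefl (trans r (sym r′)) (N-strict b∈ lt))
      ... | tri≈ _ e _  = cong proj₂ (key-inj b∈ b∈′ e)
      ... | tri> _ _ gt = ⊥-elim (ℕ.<-irrefl (trans r′ (sym r)) (N-strict b∈′ gt))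

      labelled⁺ : ∀ {k l} → (τ k , l) ∈ G →
                  ((N G (τ k) (key (τ k , l)) + k , N G (τ k) (key (τ k , l))) , l) ∈ labelled t
      labelled⁺ {k} {l} b∈ = ∈-labelled⁺ (subst (λ e → ((y + k , y) , e) ∈ t) entry (∈-map⁺ _ c∈))
        where
        y = N G (τ k) (key (τ k , l))
        c∈ : (y + k , y) ∈ cells sh
        c∈ = mem⁺ k (subst (y <_) (M≡ k) (position< b∈))
        entry : entryAt (y + k , y) ≡ just l
        entry with l′ , eq ← entry⁺ (y + k , y) (ℕ.m≤m+n y k) c∈ = trans eq
          (cong just (placed-injective (entry⁻ (y + k , y) eq)
            (ℕ.m≤m+n y k , subst (λ d → (τ d , l) ∈ G × N G (τ d) (key (τ d , l)) ≡ y)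
                             (sym (ℕ.m+n∸m≡n y k)) (b∈ , refl))))

      N-anti : ∀ {j k} z → j ≤ k → N G (τ k) z ≤ N G (τ j) z
      N-anti {j} {zero}  z z≤n = ℕ.≤-refl
      N-anti {j} {suc k} z j≤ with ℕ.m≤n⇒m<n∨m≡n j≤
      ... | inj₂ refl     = ℕ.≤-refl
      ... | inj₁ (s≤s j≤k) = ℕ.≤-trans
        (subst (λ i → N G i z ≤ N G (τ k) z) (sym (τ-suc k)) (interlace≥ (τ k) z)) (N-anti z j≤k)

      N-steps : ∀ j d z → N G (τ j) z ≤ d + N G (τ (d + j)) z
      N-steps j zero    z = ℕ.≤-refl
      N-steps j (suc d) z = begin
        N G (τ j) z                         ≤⟨ N-steps j d z ⟩
        d + N G (τ (d + j)) z               ≤⟨ ℕ.+-monoʳ-≤ d (interlace≤ (τ (d + j)) z) ⟩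
        d + suc (N G (2 + τ (d + j)) z)     ≡⟨ ℕ.+-suc d _ ⟩
        suc d + N G (2 + τ (d + j)) z       ≡⟨ cong (λ i → suc d + N G i z) (τ-suc (d + j)) ⟨
        suc d + N G (τ (suc d + j)) z       ∎
        where open ℕ.≤-Reasoning

      -- If the right bead came first, it and the y smaller beads of its type would all lie below
      -- the key of the left one. Interlacing allows a type further right no more beads there than
      -- the left type has, which is y.
      row-order : ∀ {x x′ y l l′} → Placed (x , y) l → Placed (x′ , y) l′ → x < x′ →
                  key (τ (x ∸ y) , l) < key (τ (x′ ∸ y) , l′)
      row-order {x} {x′} {y} {l} {l′} (y≤x , b∈ , r) (y≤x′ , b∈′ , r′) x<x′ = ℕ.≰⇒> λ z′≤z →
        case ℕ.m≤n⇒m<n∨m≡n z′≤z of λ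
        { (inj₂ eq) → ℕ.<-irrefl (sym (cong proj₁ (key-inj b∈′ b∈ eq))) (τ-mono k<k′)
        ; (inj₁ z′<z) → ℕ.<-irrefl refl (begin-strict
            y                             ≡⟨ r′ ⟨
            N G (τ (x′ ∸ y)) (key _)      <⟨ N-strict b∈′ z′<z ⟩
            N G (τ (x′ ∸ y)) (key (τ (x ∸ y) , l)) ≤⟨ N-anti _ (ℕ.<⇒≤ k<k′) ⟩
            N G (τ (x ∸ y)) (key (τ (x ∸ y) , l)) ≡⟨ r ⟩
            y                             ∎) }
        where
        open ℕ.≤-Reasoning
        k<k′ = ℕ.∸-monoˡ-< x<x′ y≤x

      -- Here the other interlacing inequality is used. It costs one bead per diagonal, and the two
      -- cells are y′ - y diagonals and as many rows apart.
      column-order : ∀ {x y y′ l l′} → Placed (x , y) l → Placed (x , y′) l′ → y < y′ →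
                     key (τ (x ∸ y) , l) < key (τ (x ∸ y′) , l′)
      column-order {x} {y} {y′} {l} {l′} (y≤x , b∈ , r) (y′≤x , b∈′ , r′) y<y′ = ℕ.≰⇒> λ z′≤z →
        case ℕ.m≤n⇒m<n∨m≡n z′≤z of λ
        { (inj₂ eq) → ℕ.<-irrefl (cong proj₁ (key-inj b∈′ b∈ eq)) (τ-mono k′<k)
        ; (inj₁ z′<z) → ℕ.<-irrefl refl (begin-strict
            y′                                                  ≡⟨ r′ ⟨
            N G (τ k′) z′                                       <⟨ N-strict b∈′ ℕ.≤-refl ⟩
            -- `suc z′` is the least bound that counts the bead of the upper cell itself, and it is
            -- still at most the key of the lower cell.
            N G (τ k′) (suc z′)                                 ≤⟨ N-steps k′ (y′ ∸ y) (suc z′) ⟩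
            (y′ ∸ y) + N G (τ ((y′ ∸ y) + k′)) (suc z′)
              ≡⟨ cong (λ d → (y′ ∸ y) + N G (τ d) (suc z′)) k≡ ⟩
            (y′ ∸ y) + N G (τ k) (suc z′)                       ≤⟨ ℕ.+-monoʳ-≤ (y′ ∸ y) (N-mono G (τ k) z′<z) ⟩
            (y′ ∸ y) + N G (τ k) (key (τ k , l))                ≡⟨ cong ((y′ ∸ y) +_) r ⟩
            (y′ ∸ y) + y                                        ≡⟨ ℕ.m∸n+n≡m (ℕ.<⇒≤ y<y′) ⟩
            y′                                                  ∎) }
        where
        open ℕ.≤-Reasoning
        k = x ∸ y
        k′ = x ∸ y′
        z′ = key (τ k′ , l′)
        k′<k : k′ < k
        k′<k = ℕ.∸-monoʳ-< y<y′ y′≤x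
        k≡ : (y′ ∸ y) + k′ ≡ k
        k≡ = trans (sym (ℕ.+-∸-comm k′ (ℕ.<⇒≤ y<y′))) (cong (_∸ y) (ℕ.m+[n∸m]≡n y′≤x))

      tableau : IsShiftedYoungTableau t
      tableau = record
        { up   = λ { p u → case ∈-map⁻ (λ c → c , entryAt c) p of λ { (c , c∈ , refl) → no-label c u } }
        ; down = λ { p u → case ∈-map⁻ (λ c → c , entryAt c) p of λ { (c , c∈ , refl) → has-label c c∈ u } }
        ; rows = λ { {c , _} {d , _} p q (here refl) (here refl) refl lt → rank≤ (labelled⁻ p) (labelled⁻ q)
                       (row-order (labelled⁻ p) (labelled⁻ q) lt) }
        ; columns = λ { {c , _} {d , _} p q (here refl) (here refl) refl lt → rank≤ (labelled⁻ p) (labelled⁻ q)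
                       (column-order (labelled⁻ p) (labelled⁻ q) lt) }
        ; unprimedOnce = λ { {k = k} p q (here refl) (here refl) eq → once-column {k = k} (labelled⁻ p) (labelled⁻ q) eq }
        ; primedOnce   = λ { {k = k} p q (here refl) (here refl) eq → once-row {k = k} (labelled⁻ p) (labelled⁻ q) eq }
        }
        where
        no-label : ∀ c → InUp c → entryAt c ≡ X
        no-label (x , y) u with y ℕ.≤? x | y ℕ.<? M (τ (x ∸ y))
        ... | yes y≤x | _ = ⊥-elim (ℕ.<⇒≱ (inUp⁻ u) y≤x)
        ... | no _    | _ = refl

        has-label : ∀ c → c ∈ cells sh → ¬ InUp c → Is-just (entryAt c)
        has-label (x , y) c∈ ¬u with l , eq ← entry⁺ (x , y) (ℕ.≮⇒≥ λ lt → ¬u (inUp⁺ lt)) c∈ =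
          subst Is-just (sym eq) (just _)

        rank≤ : ∀ {c d l l′} → Placed c l → Placed d l′ →
                key (cellBead (c , l)) < key (cellBead (d , l′)) → l ≤ᴸ l′
        rank≤ {_} {d} {l} {l′} _ (_ , b∈ , _) lt = key-≤⇒rank-≤ {l = l} {l′} (bounded b∈) (ℕ.<⇒≤ lt)

        once-column : ∀ {c d k} → Placed c (unprimed k) → Placed d (unprimed k) → col c ≡ col d → c ≡ d
        once-column {x , y} {.x , y′} {k} p q refl with ℕ.<-cmp y y′
        ... | tri≈ _ eq _ = cong (x ,_) eq
        ... | tri< lt _ _ = ⊥-elim (ℕ.<⇒≱ (τ-mono (ℕ.∸-monoʳ-< lt (proj₁ q)))
          (key-≤-unprimed {k = k} (ℕ.<⇒≤ (column-order p q lt))))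
        ... | tri> _ _ gt = ⊥-elim (ℕ.<⇒≱ (τ-mono (ℕ.∸-monoʳ-< gt (proj₁ p)))
          (key-≤-unprimed {k = k} (ℕ.<⇒≤ (column-order q p gt))))

        once-row : ∀ {c d k} → Placed c (primed k) → Placed d (primed k) → row c ≡ row d → c ≡ d
        once-row {x , y} {x′ , .y} {k} p q refl with ℕ.<-cmp x x′
        ... | tri≈ _ eq _ = cong (_, y) eq
        ... | tri< lt _ _ = ⊥-elim (ℕ.<⇒≱ (τ-mono (ℕ.∸-monoˡ-< lt (proj₁ p)))
          (key-≤-primed {k = k} (bounded (proj₁ (proj₂ q))) (ℕ.<⇒≤ (row-order p q lt))))
        ... | tri> _ _ gt = ⊥-elim (ℕ.<⇒≱ (τ-mono (ℕ.∸-monoˡ-< gt (proj₁ q)))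
          (key-≤-primed {k = k} (bounded (proj₁ (proj₂ p))) (ℕ.<⇒≤ (row-order q p gt))))

      T : ShiftedYoungTableau sh
      T = record { filling = t ; shape = shape ; isTableau = tableau }

      beads⁺ : ∀ {k l} → (τ k , l) ∈ G → (τ k , l) ∈ youngBeads t
      beads⁺ {k} {l} b∈ = subst (λ d → (τ d , l) ∈ youngBeads t)
        (ℕ.m+n∸m≡n (N G (τ k) (key (τ k , l))) k) (∈-map⁺ cellBead (labelled⁺ b∈))

      beads⁻ : ∀ {b} → b ∈ youngBeads t → b ∈ G
      beads⁻ b∈ with u , u∈ , refl ← ∈-map⁻ cellBead b∈ = proj₁ (proj₂ (labelled⁻ u∈))

-- Geometry of dominoes and of adjacent dominoes

type : Domino → ℕ
type (horizontal (x , y)) = suc x ∸ y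
type (vertical   (x , y)) = x ∸ y

-- A decidable form of not being in `InUp′`: the right or lower cell is on or below the main
-- diagonal, which makes the truncated subtraction in `type` exact.
Low : Domino → Set
Low (horizontal (x , y)) = y ≤ suc x
Low (vertical   (x , y)) = y ≤ x

low? : Decidable Low
low? (horizontal (x , y)) = y ℕ.≤? suc x
low? (vertical   (x , y)) = y ℕ.≤? x

halve : ∀ n → ∃[ k ] (n ≡ 2 * k ⊎ n ≡ suc (2 * k))
halve zero = 0 , inj₁ refl
halve (suc n) with halve n
... | k , inj₁ refl = k , inj₂ refl
... | k , inj₂ refl = suc k , inj₁ (cong suc (sym (ℕ.+-suc k _)))

diagonal-above : ∀ {x y n} → y ≡ x + n → diagonal (x , y) ≡ ℤ.+ n
diagonal-above {x} {n = n} refl = trans (ℤ.⊖-≥ (ℕ.m≤m+n x n)) (cong ℤ.+_ (ℕ.m+n∸m≡n x n))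

twice : ∀ k → ℤ.+ 2 ℤ.* ℤ.+ k ≡ ℤ.+ (2 * k)
twice k = sym (ℤ.pos-* 2 k)

-- Of the consecutive diagonal indices e + 1 and e + 2 one is even, and it is at least 2.
even-above : ∀ d {x y x′ y′ e} → (x , y) ∈ dominoCells d → (x′ , y′) ∈ dominoCells d →
             y ≡ suc (x + e) → y′ ≡ suc (suc (x′ + e)) → InUp′ d
even-above d {x} {y} {x′} {y′} {e} c∈ c′∈ eq eq′ with halve e
... | k , inj₁ refl = ℤ.+ suc k , ℤ.+<+ (s≤s z≤n) , Membership.lose c′∈
  (trans (diagonal-above (trans eq′ (sym (trans (ℕ.+-suc x′ _) (cong suc (ℕ.+-suc x′ _))))))
    (trans (cong (λ n → ℤ.+ suc n) (sym (ℕ.+-suc k _))) (sym (twice (suc k)))))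
... | k , inj₂ refl = ℤ.+ suc k , ℤ.+<+ (s≤s z≤n) , Membership.lose c∈
  (trans (diagonal-above (trans eq (sym (ℕ.+-suc x _))))
    (trans (cong (λ n → ℤ.+ suc n) (sym (ℕ.+-suc k _))) (sym (twice (suc k)))))

high⇒inUp′ : ∀ d → ¬ Low d → InUp′ d
high⇒inUp′ (horizontal (x , y)) ¬low with e , refl ← ℕ.m≤n⇒∃[o]m+o≡n (ℕ.≰⇒> ¬low) =
  even-above (horizontal (x , _)) {e = e} (there (here refl)) (here refl) refl refl
high⇒inUp′ (vertical (x , y)) ¬low with e , refl ← ℕ.m≤n⇒∃[o]m+o≡n (ℕ.≰⇒> ¬low) =
  even-above (vertical (x , _)) {e = e} (here refl) (there (here refl)) refl refl

-- A positive even index is at least 2.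
inUp′⇒high-cell : ∀ {d} → InUp′ d → ∃[ c ] c ∈ dominoCells d × suc (suc (col c)) ≤ row c
inUp′⇒high-cell (ℤ.+[1+ k ] , ℤ.+<+ (s≤s z≤n) , on) with (x , y) , c∈ , eq ← Membership.find on =
  (x , y) , c∈ , ℕ.≰⇒> λ y≤1+x → case diagonal≤ y≤1+x of λ le →
    ℤ.<⇒≱ (ℤ.+<+ (s≤s (s≤s z≤n))) (subst (ℤ._≤ ℤ.+ 1)
      (trans eq (trans (twice (suc k)) (cong (λ n → ℤ.+ suc n) (ℕ.+-suc k _)))) le)
  where
  diagonal≤ : ∀ {x y} → y ≤ suc x → diagonal (x , y) ℤ.≤ ℤ.+ 1
  diagonal≤ {x} {y} le = subst (diagonal (x , y) ℤ.≤_) (diagonal-above {x} (ℕ.+-comm 1 x)) (ℤ.⊖-monoˡ-≤ x le)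

high-cell⇒high : ∀ d {x y} → (x , y) ∈ dominoCells d → suc (suc x) ≤ y → ¬ Low d
high-cell⇒high (horizontal _) (here refl)         lt low = ℕ.<⇒≱ lt low
high-cell⇒high (horizontal _) (there (here refl)) lt low = ℕ.<⇒≱ lt (ℕ.m≤n⇒m≤1+n low)
high-cell⇒high (vertical _)   (here refl)         lt low = ℕ.<⇒≱ lt (ℕ.m≤n⇒m≤1+n low)
high-cell⇒high (vertical _)   (there (here refl)) lt low = ℕ.<⇒≱ lt (s≤s low)

low⇒¬inUp′ : ∀ d → Low d → ¬ InUp′ d
low⇒¬inUp′ d low up with (x , y) , c∈ , lt ← inUp′⇒high-cell up = high-cell⇒high d c∈ lt low

¬inUp′⇒low : ∀ d → ¬ InUp′ d → Low d
¬inUp′⇒low d ¬up with low? d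
... | yes low = low
... | no ¬low = ⊥-elim (¬up (high⇒inUp′ d ¬low))

low-cell⇒low : ∀ d {x y} → (x , y) ∈ dominoCells d → y ≤ x → Low d
low-cell⇒low (horizontal _) (here refl)         le = ℕ.m≤n⇒m≤1+n le
low-cell⇒low (horizontal _) (there (here refl)) le = le
low-cell⇒low (vertical _)   (here refl)         le = le
low-cell⇒low (vertical _)   (there (here refl)) le = ℕ.<⇒≤ le

cells-distinct : ∀ d → Unique (dominoCells d)
cells-distinct (horizontal _) = ((λ ()) ∷ []) ∷ [] ∷ []
cells-distinct (vertical _)   = ((λ ()) ∷ []) ∷ [] ∷ []

_≟ᴰ_ : (d e : Domino) → Dec (d ≡ e)
horizontal c ≟ᴰ horizontal d with ≡-dec ℕ._≟_ ℕ._≟_ c d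
... | yes refl = yes refl
... | no ¬p    = no λ { refl → ¬p refl }
horizontal _ ≟ᴰ vertical _   = no λ ()
vertical _   ≟ᴰ horizontal _ = no λ ()
vertical c   ≟ᴰ vertical d with ≡-dec ℕ._≟_ ℕ._≟_ c d
... | yes refl = yes refl
... | no ¬p    = no λ { refl → ¬p refl }

loRow hiRow : Domino → ℕ
loRow (horizontal (_ , y)) = y
loRow (vertical   (_ , y)) = y
hiRow (horizontal (_ , y)) = y
hiRow (vertical   (_ , y)) = suc y

lo-cell : ∀ d → Low d → (loRow d + type d , loRow d) ∈ dominoCells d
lo-cell (horizontal (x , y)) low = there (here (cong (_, y) (ℕ.m+[n∸m]≡n low)))
lo-cell (vertical   (x , y)) low = here (cong (_, y) (ℕ.m+[n∸m]≡n low))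

-- This is the cell on the diagonal just before the type. For type 0 it would lie above the main
-- diagonal, out of reach of the counts, which is why the direction of those dominoes takes a
-- separate argument.
hi-cell : ∀ d {e} → Low d → type d ≡ suc e → (hiRow d + e , hiRow d) ∈ dominoCells d
hi-cell (horizontal (x , y)) {e} low eq = here (cong (_, y)
  (ℕ.suc-injective (trans (sym (ℕ.+-suc y e)) (trans (cong (y +_) (sym eq)) (ℕ.m+[n∸m]≡n low)))))
hi-cell (vertical (x , y)) {e} low eq = there (here (cong (_, suc y)
  (trans (sym (ℕ.+-suc y e)) (trans (cong (y +_) (sym eq)) (ℕ.m+[n∸m]≡n low)))))

domino-determined : ∀ d d′ → Low d → Low d′ → type d ≡ type d′ →
                    loRow d ≡ loRow d′ → hiRow d ≡ hiRow d′ → d ≡ d′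
domino-determined (horizontal (x , y)) (horizontal (x′ , .y)) low low′ eq refl _ =
  cong (λ x → horizontal (x , y)) (ℕ.suc-injective (ℕ.∸-cancelʳ-≡ low low′ eq))
domino-determined (vertical (x , y)) (vertical (x′ , .y)) low low′ eq refl _ =
  cong (λ x → vertical (x , y)) (ℕ.∸-cancelʳ-≡ low low′ eq)
domino-determined (horizontal _) (vertical _) _ _ _ refl ()
domino-determined (vertical _) (horizontal _) _ _ _ refl ()

-- The first alternative means that `p` and `q` coincide in a paving. For disjoint neighbours the
-- type grows, except for two vertical dominoes staggered by one row, whose types are equal.
right-types : ∀ p q {x y} → (x , y) ∈ dominoCells p → (suc x , y) ∈ dominoCells q → y ≤ x →
              ((suc x , y) ∈ dominoCells p ⊎ (x , y) ∈ dominoCells q) ⊎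
              (type p < type q ⊎
               ∃[ y′ ] y ≡ suc y′ × p ≡ vertical (x , y′) × q ≡ vertical (suc x , y))
right-types (horizontal _) q (here refl) _ _ = inj₁ (inj₁ (there (here refl)))
right-types p (horizontal _) _ (there (here refl)) _ = inj₁ (inj₂ (here refl))
right-types (horizontal (x , y)) (horizontal _) (there (here refl)) (here refl) y≤ =
  inj₂ (inj₁ (ℕ.∸-monoˡ-< (s≤s (ℕ.n≤1+n _)) y≤))
right-types (horizontal (x , y)) (vertical _) (there (here refl)) (here refl) y≤ =
  inj₂ (inj₁ (ℕ.∸-monoˡ-< ℕ.≤-refl y≤))
right-types (horizontal (x , _)) (vertical (_ , y)) (there (here refl)) (there (here refl)) y≤ =
  inj₂ (inj₁ (ℕ.<-trans (ℕ.∸-monoˡ-< ℕ.≤-refl y≤) (ℕ.∸-monoʳ-< {suc (suc x)} (ℕ.n<1+n y) (ℕ.m≤n⇒m≤1+n y≤))))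
right-types (vertical (x , y)) (horizontal _) (here refl) (here refl) y≤ =
  inj₂ (inj₁ (ℕ.∸-monoˡ-< (s≤s (ℕ.n≤1+n _)) y≤))
right-types (vertical (x , y)) (vertical _) (here refl) (here refl) y≤ =
  inj₂ (inj₁ (ℕ.∸-monoˡ-< ℕ.≤-refl y≤))
right-types (vertical (x , _)) (vertical (_ , y)) (here refl) (there (here refl)) y≤ =
  inj₂ (inj₁ (ℕ.<-trans (ℕ.∸-monoˡ-< ℕ.≤-refl y≤) (ℕ.∸-monoʳ-< {suc x} (ℕ.n<1+n y) (ℕ.m≤n⇒m≤1+n y≤))))
right-types (vertical (x , y)) (horizontal _) (there (here refl)) (here refl) y≤ =
  inj₂ (inj₁ (ℕ.∸-monoˡ-< ℕ.≤-refl (ℕ.<⇒≤ y≤)))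
right-types (vertical (x , y)) (vertical _) (there (here refl)) (here refl) y≤ =
  inj₂ (inj₂ (y , refl , refl , refl))
right-types (vertical (x , y)) (vertical _) (there (here refl)) (there (here refl)) y≤ =
  inj₂ (inj₁ (ℕ.∸-monoˡ-< ℕ.≤-refl (ℕ.<⇒≤ y≤)))

-- The analogue for a step upwards; the exception now consists of two staggered horizontal dominoes.
up-types : ∀ p q {x y} → (x , y) ∈ dominoCells p → (x , suc y) ∈ dominoCells q → suc y ≤ x →
           ((x , suc y) ∈ dominoCells p ⊎ (x , y) ∈ dominoCells q) ⊎
           (type q < type p ⊎
            ∃[ x′ ] x ≡ suc x′ × p ≡ horizontal (x′ , y) × q ≡ horizontal (x , suc y))
up-types (vertical _) q (here refl) _ _ = inj₁ (inj₁ (there (here refl)))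
up-types p (vertical _) _ (there (here refl)) _ = inj₁ (inj₂ (here refl))
up-types (horizontal (x , y)) (horizontal _) (here refl) (here refl) y< =
  inj₂ (inj₁ (ℕ.∸-monoˡ-< ℕ.≤-refl (ℕ.<⇒≤ y<)))
up-types (horizontal (suc x , y)) (horizontal _) (here refl) (there (here refl)) y< =
  inj₂ (inj₁ (ℕ.∸-monoˡ-< (s≤s (ℕ.n≤1+n _)) (ℕ.≤-pred y<)))
up-types (horizontal (x , y)) (vertical _) (here refl) (here refl) y< =
  inj₂ (inj₁ (ℕ.<-trans (ℕ.∸-monoʳ-< (ℕ.n<1+n y) y<) (ℕ.∸-monoˡ-< ℕ.≤-refl (ℕ.<⇒≤ y<))))
up-types (horizontal (x , y)) (horizontal _) (there (here refl)) (here refl) y< =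
  inj₂ (inj₂ (x , refl , refl , refl))
up-types (horizontal (x , y)) (horizontal _) (there (here refl)) (there (here refl)) y< =
  inj₂ (inj₁ (ℕ.∸-monoˡ-< ℕ.≤-refl (ℕ.≤-pred y<)))
up-types (horizontal (x , y)) (vertical _) (there (here refl)) (here refl) y< =
  inj₂ (inj₁ (ℕ.∸-monoʳ-< (ℕ.n<1+n y) y<))
up-types (vertical (x , y)) (horizontal _) (there (here refl)) (here refl) y< =
  inj₂ (inj₁ (ℕ.∸-monoʳ-< (ℕ.n<1+n y) (ℕ.<⇒≤ y<)))
up-types (vertical (suc x , y)) (horizontal _) (there (here refl)) (there (here refl)) y< =
  inj₂ (inj₁ (ℕ.<-trans (ℕ.∸-monoʳ-< (ℕ.n<1+n (suc y)) y<) (ℕ.∸-monoʳ-< (ℕ.n<1+n y) (ℕ.<⇒≤ y<))))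
up-types (vertical (x , y)) (vertical _) (there (here refl)) (here refl) y< =
  inj₂ (inj₁ (ℕ.<-trans (ℕ.∸-monoʳ-< (ℕ.n<1+n (suc y)) y<) (ℕ.∸-monoʳ-< (ℕ.n<1+n y) (ℕ.<⇒≤ y<))))

unique-resp-↭ : {A : Set} {xs ys : List A} → xs ↭ ys → Unique xs → Unique ys
unique-resp-↭ {A} p = Permutation.Unique-resp-↭ (setoid A) (↭⇒↭ₛ p)

-- From shifted domino tableaux to beads

module Dominoes (K : ℕ) where

  open Keys K

  dominoBead : Domino × Letter → Bead
  dominoBead (d , l) = type d , l

  dominoBeads : Filling Domino → List Bead
  dominoBeads t = map dominoBead (labelled t)

  keyOf : Domino × Letter → ℕ
  keyOf u = key (dominoBead u)

  module FromTableau {sh : List ℕ} {m : ℕ → ℕ} (L : Lower sh (λ e → m e + m (suc e)))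
                     (bound : ∀ e → 0 < m e + m (suc e) → suc e < K)
                     (T : ShiftedDominoTableau sh) where

    open Lower L
    open ShiftedDominoTableau T renaming (filling to t)
    open IsTableau isTableau

    S : List (Domino × Letter)
    S = labelled t

    cellList : concatMap (dominoCells ∘ proj₁) t ↭ cells sh
    cellList = subst (_↭ cells sh) (concatMap-map dominoCells proj₁ t) paving

    unique-t : Unique (concatMap (dominoCells ∘ proj₁) t)
    unique-t = unique-resp-↭ (↭-sym cellList) (cells-unique sh)

    owner : ∀ {u v c} → u ∈ t → v ∈ t → c ∈ dominoCells (proj₁ u) → c ∈ dominoCells (proj₁ v) → u ≡ v
    owner = unique-concatMap-owner (dominoCells ∘ proj₁) unique-t

    ownerS : ∀ {u v c} → u ∈ S → v ∈ S → c ∈ dominoCells (proj₁ u) → c ∈ dominoCells (proj₁ v) → u ≡ v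
    ownerS {d , l} {d′ , l′} u∈ v∈ c∈ c∈′
      with refl ← owner (∈-labelled⁻ t u∈) (∈-labelled⁻ t v∈) c∈ c∈′ = refl

    cover : ∀ {c} → c ∈ cells sh → ∃[ u ] u ∈ t × c ∈ dominoCells (proj₁ u)
    cover c∈ = ∈-concatMap-elim (dominoCells ∘ proj₁) t (∈-resp-↭ (↭-sym cellList) c∈)

    inside : ∀ {u c} → u ∈ S → c ∈ dominoCells (proj₁ u) → c ∈ cells sh
    inside u∈ c∈ = ∈-resp-↭ cellList (∈-concatMap-intro (dominoCells ∘ proj₁) (∈-labelled⁻ t u∈) c∈)

    low : ∀ {u} → u ∈ S → Low (proj₁ u)
    low {d , l} u∈ = ¬inUp′⇒low d λ u → case up (∈-labelled⁻ t u∈) u of λ ()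

    low⇒labelled : ∀ {u} → u ∈ t → Low (proj₁ u) → ∃[ l ] (proj₁ u , l) ∈ S
    low⇒labelled {d , just l}  u∈ _ = l , ∈-labelled⁺ u∈
    low⇒labelled {d , nothing} u∈ low with () ← down u∈ (low⇒¬inUp′ d low)

    label : ∀ {x y} → (x , y) ∈ cells sh → y ≤ x → ∃[ u ] u ∈ S × (x , y) ∈ dominoCells (proj₁ u)
    label c∈ y≤x with (d , _) , u∈ , c∈d ← cover c∈ with l , s∈ ← low⇒labelled u∈ (low-cell⇒low d c∈d y≤x) =
      (d , l) , s∈ , c∈d

    unique-S : Unique S
    unique-S = labelled-unique {t = t} (unique-concatMap-base (dominoCells ∘ proj₁) some unique-t)
      where
      some : (u : Domino × Entry) → ∃[ c ] c ∈ dominoCells (proj₁ u)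
      some (horizontal _ , _) = _ , here refl
      some (vertical _   , _) = _ , here refl

    same-domino : ∀ {p q a b} → (p , a) ∈ S → (q , b) ∈ S → p ≡ q → (p , a) ≡ (q , b)
    same-domino {p} u∈ v∈ refl = ownerS u∈ v∈ (lo-cell p (low u∈)) (lo-cell p (low u∈))

    type<K : ∀ {u} → u ∈ S → type (proj₁ u) < K
    type<K {d , _} u∈ = ℕ.<-trans (ℕ.n<1+n _) (bound (type d) (ℕ.≤-<-trans z≤n
      (mem⁻ (type d) (inside u∈ (lo-cell d (low u∈))))))

    -- Two stacked vertical dominoes of the same type leave a cell below the
    -- right one whose letter is squeezed between equal letters.
    right-step : ∀ {p q a b x y} → (p , a) ∈ S → (q , b) ∈ S →
                 (x , y) ∈ dominoCells p → (suc x , y) ∈ dominoCells q → y ≤ x →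
                 (p , a) ≡ (q , b) ⊎ keyOf (p , a) < keyOf (q , b)
    right-step {p} {q} {a} {b} {x} {y} u∈ v∈ c∈ d∈ y≤x with p ≟ᴰ q
    ... | yes p≡q = inj₁ (same-domino u∈ v∈ p≡q)
    ... | no  p≢q with right-types p q c∈ d∈ y≤x
    ...   | inj₁ (inj₁ d∈p) = inj₁ (ownerS u∈ v∈ d∈p d∈)
    ...   | inj₁ (inj₂ c∈q) = inj₁ (ownerS u∈ v∈ c∈ c∈q)
    ...   | inj₂ (inj₁ lt)  = inj₂ (key-<-right {l = a} {b} lt (type<K u∈)
      (rows u∈ v∈ c∈ d∈ refl ℕ.≤-refl) λ { refl refl → p≢q (primedOnce u∈ v∈ c∈ d∈ refl) })
    ...   | inj₂ (inj₂ (y′ , refl , refl , refl)) =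
      inj₂ (key-< {l = a} {b} (type<K u∈) (ℕ.≤∧≢⇒< a≤b λ eq → a≢b a b (rank-injective a b eq) u∈ v∈))
      where
      a≤b : a ≤ᴸ b
      a≤b = rows u∈ v∈ c∈ d∈ refl ℕ.≤-refl

      a≢b : ∀ a b → a ≡ b → (vertical (x , y′) , a) ∈ S → (vertical (suc x , suc y′) , b) ∈ S → ⊥
      a≢b (primed k) _ refl u∈ v∈ = p≢q (primedOnce u∈ v∈ c∈ d∈ refl)
      a≢b (unprimed k) _ refl u∈ v∈
        with (r , l) , w∈ , f∈ ← label (downClosed (inside v∈ d∈)) (ℕ.≤-trans (ℕ.n≤1+n _) (ℕ.m≤n⇒m≤1+n y≤x))
        with refl ← rank-injective l (unprimed k) (ℕ.≤-antisym
               (columns w∈ v∈ f∈ d∈ refl ℕ.≤-refl) (rows u∈ w∈ (here refl) f∈ refl ℕ.≤-refl))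
        with refl ← unprimedOnce w∈ v∈ f∈ d∈ refl = absent f∈
        where
        absent : ¬ ((suc x , y′) ∈ dominoCells (vertical (suc x , suc y′)))
        absent (here ())
        absent (there (here ()))

    -- As in `right-step`, with staggered horizontal dominoes as the exceptional case: the cell to
    -- the right of the lower one and below the upper one has its letter squeezed between equal
    -- primed letters, so a row would carry that letter on two dominoes.
    up-step : ∀ {p q a b x y} → (p , a) ∈ S → (q , b) ∈ S →
              (x , y) ∈ dominoCells p → (x , suc y) ∈ dominoCells q → suc y ≤ x →
              (p , a) ≡ (q , b) ⊎ keyOf (p , a) < keyOf (q , b)
    up-step {p} {q} {a} {b} {x} {y} u∈ v∈ c∈ d∈ y<x with p ≟ᴰ q
    ... | yes p≡q = inj₁ (same-domino u∈ v∈ p≡q)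
    ... | no  p≢q with up-types p q c∈ d∈ y<x
    ...   | inj₁ (inj₁ d∈p) = inj₁ (ownerS u∈ v∈ d∈p d∈)
    ...   | inj₁ (inj₂ c∈q) = inj₁ (ownerS u∈ v∈ c∈ c∈q)
    ...   | inj₂ (inj₁ lt)  = inj₂ (key-<-up {l = a} {b} lt (type<K u∈)
      (columns u∈ v∈ c∈ d∈ refl ℕ.≤-refl) λ { refl refl → p≢q (unprimedOnce u∈ v∈ c∈ d∈ refl) })
    ...   | inj₂ (inj₂ (x′ , refl , refl , refl)) =
      inj₂ (key-< {l = a} {b} (type<K u∈) (ℕ.≤∧≢⇒< a≤b λ eq → a≢b a b (rank-injective a b eq) u∈ v∈))
      where
      a≤b : a ≤ᴸ b
      a≤b = columns u∈ v∈ c∈ d∈ refl ℕ.≤-refl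

      a≢b : ∀ a b → a ≡ b → (horizontal (x′ , y) , a) ∈ S → (horizontal (suc x′ , suc y) , b) ∈ S → ⊥
      a≢b (unprimed k) _ refl u∈ v∈ = p≢q (unprimedOnce u∈ v∈ c∈ d∈ refl)
      a≢b (primed k) _ refl u∈ v∈
        with (r , l) , w∈ , f∈ ← label (downClosed (inside v∈ (there (here refl))))
                                   (ℕ.≤-trans (ℕ.<⇒≤ y<x) (ℕ.n≤1+n _))
        with refl ← rank-injective l (primed k) (ℕ.≤-antisym
               (columns w∈ v∈ f∈ (there (here refl)) refl ℕ.≤-refl) (rows u∈ w∈ c∈ f∈ refl ℕ.≤-refl))
        with refl ← primedOnce u∈ w∈ c∈ f∈ refl = absent f∈
        where
        absent : ¬ ((suc (suc x′) , y) ∈ dominoCells (horizontal (x′ , y)))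
        absent (here ())
        absent (there (here ()))

    tiles : Domino × Letter → List (Cell × ℕ)
    tiles u = map (_, keyOf u) (dominoCells (proj₁ u))

    C : List (Cell × ℕ)
    C = concatMap tiles S

    fromC : ∀ {c κ} → (c , κ) ∈ C → ∃[ u ] u ∈ S × c ∈ dominoCells (proj₁ u) × κ ≡ keyOf u
    fromC {c} {κ} p with u , u∈ , q ← ∈-concatMap-elim tiles S p
      with _ , c∈ , refl ← ∈-map⁻ (_, keyOf u) q = u , u∈ , c∈ , refl

    toC : ∀ {u c} → u ∈ S → c ∈ dominoCells (proj₁ u) → (c , keyOf u) ∈ C
    toC {u} u∈ c∈ = ∈-concatMap-intro tiles u∈ (∈-map⁺ (_, keyOf u) c∈)

    C-unique : Unique (map proj₁ C)
    C-unique = unique-map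
      (unique-concatMap tiles unique-S
        (λ {u} _ → Unique.map⁺ (cong proj₁) (cells-distinct (proj₁ u)))
        λ {u} {v} u∈ v∈ p q →
          let c , c∈ , eq = ∈-map⁻ (_, keyOf u) p
              d , d∈ , eq′ = ∈-map⁻ (_, keyOf v) q
          in ownerS u∈ v∈ c∈ (subst (_∈ dominoCells (proj₁ v))
               (trans (sym (cong proj₁ eq′)) (cong proj₁ eq)) d∈))
      λ {(c , κ)} {(d , κ′)} p q c≡d →
        let u , u∈ , c∈ , eq = fromC p
            v , v∈ , d∈ , eq′ = fromC q
        in cong₂ _,_ c≡d (trans eq (trans
             (cong keyOf (ownerS u∈ v∈ c∈ (subst (_∈ dominoCells (proj₁ v)) (sym c≡d) d∈))) (sym eq′)))

    weak : ∀ {u v} → u ≡ v ⊎ keyOf u < keyOf v → keyOf u ≤ keyOf v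
    weak (inj₁ refl) = ℕ.≤-refl
    weak (inj₂ lt)   = ℕ.<⇒≤ lt

    left-C : ∀ {x y κ} → ((suc x , y) , κ) ∈ C → y ≤ x → ∃[ κ′ ] κ′ ≤ κ × ((x , y) , κ′) ∈ C
    left-C p y≤x =
      let u , u∈ , c∈ , eq = fromC p
          v , v∈ , d∈ = label (leftClosed (inside u∈ c∈)) y≤x
      in keyOf v , subst (keyOf v ≤_) (sym eq) (weak (right-step v∈ u∈ d∈ c∈ y≤x)) , toC v∈ d∈

    down-C : ∀ {x y κ} → ((x , suc y) , κ) ∈ C → suc y ≤ x → ∃[ κ′ ] κ′ ≤ κ × ((x , y) , κ′) ∈ C
    down-C p y<x =
      let u , u∈ , c∈ , eq = fromC p
          v , v∈ , d∈ = label (downClosed (inside u∈ c∈)) (ℕ.<⇒≤ y<x)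
      in keyOf v , subst (keyOf v ≤_) (sym eq) (weak (up-step v∈ u∈ d∈ c∈ y<x)) , toC v∈ d∈

    no-diagonal-domino : ∀ d {x y} → (x , y) ∈ dominoCells d → ¬ ((suc x , suc y) ∈ dominoCells d)
    no-diagonal-domino (horizontal _) (here refl) (here ())
    no-diagonal-domino (horizontal _) (here refl) (there (here ()))
    no-diagonal-domino (horizontal _) (there (here refl)) (here ())
    no-diagonal-domino (horizontal _) (there (here refl)) (there (here ()))
    no-diagonal-domino (vertical _) (here refl) (here ())
    no-diagonal-domino (vertical _) (here refl) (there (here ()))
    no-diagonal-domino (vertical _) (there (here refl)) (here ())
    no-diagonal-domino (vertical _) (there (here refl)) (there (here ()))

    -- A step fails to be strict only inside one domino, and no domino contains both ends of a
    -- diagonal step; so one of the two steps is strict.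
    diag-C : ∀ {x y κ} → ((suc x , suc y) , κ) ∈ C → y ≤ x → ∃[ κ′ ] κ′ < κ × ((x , y) , κ′) ∈ C
    diag-C p y≤x =
      let u , u∈ , c∈ , eq = fromC p
          v , v∈ , d∈ = label (downClosed (inside u∈ c∈)) (ℕ.m≤n⇒m≤1+n y≤x)
          w , w∈ , f∈ = label (leftClosed (inside v∈ d∈)) y≤x
      in keyOf w
       , subst (keyOf w <_) (sym eq)
           (strict c∈ f∈ (right-step w∈ v∈ f∈ d∈ y≤x) (up-step v∈ u∈ d∈ c∈ (s≤s y≤x)))
       , toC w∈ f∈
      where
      strict : ∀ {u v w x y} → (suc x , suc y) ∈ dominoCells (proj₁ u) → (x , y) ∈ dominoCells (proj₁ w) →
               w ≡ v ⊎ keyOf w < keyOf v → v ≡ u ⊎ keyOf v < keyOf u → keyOf w < keyOf u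
      strict c∈ f∈ (inj₁ refl) (inj₁ refl) = ⊥-elim (no-diagonal-domino _ f∈ c∈)
      strict c∈ f∈ (inj₁ refl) (inj₂ lt)   = lt
      strict c∈ f∈ (inj₂ lt)   (inj₁ refl) = lt
      strict c∈ f∈ (inj₂ lt)   (inj₂ lt′)  = ℕ.<-trans lt lt′

    open Ideal C C-unique left-C down-C diag-C

    G : List Bead
    G = dominoBeads t

    private
      OfType : ℕ → ℕ → Domino × Letter → Set
      OfType i z u = type (proj₁ u) ≡ i × keyOf u < z

      ofType? : ∀ i z → Decidable (OfType i z)
      ofType? i z u = (type (proj₁ u) ℕ.≟ i) ×-dec (keyOf u ℕ.<? z)

    N≡ : ∀ i z → N G i z ≡ count (ofType? i z) S
    N≡ i z = trans (N≡count G i z) (count-map dominoBead (λ b → (proj₁ b ℕ.≟ i) ×-dec (key b ℕ.<? z)) S)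

    n≡N : ∀ e z → n e z ≡ N G e z + N G (suc e) z
    n≡N e z = trans (split S (λ u∈ → low u∈)) (sym (cong₂ _+_ (N≡ e z) (N≡ (suc e) z)))
      where
      swap-on : ∀ {x y i} → y ≤ x → x ∸ y ≡ i → x ≡ y + i
      swap-on {x} {y} le eq = trans (sym (ℕ.m+[n∸m]≡n le)) (cong (y +_) eq)

      off : ∀ {x y i} → x ≡ y + i → x ∸ y ≡ i
      off {x} {y} {i} eq = trans (cong (_∸ y) eq) (ℕ.m+n∸m≡n y i)

      two : ∀ {c c′ κ} → count (onBelow? e z) ((c , κ) ∷ (c′ , κ) ∷ []) ≡
            χ (onBelow? e z (c , κ)) + χ (onBelow? e z (c′ , κ))
      two {c} {c′} {κ} = trans (count-∷ (onBelow? e z) (c , κ) ((c′ , κ) ∷ []))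
        (cong (χ (onBelow? e z (c , κ)) +_)
          (trans (count-∷ (onBelow? e z) (c′ , κ) []) (ℕ.+-identityʳ _)))

      one : ∀ u → Low (proj₁ u) → count (onBelow? e z) (tiles u) ≡
            χ (ofType? e z u) + χ (ofType? (suc e) z u)
      one u@(horizontal (x , y) , l) low = trans (two {x , y} {suc x , y})
        (trans (ℕ.+-comm (χ (onBelow? e z ((x , y) , keyOf u))) _) (cong₂ _+_
          (χ-cong {p = onBelow? e z ((suc x , y) , keyOf u)} {ofType? e z u}
            (λ (eq , lt) → off eq , lt) (λ (eq , lt) → swap-on low eq , lt))
          (χ-cong {p = onBelow? e z ((x , y) , keyOf u)} {ofType? (suc e) z u}
                  (λ (eq , lt) → off (trans (cong suc eq) (sym (ℕ.+-suc y e))) , lt)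
                  (λ (eq , lt) → ℕ.suc-injective (trans (swap-on low eq) (ℕ.+-suc y e)) , lt))))
      one u@(vertical (x , y) , l) low = trans (two {x , y} {x , suc y}) (cong₂ _+_
          (χ-cong {p = onBelow? e z ((x , y) , keyOf u)} {ofType? e z u}
            (λ (eq , lt) → off eq , lt) (λ (eq , lt) → swap-on low eq , lt))
          (χ-cong {p = onBelow? e z ((x , suc y) , keyOf u)} {ofType? (suc e) z u}
                  (λ (eq , lt) → off (trans eq (sym (ℕ.+-suc y e))) , lt)
                  (λ (eq , lt) → trans (swap-on low eq) (ℕ.+-suc y e) , lt)))

      split : ∀ us → (∀ {u} → u ∈ us → Low (proj₁ u)) →
              count (onBelow? e z) (concatMap tiles us) ≡ count (ofType? e z) us + count (ofType? (suc e) z) us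
      split []       _  = refl
      split (u ∷ us) lo = begin
        count (onBelow? e z) (tiles u ++ concatMap tiles us)
          ≡⟨ count-++ (onBelow? e z) (tiles u) (concatMap tiles us) ⟩
        count (onBelow? e z) (tiles u) + count (onBelow? e z) (concatMap tiles us)
          ≡⟨ cong₂ _+_ (one u (lo (here refl))) (split us (lo ∘ there)) ⟩
        (χ (ofType? e z u) + χ (ofType? (suc e) z u)) + (count (ofType? e z) us + count (ofType? (suc e) z) us)
          ≡⟨ interchange (χ (ofType? e z u)) _ _ _ ⟩
        (χ (ofType? e z u) + count (ofType? e z) us) + (χ (ofType? (suc e) z u) + count (ofType? (suc e) z) us)
          ≡⟨ cong₂ _+_ (count-∷ (ofType? e z) u us) (count-∷ (ofType? (suc e) z) u us) ⟨
        count (ofType? e z) (u ∷ us) + count (ofType? (suc e) z) (u ∷ us) ∎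
        where
        open ≡-Reasoning

    row≡ : ∀ {u e y} → u ∈ S → (y + e , y) ∈ dominoCells (proj₁ u) →
           N G e (keyOf u) + N G (suc e) (keyOf u) ≡ y
    row≡ {u} {e} u∈ c∈ = trans (sym (n≡N e (keyOf u))) (position (toC u∈ c∈))

    bead⁺ : ∀ {u} → u ∈ S → dominoBead u ∈ G
    bead⁺ = ∈-map⁺ dominoBead

    bead⁻ : ∀ {b} → b ∈ G → ∃[ u ] u ∈ S × b ≡ dominoBead u
    bead⁻ = ∈-map⁻ dominoBead

    N-zero : ∀ {i} → K ≤ i → ∀ z → N G i z ≡ 0
    N-zero {i} K≤i z = trans (N≡ i z) (count-none (ofType? i z) S λ u∈ (eq , _) →
      ℕ.<⇒≱ (subst (_< K) eq (type<K u∈)) K≤i)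

    m-zero : ∀ {i} → K ≤ i → m i ≡ 0
    m-zero {i} K≤i with m i in eq
    ... | zero  = refl
    ... | suc _ = ⊥-elim (ℕ.<⇒≱ (bound i (subst (λ k → 0 < k + m (suc i)) (sym eq) (s≤s z≤n))) (ℕ.m≤n⇒m≤1+n K≤i))

    -- The lengths of the diagonals give only sums over two neighbouring types. Both sides vanish
    -- from `K` on, and descending from there separates the summands.
    total : ∀ i {z} → (∀ {b} → b ∈ G → key b < z) → N G i z ≡ m i
    total i {z} h = descend K i (ℕ.m≤m+n K i)
      where
      sums : ∀ e → N G e z + N G (suc e) z ≡ m e + m (suc e)
      sums e = trans (sym (n≡N e z)) (ℕ.≤-antisym
        (below⇒≤ λ q< → let _ , _ , c∈ = n⁻ q<
                            u , u∈ , d∈ , _ = fromC c∈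
                        in mem⁻ e (inside u∈ d∈))
        (below⇒≤ λ {q} q< → let u , u∈ , d∈ = label (mem⁺ e q<) (ℕ.m≤m+n q e)
                            in n⁺ (h (bead⁺ u∈)) (toC u∈ d∈)))

      descend : ∀ d e → K ≤ d + e → N G e z ≡ m e
      descend zero    e K≤e = trans (N-zero K≤e z) (sym (m-zero K≤e))
      descend (suc d) e K≤  = ℕ.+-cancelʳ-≡ (m (suc e)) (N G e z) (m e)
        (trans (cong (N G e z +_) (sym (descend d (suc e) (subst (K ≤_) (sym (ℕ.+-suc d e)) K≤)))) (sums e))

    G-unique : Unique G
    G-unique = unique-map unique-S inj
      where
      inj : ∀ {u v} → u ∈ S → v ∈ S → dominoBead u ≡ dominoBead v → u ≡ v
      inj {d , l} {d′ , l′} u∈ v∈ eq = ownerS u∈ v∈ (lo-cell d (low u∈))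
        (subst (_∈ dominoCells d′) (cong₂ (λ r i → r + i , r) r≡ (sym i≡)) (lo-cell d′ (low v∈)))
        where
        i≡ : type d ≡ type d′
        i≡ = cong proj₁ eq
        r≡ : loRow d′ ≡ loRow d
        r≡ = trans (sym (row≡ v∈ (lo-cell d′ (low v∈))))
          (trans (cong (λ b → N G (proj₁ b) (key b) + N G (suc (proj₁ b)) (key b)) (sym eq))
            (row≡ u∈ (lo-cell d (low u∈))))

    valid : Valid m G
    valid = record
      { unique     = G-unique
      ; bounded    = λ b∈ → let u , u∈ , eq = bead⁻ b∈ in subst (λ b → proj₁ b < K) (sym eq) (type<K u∈)
      ; interlace≥ = λ i z → ℕ.+-cancelˡ-≤ (N G (suc i) z) _ _
          (subst₂ _≤_ (n≡N (suc i) z) (trans (n≡N i z) (ℕ.+-comm (N G i z) _)) (n-anti i z))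
      ; interlace≤ = λ i z → ℕ.+-cancelˡ-≤ (N G (suc i) z) _ _
          (subst₂ _≤_ (trans (n≡N i z) (ℕ.+-comm (N G i z) _))
            (trans (cong suc (n≡N (suc i) z)) (sym (ℕ.+-suc (N G (suc i) z) _))) (n-step i z))
      ; total      = total
      }

    -- Consider the cell (p, p + 1). If its domino were in `InUp′`, so would be every domino on the
    -- left, against admissibility. Otherwise that cell can only be the top of a vertical domino.
    vertical-predecessor : ∀ {p l} → (vertical (suc p , suc p) , l) ∈ S → ∃[ l′ ] (vertical (p , p) , l′) ∈ S
    vertical-predecessor {p} {l} u∈ = pick (low? d) refl
      where
      corner : (p , suc p) ∈ cells sh
      corner = leftClosed (inside u∈ (here refl))
      w = proj₁ (cover corner)
      d = proj₁ w
      w∈ : w ∈ t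
      w∈ = proj₁ (proj₂ (cover corner))
      c∈ : (p , suc p) ∈ dominoCells d
      c∈ = proj₂ (proj₂ (cover corner))

      on-corner : ∀ d′ → (p , suc p) ∈ dominoCells d′ → Low d′ →
                  d′ ≡ vertical (p , p) ⊎ (suc p , suc p) ∈ dominoCells d′
      on-corner (horizontal _) (here refl)         _   = inj₂ (there (here refl))
      on-corner (horizontal _) (there (here refl)) low = ⊥-elim (ℕ.<-irrefl refl low)
      on-corner (vertical _)   (here refl)         low = ⊥-elim (ℕ.<-irrefl refl low)
      on-corner (vertical _)   (there (here refl)) _   = inj₁ refl

      all-up : ¬ Low d → ∀ {e} → e ∈ map proj₁ t → LeftAdjacent e (vertical (suc p , suc p)) → InUp′ e
      all-up ¬low {e} e∈ (_ , _ , a∈ , here refl) =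
        let v , v∈ , e≡ = ∈-map⁻ proj₁ e∈
        in subst InUp′ (sym (trans e≡ (cong proj₁ (owner v∈ w∈ (subst (λ f → _ ∈ dominoCells f) e≡ a∈) c∈))))
             (high⇒inUp′ d ¬low)
      -- A left neighbour of the upper cell contains (p, p + 2), a cell on D₂.
      all-up _ {e} _ (_ , _ , a∈ , there (here refl)) =
        high⇒inUp′ e (high-cell⇒high e a∈ ℕ.≤-refl)

      pick : ∀ dec → low? d ≡ dec → ∃[ l′ ] (vertical (p , p) , l′) ∈ S
      pick (no ¬low) _ = ⊥-elim (admissible (suc p , suc p) record
        { present = ∈-map⁺ proj₁ (∈-labelled⁻ t u∈)
        ; onD₀    = here (ℤ.n⊖n≡0 (suc p))
        ; hasLeft = d , ∈-map⁺ proj₁ w∈ , p , suc p , c∈ , here refl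
        ; allUp   = all-up ¬low
        })
      pick (yes low) _ with on-corner d c∈ low
      ... | inj₁ eq = let l′ , v∈ = low⇒labelled w∈ low in l′ , subst (λ f → (f , l′) ∈ S) eq v∈
      ... | inj₂ q  = ⊥-elim (not-left d c∈ (cong proj₁ (owner w∈ (∈-labelled⁻ t u∈) q (here refl))))
        where
        not-left : ∀ d → (p , suc p) ∈ dominoCells d → d ≢ vertical (suc p , suc p)
        not-left _ (here ())         refl
        not-left _ (there (here ())) refl

    vertical-below : ∀ {p l} → (vertical (p , p) , l) ∈ S → ∀ {q} → q ≤ p → ∃[ l′ ] (vertical (q , q) , l′) ∈ S
    vertical-below {zero}  u∈ z≤n = _ , u∈
    vertical-below {suc p} u∈ q≤p with ℕ.m≤n⇒m<n∨m≡n q≤p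
    ... | inj₂ refl      = _ , u∈
    ... | inj₁ (s≤s q≤p) = vertical-below (proj₂ (vertical-predecessor u∈)) q≤p

    -- A smaller domino of type 1 would have a cell on the main diagonal in a row q ≤ p, but
    -- `vertical-below` gives that cell to a vertical domino of type 0.
    vertical⇒none : ∀ {p l} → (vertical (p , p) , l) ∈ S → N G 1 (keyOf (vertical (p , p) , l)) ≡ 0
    vertical⇒none {p} {l} u∈ = trans (N≡ 1 κ) (count-none (ofType? 1 κ) S λ {v} v∈ (eq , lt) →
      clash v v∈ eq lt)
      where
      κ = keyOf (vertical (p , p) , l)

      clash : ∀ v → v ∈ S → type (proj₁ v) ≡ 1 → ¬ (keyOf v < κ)
      clash v@(d , _) v∈ eq lt = ℕ.0≢1+n (trans (sym type≡0) eq)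
        where
        q = hiRow d
        hi∈ : (q + 0 , q) ∈ dominoCells d
        hi∈ = hi-cell d (low v∈) eq
        q≤p : q ≤ p
        q≤p = subst₂ _≤_ (row≡ v∈ hi∈) (row≡ {e = 0} u∈ (here (cong (_, p) (ℕ.+-identityʳ p))))
          (ℕ.+-mono-≤ (N-mono G 0 (ℕ.<⇒≤ lt)) (N-mono G 1 (ℕ.<⇒≤ lt)))
        type≡0 : type d ≡ 0
        type≡0 = trans (cong (type ∘ proj₁) (ownerS v∈ (proj₂ (vertical-below u∈ q≤p)) hi∈
          (here (cong (_, q) (ℕ.+-identityʳ q))))) (ℕ.n∸n≡0 q)

    -- With no smaller bead of type 1, the cells (q, q) with q ≤ x are covered by dominoes of type 0
    -- only, and these are vertical by induction from the corner. The last one would overlap the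
    -- horizontal domino in (x, x + 1).
    horizontal⇒some : ∀ {x l} → (horizontal (x , suc x) , l) ∈ S → 0 < N G 1 (keyOf (horizontal (x , suc x) , l))
    horizontal⇒some {x} {l} u∈ = ℕ.n≢0⇒n>0 λ none → clash none (covered none x ℕ.≤-refl)
      where
      κ = keyOf (horizontal (x , suc x) , l)

      on-diagonal : ∀ x → (x , x) ∈ cells sh → ∀ q → q ≤ x → (q , q) ∈ cells sh
      on-diagonal zero    c∈ zero q≤x = c∈
      on-diagonal (suc x) c∈ q q≤x with ℕ.m≤n⇒m<n∨m≡n q≤x
      ... | inj₂ refl      = c∈
      ... | inj₁ (s≤s q≤x) = on-diagonal x (downClosed (leftClosed c∈)) q q≤x

      zero-cases : ∀ d q → (q , q) ∈ dominoCells d →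
                   type d ≡ 1 ⊎ d ≡ vertical (q , q) ⊎ ∃[ q′ ] q ≡ suc q′ × (q′ , q) ∈ dominoCells d
      zero-cases (horizontal _) q      (here refl)         = inj₁ (ℕ.m+n∸n≡m 1 q)
      zero-cases (horizontal _) (suc q) (there (here refl)) = inj₂ (inj₂ (q , refl , here refl))
      zero-cases (vertical _)   q      (here refl)         = inj₂ (inj₁ refl)
      zero-cases (vertical _)   (suc q) (there (here refl)) = inj₁ (ℕ.m+n∸n≡m 1 q)

      covered : N G 1 κ ≡ 0 → ∀ q → q ≤ x → ∃[ l′ ] (vertical (q , q) , l′) ∈ S
      covered none q q≤x = pick (zero-cases (proj₁ v) q d∈)
        where
        diagonal∈ : (q , q) ∈ cells sh
        diagonal∈ = on-diagonal (suc x) (inside u∈ (there (here refl))) q (ℕ.m≤n⇒m≤1+n q≤x)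
        v  = proj₁ (label diagonal∈ ℕ.≤-refl)
        v∈ : v ∈ S
        v∈ = proj₁ (proj₂ (label diagonal∈ ℕ.≤-refl))
        d∈ : (q , q) ∈ dominoCells (proj₁ v)
        d∈ = proj₂ (proj₂ (label diagonal∈ ℕ.≤-refl))

        at : ∀ {r u} → (r , r) ∈ dominoCells (proj₁ u) → (r + 0 , r) ∈ dominoCells (proj₁ u)
        at {r} {u} = subst (λ s → (s , r) ∈ dominoCells (proj₁ u)) (sym (ℕ.+-identityʳ r))

        -- On the main diagonal the row is a count of smaller beads, so the lower row q < x + 1
        -- forces the smaller key.
        lt : keyOf v < κ
        lt = ℕ.≰⇒> λ κ≤ → ℕ.<⇒≱ (s≤s q≤x) (subst₂ _≤_
          (row≡ u∈ (at {u = horizontal (x , suc x) , l} (there (here refl)))) (row≡ v∈ (at {u = v} d∈))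
          (ℕ.+-mono-≤ (N-mono G 0 κ≤) (N-mono G 1 κ≤)))

        pick : type (proj₁ v) ≡ 1 ⊎ proj₁ v ≡ vertical (q , q) ⊎
               ∃[ q′ ] q ≡ suc q′ × (q′ , q) ∈ dominoCells (proj₁ v) →
               ∃[ l′ ] (vertical (q , q) , l′) ∈ S
        pick (inj₁ eq) = ⊥-elim (ℕ.n≮0 (subst (N G 1 (keyOf v) <_) none
          (subst (λ i → N G i (keyOf v) < N G i κ) eq (N-strict (bead⁺ v∈) lt))))
        pick (inj₂ (inj₁ eq)) = proj₂ v , subst (λ d → (d , proj₂ v) ∈ S) eq v∈
        pick (inj₂ (inj₂ (q′ , refl , c∈))) = ⊥-elim (bad
          (subst ((suc q′ , suc q′) ∈_) (cong (dominoCells ∘ proj₁)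
            (ownerS v∈ (proj₂ (covered none q′ (ℕ.<⇒≤ q≤x))) c∈ (there (here refl)))) d∈))
          where
          bad : ¬ ((suc q′ , suc q′) ∈ dominoCells (vertical (q′ , q′)))
          bad (here ())
          bad (there (here ()))

      clash : N G 1 κ ≡ 0 → ¬ (∃[ l′ ] (vertical (x , x) , l′) ∈ S)
      clash _ (l′ , v∈) = case ownerS u∈ v∈ (here refl) (there (here refl)) of λ ()

  module _ {sh : List ℕ} {m : ℕ → ℕ} (L : Lower sh (λ e → m e + m (suc e)))
           (bound : ∀ e → 0 < m e + m (suc e) → suc e < K) where

    -- The type and the rows of both ends fix a domino. For positive type the counts give both rows;
    -- for type 0 they give one, and the presence of a smaller bead of type 1 tells horizontal from
    -- vertical.
    domino-tableau-determined : (T U : ShiftedDominoTableau sh) → let open ShiftedDominoTableau in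
      dominoBeads (filling T) ↭ dominoBeads (filling U) →
      ∀ {u} → u ∈ labelled (filling T) → u ∈ labelled (filling U)
    domino-tableau-determined T U T↭U {d , l} u∈ =
      subst (_∈ U′.S) (cong₂ _,_ (sym d≡) (sym l≡)) v∈
      where
      module T′ = FromTableau {sh} {m} L bound T
      module U′ = FromTableau {sh} {m} L bound U

      found = U′.bead⁻ (∈-resp-↭ T↭U (T′.bead⁺ u∈))
      v  = proj₁ found
      d′ = proj₁ v
      v∈ : v ∈ U′.S
      v∈ = proj₁ (proj₂ found)
      bead≡ : dominoBead (d , l) ≡ dominoBead v
      bead≡ = proj₂ (proj₂ found)
      type≡ : type d ≡ type d′
      type≡ = cong proj₁ bead≡
      l≡ : l ≡ proj₂ v
      l≡ = cong proj₂ bead≡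
      N≡N : ∀ i → N T′.G i (keyOf (d , l)) ≡ N U′.G i (keyOf v)
      N≡N i = trans (N-↭ T↭U i _) (cong (λ b → N U′.G i (key b)) bead≡)

      lo≡ : loRow d ≡ loRow d′
      lo≡ = trans (sym (T′.row≡ u∈ (lo-cell d (T′.low u∈)))) (trans
        (cong₂ _+_ (trans (N≡N (type d)) (cong (λ i → N U′.G i (keyOf v)) type≡))
                   (trans (N≡N (suc (type d))) (cong (λ i → N U′.G (suc i) (keyOf v)) type≡)))
        (U′.row≡ v∈ (lo-cell d′ (U′.low v∈))))

      hi≡-type0 : ∀ d d′ → (d , l) ∈ T′.S → (d′ , proj₂ v) ∈ U′.S →
                  N T′.G 1 (keyOf (d , l)) ≡ N U′.G 1 (keyOf (d′ , proj₂ v)) →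
                  type d ≡ 0 → type d′ ≡ 0 → loRow d ≡ loRow d′ → hiRow d ≡ hiRow d′
      hi≡-type0 (horizontal _) (horizontal _) _ _ _ _ _ eq = eq
      hi≡-type0 (vertical _)   (vertical _)   _ _ _ _ _ eq = cong suc eq
      hi≡-type0 (horizontal (x , y)) (vertical (x′ , y′)) u∈ v∈ n≡ z z′ _ =
        ⊥-elim (mixed-hv u∈ v∈ n≡ (ℕ.≤-antisym (T′.low u∈) (ℕ.m∸n≡0⇒m≤n z))
                          (ℕ.≤-antisym (U′.low v∈) (ℕ.m∸n≡0⇒m≤n z′)))
        where
        mixed-hv : ∀ {x y x′ y′ l l′} → (horizontal (x , y) , l) ∈ T′.S → (vertical (x′ , y′) , l′) ∈ U′.S →
                   N T′.G 1 (keyOf (horizontal (x , y) , l)) ≡ N U′.G 1 (keyOf (vertical (x′ , y′) , l′)) →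
                   y ≡ suc x → y′ ≡ x′ → ⊥
        mixed-hv u∈ v∈ n≡ refl refl =
          ℕ.<-irrefl refl (subst (0 <_) (trans n≡ (U′.vertical⇒none v∈)) (T′.horizontal⇒some u∈))
      hi≡-type0 (vertical (x , y)) (horizontal (x′ , y′)) u∈ v∈ n≡ z z′ _ =
        ⊥-elim (mixed-vh u∈ v∈ n≡ (ℕ.≤-antisym (T′.low u∈) (ℕ.m∸n≡0⇒m≤n z))
                          (ℕ.≤-antisym (U′.low v∈) (ℕ.m∸n≡0⇒m≤n z′)))
        where
        mixed-vh : ∀ {x y x′ y′ l l′} → (vertical (x , y) , l) ∈ T′.S → (horizontal (x′ , y′) , l′) ∈ U′.S →
                   N T′.G 1 (keyOf (vertical (x , y) , l)) ≡ N U′.G 1 (keyOf (horizontal (x′ , y′) , l′)) →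
                   y ≡ x → y′ ≡ suc x′ → ⊥
        mixed-vh u∈ v∈ n≡ refl refl =
          ℕ.<-irrefl refl (subst (0 <_) (trans (sym n≡) (T′.vertical⇒none u∈)) (U′.horizontal⇒some v∈))

      hi≡ : ∀ i → type d ≡ i → hiRow d ≡ hiRow d′
      hi≡ zero    eq = hi≡-type0 d d′ u∈ v∈ (N≡N 1) eq (trans (sym type≡) eq) lo≡
      hi≡ (suc e) eq = trans (sym (T′.row≡ u∈ (hi-cell d (T′.low u∈) eq))) (trans
        (cong₂ _+_ (N≡N e) (N≡N (suc e)))
        (U′.row≡ v∈ (hi-cell d′ (U′.low v∈) (trans (sym type≡) eq))))

      d≡ : d ≡ d′
      d≡ = domino-determined d d′ (T′.low u∈) (U′.low v∈) type≡ lo≡ (hi≡ (type d) refl)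

-- Continuing the pattern above the main diagonal

dbl : ℕ → ℕ
dbl zero    = 0
dbl (suc s) = 2 + dbl s

-- The lengths of the diagonals y - x = 2s and y - x = 2s + 1 when type -2s has `m 0 ∸ s` dominoes
-- and type 1 - 2s has `m 1 ∸ s`.
record Upper (sh : List ℕ) (m : ℕ → ℕ) : Set where
  field
    even⁺ : ∀ s {p} → p < (m 0 ∸ s) + (m 1 ∸ s) → (p , p + dbl s) ∈ cells sh
    even⁻ : ∀ s {p} → (p , p + dbl s) ∈ cells sh → p < (m 0 ∸ s) + (m 1 ∸ s)
    odd⁺  : ∀ s {p} → p < (m 0 ∸ s) + (m 1 ∸ suc s) → (p , p + suc (dbl s)) ∈ cells sh
    odd⁻  : ∀ s {p} → (p , p + suc (dbl s)) ∈ cells sh → p < (m 0 ∸ s) + (m 1 ∸ suc s)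

Mark : Set
Mark = ℕ × Entry

Increasing : List Mark → Set
Increasing = AllPairs (λ p q → proj₁ p < proj₁ q)

rankOf : List Mark → ℕ → ℕ
rankOf = below proj₁

-- The keys survive because they still decide the places; the entries become `X` because the new
-- dominoes lie in the upper half.
blank : List Mark → List Mark
blank = map (λ p → proj₁ p , X) ∘ drop 1

blank-increasing : ∀ {xs} → Increasing xs → Increasing (blank xs)
blank-increasing []      = []
blank-increasing (_ ∷ i) = AllPairsₚ.map⁺ i

-- The dropped mark is the smallest one. If it is not below `z`, no mark is, and truncation keeps
-- both sides at 0.
rankOf-blank : ∀ {xs} → Increasing xs → ∀ z → rankOf (blank xs) z ≡ rankOf xs z ∸ 1
rankOf-blank []                z = refl
rankOf-blank {p ∷ xs} (p< ∷ i) z = begin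
  rankOf (map (λ p → proj₁ p , X) xs) z     ≡⟨ count-map (λ p → proj₁ p , X) (λ p → proj₁ p ℕ.<? z) xs ⟩
  rankOf xs z                               ≡⟨ lemma (proj₁ p ℕ.<? z) ⟩
  χ (proj₁ p ℕ.<? z) + rankOf xs z ∸ 1      ≡⟨ cong (_∸ 1) (count-∷ (λ p → proj₁ p ℕ.<? z) p xs) ⟨
  rankOf (p ∷ xs) z ∸ 1                     ∎
  where
  open ≡-Reasoning
  lemma : (d : Dec (proj₁ p < z)) → rankOf xs z ≡ χ d + rankOf xs z ∸ 1
  lemma (yes _) = refl
  lemma (no ≮) rewrite count-none (λ p → proj₁ p ℕ.<? z) xs
    (λ q∈ lt → ≮ (ℕ.<-trans (All.lookup p< q∈) lt)) = refl

∈-blank : ∀ xs {p} → p ∈ blank xs → proj₂ p ≡ X × ∃[ q ] q ∈ xs × proj₁ p ≡ proj₁ q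
∈-blank (_ ∷ xs) p∈ with q , q∈ , refl ← ∈-map⁻ (λ p → proj₁ p , X) p∈ = refl , q , there q∈ , refl

length-blank : ∀ xs → length (blank xs) ≡ length xs ∸ 1
length-blank xs = trans (length-map _ (drop 1 xs)) (length-drop 1 xs)

-- Dropping the first marks of the two leading diagonals continues the
-- interlacing pattern two diagonals further up.
module Continue (base : ℕ → List Mark) where

  -- After h steps, index e stands for type e - 2h.
  γ : ℕ → ℕ → List Mark
  γ zero    e             = base e
  γ (suc h) zero          = blank (γ h 0)
  γ (suc h) (suc zero)    = blank (γ h 1)
  γ (suc h) (suc (suc e)) = γ h e

  -- The number of marks dropped on the way to the list `γ h e`.
  o : ℕ → ℕ → ℕ
  o zero    e             = 0
  o (suc h) zero          = suc (o h 0)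
  o (suc h) (suc zero)    = suc (o h 1)
  o (suc h) (suc (suc e)) = o h e

  -- Two neighbouring lists have together lost as many marks as their common diagonal is steps above
  -- the main one, and this is the row in which that diagonal begins.
  o-sum : ∀ h e → o h e + o h (suc e) ≡ dbl h ∸ e
  o-sum zero    zero          = refl
  o-sum zero    (suc e)       = refl
  o-sum (suc h) zero          = cong suc (trans (ℕ.+-suc _ _) (cong suc (o-sum h 0)))
  o-sum (suc h) (suc zero)    = cong suc (trans (ℕ.+-comm (o h 1) (o h 0)) (o-sum h 0))
  o-sum (suc h) (suc (suc e)) = o-sum h e

  -- Dropped marks are counted as lying below every `z`; with them the interlacing inequalities
  -- persist.
  M : ℕ → ℕ → ℕ → ℕ
  M h e z = o h e + rankOf (γ h e) z

  γ-base : ∀ h i → γ h (dbl h + i) ≡ base i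
  γ-base zero    i = refl
  γ-base (suc h) i = γ-base h i

  γ-first : ∀ h → γ (suc h) (suc (dbl h)) ≡ blank (base 1)
  γ-first zero    = refl
  γ-first (suc h) = γ-first h

  γ-blank : ∀ h {e} → e < dbl h → ∀ {p} → p ∈ γ h e → proj₂ p ≡ X
  γ-blank (suc h) {zero}        _             p∈ = proj₁ (∈-blank (γ h 0) p∈)
  γ-blank (suc h) {suc zero}    _             p∈ = proj₁ (∈-blank (γ h 1) p∈)
  γ-blank (suc h) {suc (suc e)} (s≤s (s≤s e<)) p∈ = γ-blank h e< p∈

  length-γ₀ : ∀ h → length (γ h 0) ≡ length (base 0) ∸ h
  length-γ₀ zero    = refl
  length-γ₀ (suc h) = trans (length-blank (γ h 0)) (trans (cong (_∸ 1) (length-γ₀ h))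
    (trans (ℕ.∸-+-assoc _ h 1) (cong (length (base 0) ∸_) (ℕ.+-comm h 1))))

  length-γ₁ : ∀ h → length (γ h 1) ≡ length (base 1) ∸ h
  length-γ₁ zero    = refl
  length-γ₁ (suc h) = trans (length-blank (γ h 1)) (trans (cong (_∸ 1) (length-γ₁ h))
    (trans (ℕ.∸-+-assoc _ h 1) (cong (length (base 1) ∸_) (ℕ.+-comm h 1))))

  module _ (increasing : ∀ e → Increasing (base e)) where

    γ-increasing : ∀ h e → Increasing (γ h e)
    γ-increasing zero    e             = increasing e
    γ-increasing (suc h) zero          = blank-increasing (γ-increasing h 0)
    γ-increasing (suc h) (suc zero)    = blank-increasing (γ-increasing h 1)
    γ-increasing (suc h) (suc (suc e)) = γ-increasing h e

    module _ (interlace≥ : ∀ e z → rankOf (base (2 + e)) z ≤ rankOf (base e) z)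
             (interlace≤ : ∀ e z → rankOf (base e) z ≤ suc (rankOf (base (2 + e)) z)) where

      private
        up-≥ : ∀ a n → a + n ≤ suc a + (n ∸ 1)
        up-≥ a zero    = ℕ.+-monoˡ-≤ 0 (ℕ.n≤1+n a)
        up-≥ a (suc n) = ℕ.≤-reflexive (ℕ.+-suc a n)

        up-≤ : ∀ a n → suc a + (n ∸ 1) ≤ suc (a + n)
        up-≤ a n = s≤s (ℕ.+-monoʳ-≤ a (ℕ.m∸n≤m n 1))

      M-≥ : ∀ h e z → M h (2 + e) z ≤ M h e z
      M-≥ zero    e             z = interlace≥ e z
      M-≥ (suc h) zero          z rewrite rankOf-blank (γ-increasing h 0) z = up-≥ (o h 0) _
      M-≥ (suc h) (suc zero)    z rewrite rankOf-blank (γ-increasing h 1) z = up-≥ (o h 1) _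
      M-≥ (suc h) (suc (suc e)) z = M-≥ h e z

      M-≤ : ∀ h e z → M h e z ≤ suc (M h (2 + e) z)
      M-≤ zero    e             z = interlace≤ e z
      M-≤ (suc h) zero          z rewrite rankOf-blank (γ-increasing h 0) z = up-≤ (o h 0) _
      M-≤ (suc h) (suc zero)    z rewrite rankOf-blank (γ-increasing h 1) z = up-≤ (o h 1) _
      M-≤ (suc h) (suc (suc e)) z = M-≤ h e z

  module _ (apart : ∀ e {p q} → p ∈ base e → q ∈ base (suc e) → proj₁ p ≢ proj₁ q) where

    γ-apart : ∀ h e {p q} → p ∈ γ h e → q ∈ γ h (suc e) → proj₁ p ≢ proj₁ q
    γ-apart zero    e p∈ q∈ = apart e p∈ q∈
    γ-apart (suc h) zero p∈ q∈ eq =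
      let _ , p′ , p′∈ , ep = ∈-blank (γ h 0) p∈
          _ , q′ , q′∈ , eq′ = ∈-blank (γ h 1) q∈
      in γ-apart h 0 p′∈ q′∈ (trans (sym ep) (trans eq eq′))
    γ-apart (suc h) (suc zero) p∈ q∈ eq =
      let _ , p′ , p′∈ , ep = ∈-blank (γ h 1) p∈
      in γ-apart h 0 q∈ p′∈ (trans (sym eq) ep)
    γ-apart (suc h) (suc (suc e)) p∈ q∈ = γ-apart h e p∈ q∈

-- Dominoes placed by counting smaller marks

lo : Domino → Cell
lo (horizontal (x , y)) = suc x , y
lo (vertical c)         = c

type≡lo : ∀ d → type d ≡ col (lo d) ∸ row (lo d)
type≡lo (horizontal _) = refl
type≡lo (vertical _)   = refl

lo⇒low : ∀ d → row (lo d) ≤ col (lo d) → Low d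
lo⇒low (horizontal _) le = le
lo⇒low (vertical _)   le = le

low⇒lo : ∀ d → Low d → row (lo d) ≤ col (lo d)
low⇒lo (horizontal _) le = le
low⇒lo (vertical _)   le = le

smaller : (ℕ → List Mark) → ℕ → ℕ → ℕ
smaller γ e z = rankOf (γ e) z + rankOf (γ (suc e)) z

-- Mark (z , _) of γ (suc e) becomes the domino on the diagonals e and suc e
-- whose place on each is the number of smaller marks there; diagonal H is
-- the main one.
module Place (γ : ℕ → List Mark) (H : ℕ)
  (ρ-≥ : ∀ e z → smaller γ (suc e) z + (H ∸ suc e) ≤ smaller γ e z + (H ∸ e))
  (ρ-≤ : ∀ e z → smaller γ e z + (H ∸ e) ≤ suc (smaller γ (suc e) z + (H ∸ suc e)))
  (increasing : ∀ e → Increasing (γ e))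
  (apart : ∀ e {p q} → p ∈ γ e → q ∈ γ (suc e) → proj₁ p ≢ proj₁ q)
  where

  n : ℕ → ℕ → ℕ
  n = smaller γ

  ρ : ℕ → ℕ → ℕ
  ρ e z = n e z + (H ∸ e)

  -- A diagonal starts at (0, H - e) above the main one and at (e - H, 0) below it; one of the
  -- truncated differences is always 0.
  at : ℕ → ℕ → Cell
  at e z = n e z + (e ∸ H) , ρ e z

  col-row : ∀ e z → col (at e z) + H ≡ ρ e z + e
  col-row e z = begin
    n e z + (e ∸ H) + H   ≡⟨ ℕ.+-assoc (n e z) _ _ ⟩
    n e z + ((e ∸ H) + H) ≡⟨ cong (n e z +_) balance ⟩
    n e z + ((H ∸ e) + e) ≡⟨ ℕ.+-assoc (n e z) _ _ ⟨
    n e z + (H ∸ e) + e   ∎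
    where
    open ≡-Reasoning
    balance : (e ∸ H) + H ≡ (H ∸ e) + e
    balance with ℕ.≤-total e H
    ... | inj₁ e≤H = trans (cong (_+ H) (ℕ.m≤n⇒m∸n≡0 e≤H)) (sym (ℕ.m∸n+n≡m e≤H))
    ... | inj₂ H≤e = trans (ℕ.m∸n+n≡m H≤e) (sym (cong (_+ e) (ℕ.m≤n⇒m∸n≡0 H≤e)))

  -- By `ρ-≥` and `ρ-≤` the two cells have equal or consecutive rows, hence they are neighbours in
  -- either case.
  F : ℕ → ℕ → Domino
  F e z with ρ e z ℕ.≤? ρ (suc e) z
  ... | yes _ = horizontal (at e z)
  ... | no  _ = vertical (at (suc e) z)

  private
    same-row : ∀ {e z} → ρ e z ≤ ρ (suc e) z → at (suc e) z ≡ (suc (col (at e z)) , ρ e z)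
    same-row {e} {z} le = cong₂ _,_ (ℕ.+-cancelʳ-≡ H _ _ (begin
      col (at (suc e) z) + H ≡⟨ col-row (suc e) z ⟩
      ρ (suc e) z + suc e    ≡⟨ cong (_+ suc e) eq ⟩
      ρ e z + suc e          ≡⟨ ℕ.+-suc _ e ⟩
      suc (ρ e z + e)        ≡⟨ cong suc (col-row e z) ⟨
      suc (col (at e z) + H) ∎)) eq
      where
      open ≡-Reasoning
      eq : ρ (suc e) z ≡ ρ e z
      eq = ℕ.≤-antisym (ρ-≥ e z) le

    same-column : ∀ {e z} → ¬ (ρ e z ≤ ρ (suc e) z) → at e z ≡ (col (at (suc e) z) , suc (ρ (suc e) z))
    same-column {e} {z} ≰ = cong₂ _,_ (ℕ.+-cancelʳ-≡ H _ _ (begin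
      col (at e z) + H         ≡⟨ col-row e z ⟩
      ρ e z + e                ≡⟨ cong (_+ e) eq ⟩
      suc (ρ (suc e) z) + e    ≡⟨ ℕ.+-suc _ e ⟨
      ρ (suc e) z + suc e      ≡⟨ col-row (suc e) z ⟨
      col (at (suc e) z) + H   ∎)) eq
      where
      open ≡-Reasoning
      eq : ρ e z ≡ suc (ρ (suc e) z)
      eq = ℕ.≤-antisym (ρ-≤ e z) (ℕ.≰⇒> ≰)

  F-lo : ∀ e z → lo (F e z) ≡ at (suc e) z
  F-lo e z with ρ e z ℕ.≤? ρ (suc e) z
  ... | yes le = sym (same-row le)
  ... | no  _  = refl

  F-vertical : ∀ {e z} → ¬ (ρ e z ≤ ρ (suc e) z) → F e z ≡ vertical (at (suc e) z)
  F-vertical {e} {z} ≰ with ρ e z ℕ.≤? ρ (suc e) z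
  ... | yes le = ⊥-elim (≰ le)
  ... | no  _  = refl

  vertical⁻ : ∀ {e z c} → F e z ≡ vertical c → ¬ (ρ e z ≤ ρ (suc e) z)
  vertical⁻ {e} {z} eq with ρ e z ℕ.≤? ρ (suc e) z
  vertical⁻ () | yes _
  ... | no ≰ = ≰

  ∈-F⁻ : ∀ {e z c} → c ∈ dominoCells (F e z) → ∃[ a ] (a ≤ suc e × e ≤ a) × c ≡ at a z
  ∈-F⁻ {e} {z} c∈ with ρ e z ℕ.≤? ρ (suc e) z
  ∈-F⁻ {e} (here eq)         | yes le = e , (ℕ.n≤1+n e , ℕ.≤-refl) , eq
  ∈-F⁻ {e} (there (here eq)) | yes le = suc e , (ℕ.≤-refl , ℕ.n≤1+n e) , trans eq (sym (same-row le))
  ∈-F⁻ {e} (here eq)         | no ≰   = suc e , (ℕ.≤-refl , ℕ.n≤1+n e) , eq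
  ∈-F⁻ {e} (there (here eq)) | no ≰   = e , (ℕ.n≤1+n e , ℕ.≤-refl) , trans eq (sym (same-column ≰))

  ∈-F-hi : ∀ e z → at e z ∈ dominoCells (F e z)
  ∈-F-hi e z with ρ e z ℕ.≤? ρ (suc e) z
  ... | yes _ = here refl
  ... | no ≰  = there (here (same-column ≰))

  ∈-F-lo : ∀ e z → at (suc e) z ∈ dominoCells (F e z)
  ∈-F-lo e z with ρ e z ℕ.≤? ρ (suc e) z
  ... | yes le = there (here (same-row le))
  ... | no _   = here refl

  n-mono : ∀ e {z z′} → z ≤ z′ → n e z ≤ n e z′
  n-mono e z≤ = ℕ.+-mono-≤ (below-mono proj₁ (γ e) z≤) (below-mono proj₁ (γ (suc e)) z≤)

  On : ℕ → Mark → Set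
  On a p = p ∈ γ a ⊎ p ∈ γ (suc a)

  n-strict : ∀ {a p z} → On a p → proj₁ p < z → n a (proj₁ p) < n a z
  n-strict {a} (inj₁ p∈) lt = ℕ.+-mono-<-≤ (below-strict proj₁ (γ a) p∈ lt) (below-mono proj₁ (γ (suc a)) (ℕ.<⇒≤ lt))
  n-strict {a} (inj₂ p∈) lt = ℕ.+-mono-≤-< (below-mono proj₁ (γ a) (ℕ.<⇒≤ lt)) (below-strict proj₁ (γ (suc a)) p∈ lt)

  n-length : ∀ {a p} → On a p → n a (proj₁ p) < length (γ a) + length (γ (suc a))
  n-length {a} (inj₁ p∈) = ℕ.+-mono-<-≤ (below-length proj₁ (γ a) p∈) (length-filter _ (γ (suc a)))
  n-length {a} (inj₂ p∈) = ℕ.+-mono-≤-< (length-filter _ (γ a)) (below-length proj₁ (γ (suc a)) p∈)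

  -- The difference of the coordinates gives the diagonal, and along it the number of smaller marks
  -- grows strictly with the key.
  at-injective : ∀ {a b p q} → On a p → On b q → at a (proj₁ p) ≡ at b (proj₁ q) →
                 a ≡ b × proj₁ p ≡ proj₁ q
  at-injective {a} {b} {p} {q} pa qb eq = a≡b , z≡z′
    where
    a≡b : a ≡ b
    a≡b = ℕ.+-cancelˡ-≡ (ρ a (proj₁ p)) a b (trans (sym (col-row a (proj₁ p)))
      (trans (cong (λ c → col c + H) eq) (trans (col-row b (proj₁ q)) (cong (λ c → row c + b) (sym eq)))))
    n≡ : n a (proj₁ p) ≡ n a (proj₁ q)
    n≡ = ℕ.+-cancelʳ-≡ (H ∸ a) _ _ (trans (cong row eq) (cong (λ b → ρ b (proj₁ q)) (sym a≡b)))
    z≡z′ : proj₁ p ≡ proj₁ q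
    z≡z′ with ℕ.<-cmp (proj₁ p) (proj₁ q)
    ... | tri< lt _ _ = ⊥-elim (ℕ.<-irrefl n≡ (n-strict {a} pa lt))
    ... | tri≈ _ e _  = e
    ... | tri> _ _ gt = ⊥-elim (ℕ.<-irrefl (sym n≡) (n-strict {a} (subst (λ b → On b q) (sym a≡b) qb) gt))

  increasing⇒unique : ∀ {xs : List Mark} → Increasing xs → Unique (map proj₁ xs)
  increasing⇒unique i = AllPairsₚ.map⁺ (AllPairs.map ℕ.<⇒≢ i)

  find-mark : ∀ {a p} → p < length (γ a) + length (γ (suc a)) → ∃[ q ] On a q × n a (proj₁ q) ≡ p
  find-mark {a} {p} p< =
    let q , q∈ , eq = select proj₁ (γ a ++ γ (suc a))
          (subst Unique (sym (map-++ proj₁ (γ a) (γ (suc a))))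
            (Unique.++⁺ (increasing⇒unique (increasing a)) (increasing⇒unique (increasing (suc a)))
              λ (u , v) → let p , p∈ , ep = ∈-map⁻ proj₁ u
                              q , q∈ , eq = ∈-map⁻ proj₁ v
                          in apart a p∈ q∈ (trans (sym ep) eq)))
          (subst (p <_) (sym (length-++ (γ a))) p<)
    in q , ∈-++⁻ (γ a) q∈
     , trans (sym (count-++ (λ r → proj₁ r ℕ.<? proj₁ q) (γ a) (γ (suc a)))) eq

  on-from : ∀ {a e p} → a ≤ suc e → e ≤ a → p ∈ γ (suc e) → On a p
  on-from {a} {e} a≤ e≤ p∈ with ℕ.m≤n⇒m<n∨m≡n a≤
  ... | inj₂ refl     = inj₁ p∈
  ... | inj₁ (s≤s a≤e) with refl ← ℕ.≤-antisym a≤e e≤ = inj₂ p∈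

  mark-unique : ∀ {e p q} → p ∈ γ e → q ∈ γ e → proj₁ p ≡ proj₁ q → p ≡ q
  mark-unique {e} = unique-map-injective (increasing⇒unique (increasing e))

  -- A common cell forces equal keys, and neighbouring lists have none in common.
  F-owner : ∀ {e e′ p q c} → p ∈ γ (suc e) → q ∈ γ (suc e′) →
            c ∈ dominoCells (F e (proj₁ p)) → c ∈ dominoCells (F e′ (proj₁ q)) → e ≡ e′ × p ≡ q
  F-owner {e} {e′} {p} {q} p∈ q∈ c∈ c∈′ =
    let a , (a≤ , ≤a) , eq = ∈-F⁻ c∈
        b , (b≤ , ≤b) , eq′ = ∈-F⁻ c∈′
        a≡b , z≡ = at-injective (on-from a≤ ≤a p∈) (on-from b≤ ≤b q∈) (trans (sym eq) eq′)
    in same (ℕ.≤-trans ≤a (subst (_≤ suc e′) (sym a≡b) b≤)) (ℕ.≤-trans ≤b (subst (_≤ suc e) a≡b a≤)) z≡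
    where
    same : e ≤ suc e′ → e′ ≤ suc e → proj₁ p ≡ proj₁ q → e ≡ e′ × p ≡ q
    same le le′ z≡ with ℕ.<-cmp e e′
    ... | tri≈ _ refl _ = refl , mark-unique p∈ q∈ z≡
    ... | tri< lt _ _ with refl ← ℕ.≤-antisym le′ lt = ⊥-elim (apart (suc e) p∈ q∈ z≡)
    ... | tri> _ _ gt with refl ← ℕ.≤-antisym le gt = ⊥-elim (apart (suc e′) q∈ p∈ (sym z≡))

  marks : ℕ → List (ℕ × Mark)
  marks B = concatMap (λ e → map (e ,_) (γ (suc e))) (upTo B)

  ∈-marks⁺ : ∀ {B e p} → e < B → p ∈ γ (suc e) → (e , p) ∈ marks B
  ∈-marks⁺ {e = e} e<B p∈ = ∈-concatMap-intro (λ e → map (e ,_) (γ (suc e))) (∈-upTo⁺ e<B) (∈-map⁺ (e ,_) p∈)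

  ∈-marks⁻ : ∀ B {e p} → (e , p) ∈ marks B → p ∈ γ (suc e)
  ∈-marks⁻ B j∈ with e , _ , q ← ∈-concatMap-elim (λ e → map (e ,_) (γ (suc e))) (upTo B) j∈
    with _ , p∈ , refl ← ∈-map⁻ (e ,_) q = p∈

  marks-unique : ∀ B → Unique (marks B)
  marks-unique B = unique-concatMap _ (Unique.upTo⁺ B)
    (λ {e} _ → Unique.map⁺ (cong proj₂) (Unique.map⁻ (increasing⇒unique (increasing (suc e)))))
    λ {e} {e′} _ _ p q → let _ , _ , eq = ∈-map⁻ (e ,_) p
                             _ , _ , eq′ = ∈-map⁻ (e′ ,_) q
                         in trans (sym (cong proj₁ eq)) (cong proj₁ eq′)

  place : ℕ × Mark → Domino × Entry
  place (e , z , entry) = F e z , entry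

  filling : ℕ → Filling Domino
  filling B = map place (marks B)

  paving : ∀ {sh} B → (∀ {e} → B ≤ e → γ (suc e) ≡ []) →
           (∀ {a q} → On a q → at a (proj₁ q) ∈ cells sh) →
           (∀ {c} → c ∈ cells sh → ∃[ e ] ∃[ q ] q ∈ γ (suc e) × c ∈ dominoCells (F e (proj₁ q))) →
           IsPaving sh (map proj₁ (filling B))
  paving {sh} B bounded into onto = subst (_↭ cells sh) (sym list≡)
    (same-members⇒↭ unique (cells-unique sh) sound complete)
    where
    tile : ℕ × Mark → List Cell
    tile (e , z , _) = dominoCells (F e z)

    list≡ : concatMap dominoCells (map proj₁ (filling B)) ≡ concatMap tile (marks B)
    list≡ = trans (cong (concatMap dominoCells) (sym (map-∘ (marks B)))) (concatMap-map dominoCells (proj₁ ∘ place) (marks B))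

    unique : Unique (concatMap tile (marks B))
    unique = unique-concatMap tile (marks-unique B) (λ {j} _ → cells-distinct (F (proj₁ j) (proj₁ (proj₂ j))))
      λ {(e , p)} {(e′ , q)} j∈ j∈′ c∈ c∈′ →
        let e≡ , p≡ = F-owner (∈-marks⁻ B j∈) (∈-marks⁻ B j∈′) c∈ c∈′ in cong₂ _,_ e≡ p≡

    sound : ∀ {c} → c ∈ concatMap tile (marks B) → c ∈ cells sh
    sound c∈ = let (e , p) , j∈ , d∈ = ∈-concatMap-elim tile (marks B) c∈
                   a , (a≤ , ≤a) , eq = ∈-F⁻ d∈
               in subst (_∈ cells sh) (sym eq) (into (on-from a≤ ≤a (∈-marks⁻ B j∈)))

    complete : ∀ {c} → c ∈ cells sh → c ∈ concatMap tile (marks B)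
    complete c∈ = let e , q , q∈ , d∈ = onto c∈
                  in ∈-concatMap-intro tile (∈-marks⁺ (ℕ.≰⇒> λ B≤e → case subst (q ∈_) (bounded B≤e) q∈ of λ ()) q∈) d∈

  ρ-anti : ∀ {a b} z → a ≤ b → ρ b z ≤ ρ a z
  ρ-anti {b = zero}  z z≤n = ℕ.≤-refl
  ρ-anti {b = suc b} z a≤ with ℕ.m≤n⇒m<n∨m≡n a≤
  ... | inj₂ refl      = ℕ.≤-refl
  ... | inj₁ (s≤s a≤b) = ℕ.≤-trans (ρ-≥ b z) (ρ-anti z a≤b)

  ρ-steps : ∀ a d z → ρ a z ≤ d + ρ (d + a) z
  ρ-steps a zero    z = ℕ.≤-refl
  ρ-steps a (suc d) z = begin
    ρ a z                         ≤⟨ ρ-steps a d z ⟩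
    d + ρ (d + a) z               ≤⟨ ℕ.+-monoʳ-≤ d (ρ-≤ (d + a) z) ⟩
    d + suc (ρ (suc d + a) z)     ≡⟨ ℕ.+-suc d _ ⟩
    suc d + ρ (suc d + a) z       ∎
    where open ℕ.≤-Reasoning

  -- The argument is that for Young tableaux, with `ρ` as the row on all diagonals, also those above
  -- the main one.
  row-order : ∀ {a b z q} → On b q → ρ a z ≡ ρ b (proj₁ q) →
              col (at a z) < col (at b (proj₁ q)) → a < b × z ≤ proj₁ q
  row-order {a} {b} {z} {q} qb eq lt = a<b , ℕ.≮⇒≥ λ q<z → ℕ.<-irrefl refl (begin-strict
    ρ b (proj₁ q) <⟨ ℕ.+-monoˡ-< (H ∸ b) (n-strict qb q<z) ⟩
    ρ b z         ≤⟨ ρ-anti z (ℕ.<⇒≤ a<b) ⟩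
    ρ a z         ≡⟨ eq ⟩
    ρ b (proj₁ q) ∎)
    where
    open ℕ.≤-Reasoning
    a<b : a < b
    a<b = ℕ.+-cancelˡ-< (ρ a z) a b (begin-strict
      ρ a z + a                  ≡⟨ col-row a z ⟨
      col (at a z) + H           <⟨ ℕ.+-monoˡ-< H lt ⟩
      col (at b (proj₁ q)) + H   ≡⟨ col-row b (proj₁ q) ⟩
      ρ b (proj₁ q) + b          ≡⟨ cong (_+ b) eq ⟨
      ρ a z + b                  ∎)

  column-order : ∀ {a b z q} → On b q → col (at a z) ≡ col (at b (proj₁ q)) →
                 ρ a z < ρ b (proj₁ q) → b < a × z ≤ proj₁ q
  column-order {a} {b} {z} {q} qb eq lt = b<a , ℕ.≮⇒≥ λ q<z → ℕ.<-irrefl refl (begin-strict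
    ρ b (proj₁ q)                     <⟨ ℕ.+-monoˡ-< (H ∸ b) (n-strict qb ℕ.≤-refl) ⟩
    ρ b (suc (proj₁ q))               ≤⟨ ρ-steps b d (suc (proj₁ q)) ⟩
    d + ρ (d + b) (suc (proj₁ q))     ≡⟨ cong (λ e → d + ρ e (suc (proj₁ q))) d+b≡a ⟩
    d + ρ a (suc (proj₁ q))           ≤⟨ ℕ.+-monoʳ-≤ d (ℕ.+-monoˡ-≤ (H ∸ a) (n-mono a q<z)) ⟩
    d + ρ a z                         ≡⟨ ℕ.m∸n+n≡m (ℕ.<⇒≤ lt) ⟩
    ρ b (proj₁ q)                     ∎)
    where
    open ℕ.≤-Reasoning
    d = ρ b (proj₁ q) ∸ ρ a z
    sum≡ : ρ a z + a ≡ ρ b (proj₁ q) + b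
    sum≡ = trans (sym (col-row a z)) (trans (cong (_+ H) eq) (col-row b (proj₁ q)))
    d+b≡a : d + b ≡ a
    d+b≡a = ℕ.+-cancelˡ-≡ (ρ a z) _ _ (begin-equality
      ρ a z + (d + b)     ≡⟨ ℕ.+-assoc (ρ a z) d b ⟨
      ρ a z + d + b       ≡⟨ cong (_+ b) (ℕ.m+[n∸m]≡n (ℕ.<⇒≤ lt)) ⟩
      ρ b (proj₁ q) + b   ≡⟨ sum≡ ⟨
      ρ a z + a           ∎)
    b<a : b < a
    b<a = subst (b <_) d+b≡a (ℕ.m<n+m b (ℕ.m<n⇒0<n∸m lt))

-- From beads to shifted domino tableaux

module Assemble (K : ℕ) where

  open Keys K
  open Dominoes K

  module FromBeads {sh : List ℕ} {m : ℕ → ℕ} (L : Lower sh (λ e → m e + m (suc e))) (U : Upper sh m)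
                   {G : List Bead} (V : Valid m G) (sorted : AllPairs (λ b c → key b < key c) G) where

    open Lower L
    open Upper U
    open Valid V

    mark : Bead → Mark
    mark b = key b , just (proj₂ b)

    base : ℕ → List Mark
    base i = map mark (ofType i G)

    ∈-base⁺ : ∀ {i l} → (i , l) ∈ G → mark (i , l) ∈ base i
    ∈-base⁺ b∈ = ∈-map⁺ mark (∈-filter⁺ _ b∈ refl)

    ∈-base⁻ : ∀ {i p} → p ∈ base i → ∃[ l ] (i , l) ∈ G × p ≡ mark (i , l)
    ∈-base⁻ {i} p∈ with (_ , l) , b∈ , refl ← ∈-map⁻ mark p∈
      with b∈G , refl ← ∈-filter⁻ (λ b → proj₁ b ℕ.≟ i) {xs = G} b∈ = l , b∈G , refl

    base-increasing : ∀ i → Increasing (base i)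
    base-increasing i = AllPairsₚ.map⁺ (AllPairsₚ.filter⁺ _ sorted)

    rankOf-base : ∀ i z → rankOf (base i) z ≡ N G i z
    rankOf-base i z = trans (count-map mark (λ p → proj₁ p ℕ.<? z) (ofType i G)) (sym (N≡below G i z))

    length-base : ∀ i → length (base i) ≡ m i
    length-base i = trans (length-map mark (ofType i G)) (length-ofType i)

    base-apart : ∀ i {p q} → p ∈ base i → q ∈ base (suc i) → proj₁ p ≢ proj₁ q
    base-apart i p∈ q∈ eq =
      let l , b∈ , ep = ∈-base⁻ p∈
          l′ , b∈′ , eq′ = ∈-base⁻ q∈
      in ℕ.<-irrefl (cong proj₁ (key-inj b∈ b∈′ (trans (sym (cong proj₁ ep)) (trans eq (cong proj₁ eq′)))))
           (ℕ.n<1+n i)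

    open Continue base

    M-≥′ = M-≥ base-increasing
      (λ i z → subst₂ _≤_ (sym (rankOf-base (2 + i) z)) (sym (rankOf-base i z)) (interlace≥ i z))
      (λ i z → subst₂ _≤_ (sym (rankOf-base i z)) (cong suc (sym (rankOf-base (2 + i) z))) (interlace≤ i z))
    M-≤′ = M-≤ base-increasing
      (λ i z → subst₂ _≤_ (sym (rankOf-base (2 + i) z)) (sym (rankOf-base i z)) (interlace≥ i z))
      (λ i z → subst₂ _≤_ (sym (rankOf-base i z)) (cong suc (sym (rankOf-base (2 + i) z))) (interlace≤ i z))

    -- `suc h′` steps exceed `m 0` and `m 1`, so the two leading lists are exhausted and the
    -- diagonal of index 0 is empty. As there is at least one step, the diagonal just above the main
    -- one has an index too.
    h′ H : ℕ
    h′ = m 0 + m 1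
    H  = dbl (suc h′)

    Γ : ℕ → List Mark
    Γ = γ (suc h′)

    private
      ρ≡ : ∀ e z → (rankOf (Γ e) z + rankOf (Γ (suc e)) z) + (H ∸ e) ≡ M (suc h′) e z + M (suc h′) (suc e) z
      ρ≡ e z = begin
        (rankOf (Γ e) z + rankOf (Γ (suc e)) z) + (H ∸ e)
          ≡⟨ cong ((rankOf (Γ e) z + rankOf (Γ (suc e)) z) +_) (o-sum (suc h′) e) ⟨
        (rankOf (Γ e) z + rankOf (Γ (suc e)) z) + (o (suc h′) e + o (suc h′) (suc e))
          ≡⟨ ℕ.+-comm (rankOf (Γ e) z + rankOf (Γ (suc e)) z) _ ⟩
        (o (suc h′) e + o (suc h′) (suc e)) + (rankOf (Γ e) z + rankOf (Γ (suc e)) z)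
          ≡⟨ interchange (o (suc h′) e) _ _ _ ⟩
        M (suc h′) e z + M (suc h′) (suc e) z ∎
        where open ≡-Reasoning

    open Place Γ H
      (λ e z → subst₂ _≤_ (sym (ρ≡ (suc e) z)) (sym (ρ≡ e z))
        (subst (M (suc h′) (suc e) z + M (suc h′) (2 + e) z ≤_) (ℕ.+-comm (M (suc h′) (suc e) z) _)
          (ℕ.+-monoʳ-≤ (M (suc h′) (suc e) z) (M-≥′ (suc h′) e z))))
      (λ e z → subst₂ _≤_ (sym (ρ≡ e z)) (cong suc (sym (ρ≡ (suc e) z)))
        (subst₂ _≤_ (ℕ.+-comm (M (suc h′) (suc e) z) _) (ℕ.+-suc (M (suc h′) (suc e) z) _)
          (ℕ.+-monoʳ-≤ (M (suc h′) (suc e) z) (M-≤′ (suc h′) e z))))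
      (γ-increasing base-increasing (suc h′))
      (γ-apart base-apart (suc h′))
      public

    -- The lists lose marks at the rate at which `Upper` makes the diagonals of the shape shrink;
    -- from the main diagonal on, `Lower` gives the lengths.
    sizes⁺ : ∀ h e {p} → p < length (γ h e) + length (γ h (suc e)) → (p + (e ∸ dbl h) , p + (dbl h ∸ e)) ∈ cells sh
    sizes⁺ zero e {p} p< = subst (λ r → (p + e , r) ∈ cells sh) (sym (trans (cong (p +_) (ℕ.0∸n≡0 e)) (ℕ.+-identityʳ p)))
      (mem⁺ e (subst₂ (λ a b → p < a + b) (length-base e) (length-base (suc e)) p<))
    sizes⁺ (suc h) zero {p} p< = subst (λ c → (c , p + dbl (suc h)) ∈ cells sh) (sym (ℕ.+-identityʳ p))
      (even⁺ (suc h) (subst₂ (λ a b → p < a + b)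
        (trans (length-γ₀ (suc h)) (cong (_∸ suc h) (length-base 0)))
        (trans (length-γ₁ (suc h)) (cong (_∸ suc h) (length-base 1))) p<))
    sizes⁺ (suc h) (suc zero) {p} p< = subst (λ c → (c , p + suc (dbl h)) ∈ cells sh) (sym (ℕ.+-identityʳ p))
      (odd⁺ h (subst₂ (λ a b → p < a + b)
        (trans (length-γ₀ h) (cong (_∸ h) (length-base 0)))
        (trans (length-γ₁ (suc h)) (cong (_∸ suc h) (length-base 1)))
        (subst (p <_) (ℕ.+-comm (length (γ (suc h) 1)) (length (γ h 0))) p<)))
    sizes⁺ (suc h) (suc (suc e)) p< = sizes⁺ h e p<

    sizes⁻ : ∀ h e {p} → (p + (e ∸ dbl h) , p + (dbl h ∸ e)) ∈ cells sh → p < length (γ h e) + length (γ h (suc e))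
    sizes⁻ zero e {p} c∈ = subst₂ (λ a b → p < a + b) (sym (length-base e)) (sym (length-base (suc e)))
      (mem⁻ e (subst (λ r → (p + e , r) ∈ cells sh) (trans (cong (p +_) (ℕ.0∸n≡0 e)) (ℕ.+-identityʳ p)) c∈))
    sizes⁻ (suc h) zero {p} c∈ = subst₂ (λ a b → p < a + b)
      (sym (trans (length-γ₀ (suc h)) (cong (_∸ suc h) (length-base 0))))
      (sym (trans (length-γ₁ (suc h)) (cong (_∸ suc h) (length-base 1))))
      (even⁻ (suc h) (subst (λ c → (c , p + dbl (suc h)) ∈ cells sh) (ℕ.+-identityʳ p) c∈))
    sizes⁻ (suc h) (suc zero) {p} c∈ = subst (p <_) (ℕ.+-comm (length (γ h 0)) (length (γ (suc h) 1)))
      (subst₂ (λ a b → p < a + b)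
        (sym (trans (length-γ₀ h) (cong (_∸ h) (length-base 0))))
        (sym (trans (length-γ₁ (suc h)) (cong (_∸ suc h) (length-base 1))))
        (odd⁻ h (subst (λ c → (c , p + suc (dbl h)) ∈ cells sh) (ℕ.+-identityʳ p) c∈)))
    sizes⁻ (suc h) (suc (suc e)) c∈ = sizes⁻ h e c∈

    into : ∀ {a q} → On a q → at a (proj₁ q) ∈ cells sh
    into {a} {q} on = sizes⁺ (suc h′) a (n-length {a} {q} on)

    length-Γ₀ : length (Γ 0) ≡ 0
    length-Γ₀ = trans (length-γ₀ (suc h′)) (trans (cong (_∸ suc h′) (length-base 0))
      (ℕ.m≤n⇒m∸n≡0 (ℕ.m≤n⇒m≤1+n (ℕ.m≤m+n (m 0) (m 1)))))

    length-Γ₁ : length (Γ 1) ≡ 0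
    length-Γ₁ = trans (length-γ₁ (suc h′)) (trans (cong (_∸ suc h′) (length-base 1))
      (ℕ.m≤n⇒m∸n≡0 (ℕ.m≤n⇒m≤1+n (ℕ.m≤n+m (m 1) (m 0)))))

    down-to : ∀ {x y} d → (x , d + y) ∈ cells sh → (x , y) ∈ cells sh
    down-to zero    c∈ = c∈
    down-to (suc d) c∈ = down-to d (downClosed c∈)

    numbered : ∀ {x y} → (x , y) ∈ cells sh → ∃[ a ] ∃[ p ] (x , y) ≡ (p + (a ∸ H) , p + (H ∸ a))
    numbered {x} {y} c∈ with ℕ.≤-total y x
    ... | inj₁ y≤x = H + (x ∸ y) , y , cong₂ _,_
      (sym (trans (cong (y +_) (ℕ.m+n∸m≡n H (x ∸ y))) (ℕ.m+[n∸m]≡n y≤x)))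
      (sym (trans (cong (y +_) (ℕ.m≤n⇒m∸n≡0 (ℕ.m≤m+n H (x ∸ y)))) (ℕ.+-identityʳ y)))
    ... | inj₂ x≤y with y ∸ x ℕ.≤? H
    ...   | yes d≤H = H ∸ (y ∸ x) , x , cong₂ _,_
      (sym (trans (cong (x +_) (ℕ.m≤n⇒m∸n≡0 (ℕ.m∸n≤m H (y ∸ x)))) (ℕ.+-identityʳ x)))
      (sym (trans (cong (x +_) (ℕ.m∸[m∸n]≡n d≤H)) (ℕ.m+[n∸m]≡n x≤y)))
    -- A cell beyond index 0 would, on moving down, put a cell on the diagonal of index 0, which is
    -- empty.
    ...   | no d≰H = ⊥-elim (ℕ.n≮0 (subst (x <_) (cong₂ _+_ length-Γ₀ length-Γ₁)
      (sizes⁻ (suc h′) 0 (subst (λ c → (c , x + H) ∈ cells sh) (sym (ℕ.+-identityʳ x))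
        (down-to (y ∸ (x + H)) (subst (λ r → (x , r) ∈ cells sh) (sym (ℕ.m∸n+n≡m x+H≤y)) c∈))))))
      where
      x+H≤y : x + H ≤ y
      x+H≤y = subst (x + H ≤_) (ℕ.m+[n∸m]≡n x≤y) (ℕ.+-monoʳ-≤ x (ℕ.<⇒≤ (ℕ.≰⇒> d≰H)))

    onto : ∀ {c} → c ∈ cells sh → ∃[ e ] ∃[ q ] q ∈ Γ (suc e) × c ∈ dominoCells (F e (proj₁ q))
    onto {c} c∈ =
      let a , p , c≡ = numbered c∈
          q , on , n≡p = find-mark {a} (sizes⁻ (suc h′) a (subst (_∈ cells sh) c≡ c∈))
          e , q∈ , d∈ = covering a on
      in e , q , q∈ , subst (_∈ dominoCells (F e (proj₁ q)))
           (trans (cong (λ r → r + (a ∸ H) , r + (H ∸ a)) n≡p) (sym c≡)) d∈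
      where
      covering : ∀ a {q} → On a q → ∃[ e ] q ∈ Γ (suc e) × at a (proj₁ q) ∈ dominoCells (F e (proj₁ q))
      covering a       {q} (inj₂ q∈) = a , q∈ , ∈-F-hi a (proj₁ q)
      covering (suc e) {q} (inj₁ q∈) = e , q∈ , ∈-F-lo e (proj₁ q)
      -- Dominoes come from the lists of index at least 1; list 0 is empty.
      covering zero    {q} (inj₁ q∈) = ⊥-elim (no-member length-Γ₀ q∈)
        where
        no-member : ∀ {xs : List Mark} → length xs ≡ 0 → ¬ (q ∈ xs)
        no-member {[]} _ ()

    top : ℕ
    top = H + K

    beyond : ∀ {e} → top ≤ e → Γ (suc e) ≡ []
    beyond {e} top≤e = empty λ {p} p∈ →
      let l , b∈ , _ = ∈-base⁻ (subst (p ∈_) Γ≡ p∈)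
      in ℕ.<⇒≱ (bounded b∈) (ℕ.≤-trans (ℕ.m+n≤o⇒m≤o∸n K (subst (_≤ e) (ℕ.+-comm H K) top≤e))
           (ℕ.∸-monoˡ-≤ H (ℕ.n≤1+n e)))
      where
      Γ≡ : Γ (suc e) ≡ base (suc e ∸ H)
      Γ≡ = trans (cong Γ (sym (ℕ.m+[n∸m]≡n {H} (ℕ.m≤n⇒m≤1+n (ℕ.m+n≤o⇒m≤o H top≤e))))) (γ-base (suc h′) (suc e ∸ H))
      empty : ∀ {xs : List Mark} → (∀ {p} → ¬ (p ∈ xs)) → xs ≡ []
      empty {[]}     _ = refl
      empty {x ∷ xs} f = ⊥-elim (f (here refl))

    t : Filling Domino
    t = filling top

    t-paving : IsPaving sh (map proj₁ t)
    t-paving = paving {sh} top beyond (λ {a} {q} → into {a} {q}) onto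

    -- suc (E i) is the diagonal H + i.
    E : ℕ → ℕ
    E i = suc (dbl h′ + i)

    Tile : Bead → Domino
    Tile (i , l) = F (E i) (key (i , l))

    bead-mark : ∀ {i l} → (i , l) ∈ G → mark (i , l) ∈ Γ (suc (E i))
    bead-mark {i} {l} b∈ = subst (mark (i , l) ∈_) (sym (γ-base (suc h′) i)) (∈-base⁺ b∈)

    low-mark : ∀ {e p} → H ≤ suc e → p ∈ Γ (suc e) → ∃[ b ] b ∈ G × e ≡ E (proj₁ b) × p ≡ mark b
    low-mark {e} {p} H≤ p∈ =
      let l , b∈ , eq = ∈-base⁻ (subst (p ∈_) (trans (cong Γ (sym e≡)) (γ-base (suc h′) (suc e ∸ H))) p∈)
      in (suc e ∸ H , l) , b∈ , ℕ.suc-injective (sym e≡) , eq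
      where
      e≡ : H + (suc e ∸ H) ≡ suc e
      e≡ = ℕ.m+[n∸m]≡n H≤

    at-low : ∀ {e} z → H ≤ e → at e z ≡ (n e z + (e ∸ H) , n e z)
    at-low {e} z H≤e = cong (n e z + (e ∸ H) ,_) (trans (cong (n e z +_) (ℕ.m≤n⇒m∸n≡0 H≤e)) (ℕ.+-identityʳ _))

    H≤E : ∀ i → H ≤ suc (E i)
    H≤E i = ℕ.m≤m+n H i

    lo-low : ∀ {e} z → H ≤ suc e → lo (F e z) ≡ (n (suc e) z + (suc e ∸ H) , n (suc e) z)
    lo-low {e} z H≤ = trans (F-lo e z) (at-low z H≤)

    F-low : ∀ {e} z → H ≤ suc e → Low (F e z)
    F-low {e} z H≤ = lo⇒low (F e z) (subst (λ c → row c ≤ col c) (sym (lo-low z H≤)) (ℕ.m≤m+n _ _))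

    F-high : ∀ {e} z → suc e < H → ¬ Low (F e z)
    F-high {e} z <H low = ℕ.<⇒≱ (subst₂ (λ c c′ → col c < row c′) (sym (F-lo e z)) (sym (F-lo e z))
      (ℕ.+-monoʳ-< (n (suc e) z) (subst (_< H ∸ suc e) (sym (ℕ.m≤n⇒m∸n≡0 (ℕ.<⇒≤ <H))) (ℕ.m<n⇒0<n∸m <H))))
      (low⇒lo (F e z) low)

    F-type : ∀ i z → type (F (E i) z) ≡ i
    F-type i z = trans (type≡lo (F (E i) z)) (trans (cong (λ c → col c ∸ row c) (lo-low z (H≤E i)))
      (trans (ℕ.m+n∸m≡n (n (suc (E i)) z) _) (ℕ.m+n∸m≡n H i)))

    ∈-t⁻ : ∀ {d ent} → (d , ent) ∈ t → ∃[ e ] ∃[ z ] d ≡ F e z × (z , ent) ∈ Γ (suc e)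
    ∈-t⁻ d∈ =
      let (e , z , ent) , j∈ , eq = ∈-map⁻ place d∈
      in e , z , cong proj₁ eq , subst (λ x → (z , x) ∈ Γ (suc e)) (sym (cong proj₂ eq)) (∈-marks⁻ top j∈)

    Placed : Domino → Letter → Set
    Placed d l = ∃[ i ] (i , l) ∈ G × d ≡ Tile (i , l)

    labelled⁻ : ∀ {d l} → (d , l) ∈ labelled t → Placed d l
    labelled⁻ {d} {l} u∈ =
      let e , z , d≡ , p∈ = ∈-t⁻ (∈-labelled⁻ t u∈)
      in build d≡ (low-mark (ℕ.≮⇒≥ λ lt → just≢X (γ-blank (suc h′) lt p∈)) p∈)
      where
      just≢X : just l ≢ X
      just≢X ()
      build : ∀ {e z} → d ≡ F e z → ∃[ b ] b ∈ G × e ≡ E (proj₁ b) × (z , just l) ≡ mark b → Placed d l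
      build d≡ ((i , .l) , b∈ , refl , refl) = i , b∈ , d≡

    tile∈t : ∀ {i l} → (i , l) ∈ G → (Tile (i , l) , just l) ∈ t
    tile∈t {i} {l} b∈ = ∈-map⁺ place (∈-marks⁺ {B = top} {e = E i} (ℕ.<-trans (ℕ.n<1+n _) (ℕ.+-monoʳ-< H (bounded b∈))) (bead-mark b∈))

    labelled⁺ : ∀ {i l} → (i , l) ∈ G → (Tile (i , l) , l) ∈ labelled t
    labelled⁺ b∈ = ∈-labelled⁺ (tile∈t b∈)

    record Covered (d : Domino) (l : Letter) (c : Cell) : Set where
      field
        i a  : ℕ
        b∈   : (i , l) ∈ G
        tile : d ≡ Tile (i , l)
        spot : c ≡ at a (key (i , l))
        a≤   : a ≤ suc (E i)
        ≤a   : E i ≤ a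

      on : On a (mark (i , l))
      on = on-from a≤ ≤a (bead-mark b∈)

    covered : ∀ {d l c} → (d , l) ∈ labelled t → c ∈ dominoCells d → Covered d l c
    covered u∈ c∈ =
      let i , b∈ , d≡ = labelled⁻ u∈
          a , (a≤ , ≤a) , c≡ = ∈-F⁻ (subst (λ d → _ ∈ dominoCells d) d≡ c∈)
      in record { i = i ; a = a ; b∈ = b∈ ; tile = d≡ ; spot = c≡ ; a≤ = a≤ ; ≤a = ≤a }

    open Covered

    covered-row-order : ∀ {d l c d′ l′ c′} (u : Covered d l c) (v : Covered d′ l′ c′) →
                        row c ≡ row c′ → col c < col c′ → a u < a v × key (i u , l) ≤ key (i v , l′)
    covered-row-order {l = l} {l′ = l′} u v eq lt =
      row-order {a u} {a v} {key (i u , l)} {mark (i v , l′)} (on v)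
        (trans (cong row (sym (spot u))) (trans eq (cong row (spot v))))
        (subst₂ _<_ (cong col (spot u)) (cong col (spot v)) lt)

    covered-column-order : ∀ {d l c d′ l′ c′} (u : Covered d l c) (v : Covered d′ l′ c′) →
                           col c ≡ col c′ → row c < row c′ → a v < a u × key (i u , l) ≤ key (i v , l′)
    covered-column-order {l = l} {l′ = l′} u v eq lt =
      column-order {a u} {a v} {key (i u , l)} {mark (i v , l′)} (on v)
        (trans (cong col (sym (spot u))) (trans eq (cong col (spot v))))
        (subst₂ _<_ (cong row (spot u)) (cong row (spot v)) lt)

    covered-same : ∀ {d l c d′ l′ c′} (u : Covered d l c) (v : Covered d′ l′ c′) → c ≡ c′ → d ≡ d′
    covered-same {l = l} {l′ = l′} u v eq = trans (tile u) (trans (cong Tile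
      (key-inj (b∈ u) (b∈ v) (proj₂ (at-injective {a u} {a v} {mark (i u , l)} {mark (i v , l′)} (on u) (on v)
        (trans (sym (spot u)) (trans eq (spot v))))))) (sym (tile v)))

    same-index : ∀ {d l c d′ c′} (u : Covered d l c) (v : Covered d′ l c′) → i u ≡ i v → d ≡ d′
    same-index {l = l} u v eq = trans (tile u) (trans (cong (λ j → Tile (j , l)) eq) (sym (tile v)))

    order-indices : ∀ {d l c d′ l′ c′} (u : Covered d l c) (v : Covered d′ l′ c′) → a u < a v → i u ≤ i v
    order-indices u v lt = ℕ.+-cancelˡ-≤ (suc (dbl h′)) _ _
      (ℕ.≤-trans (≤a u) (ℕ.≤-pred (ℕ.≤-trans lt (a≤ v))))

    -- The upper domino has the larger or equal key, hence for unprimed letters at least the type of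
    -- the other; being higher in the column, it has at most that type. Type and letter then fix the
    -- domino.
    once-column : ∀ {d c d′ c′ k} → Covered d (unprimed k) c → Covered d′ (unprimed k) c′ → col c ≡ col c′ → d ≡ d′
    once-column {c = c} {c′ = c′} {k} u v eq with ℕ.<-cmp (row c) (row c′)
    ... | tri≈ _ e _  = covered-same u v (cong₂ _,_ eq e)
    ... | tri< lt _ _ = let a< , z≤ = covered-column-order u v eq lt in
      same-index u v (ℕ.≤-antisym (key-≤-unprimed {k = k} z≤) (order-indices v u a<))
    ... | tri> _ _ gt = let a< , z≤ = covered-column-order v u (sym eq) gt in
      same-index u v (ℕ.≤-antisym (order-indices u v a<) (key-≤-unprimed {k = k} z≤))

    once-row : ∀ {d c d′ c′ k} → Covered d (primed k) c → Covered d′ (primed k) c′ → row c ≡ row c′ → d ≡ d′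
    once-row {c = c} {c′ = c′} {k} u v eq with ℕ.<-cmp (col c) (col c′)
    ... | tri≈ _ e _  = covered-same u v (cong₂ _,_ e eq)
    ... | tri< lt _ _ = let a< , z≤ = covered-row-order u v eq lt in
      same-index u v (ℕ.≤-antisym (order-indices u v a<) (key-≤-primed {k = k} (bounded (b∈ v)) z≤))
    ... | tri> _ _ gt = let a< , z≤ = covered-row-order v u (sym eq) gt in
      same-index u v (ℕ.≤-antisym (key-≤-primed {k = k} (bounded (b∈ u)) z≤) (order-indices v u a<))

    t-up : ∀ {d ent} → (d , ent) ∈ t → InUp′ d → ent ≡ X
    t-up {d} {ent} d∈ up =
      let e , z , d≡ , p∈ = ∈-t⁻ d∈
      in γ-blank (suc h′) (ℕ.≰⇒> λ H≤ → low⇒¬inUp′ (F e z) (F-low z H≤) (subst InUp′ d≡ up)) p∈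

    t-down : ∀ {d ent} → (d , ent) ∈ t → ¬ InUp′ d → Is-just ent
    t-down {d} {ent} d∈ ¬up =
      let e , z , d≡ , p∈ = ∈-t⁻ d∈
          b , _ , _ , eq = low-mark (ℕ.≮⇒≥ λ <H → ¬up (subst InUp′ (sym d≡) (high⇒inUp′ (F e z) (F-high z <H)))) p∈
      in subst Is-just (sym (cong proj₂ eq)) (just _)

    t-tableau : IsTableau dominoCells InUp′ t
    t-tableau = record
      { up           = t-up
      ; down         = t-down
      ; rows         = λ {p} {q} {l} {l′} u∈ v∈ c∈ d∈ eq lt →
          key-≤⇒rank-≤ {l = l} {l′} (bounded (b∈ (covered v∈ d∈)))
            (proj₂ (covered-row-order (covered u∈ c∈) (covered v∈ d∈) eq lt))
      ; columns      = λ {p} {q} {l} {l′} u∈ v∈ c∈ d∈ eq lt →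
          key-≤⇒rank-≤ {l = l} {l′} (bounded (b∈ (covered v∈ d∈)))
            (proj₂ (covered-column-order (covered u∈ c∈) (covered v∈ d∈) eq lt))
      ; unprimedOnce = λ u∈ v∈ c∈ d∈ → once-column (covered u∈ c∈) (covered v∈ d∈)
      ; primedOnce   = λ u∈ v∈ c∈ d∈ → once-row (covered u∈ c∈) (covered v∈ d∈)
      }

    ∈-t⁺ : ∀ {e p} → p ∈ Γ (suc e) → (F e (proj₁ p) , proj₂ p) ∈ t
    ∈-t⁺ {e} {p} p∈ = ∈-map⁺ place (∈-marks⁺ {B = top} {e = e}
      (ℕ.≰⇒> λ top≤e → case subst (p ∈_) (beyond top≤e) p∈ of λ ()) p∈)

    e₀ : ℕ
    e₀ = suc (dbl h′)

    rankOf-Γ : ∀ {e} i z → H + i ≡ e → rankOf (Γ e) z ≡ N G i z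
    rankOf-Γ i z refl = trans (cong (λ xs → rankOf xs z) (γ-base (suc h′) i)) (rankOf-base i z)

    -- The list at `e₀` has type -1: the beads of type 1 without the first. Compared with `ρ-H`, the
    -- truncated subtraction makes the rows differ exactly when no bead of type 1 is below `z`, that
    -- is, when the domino of type 0 is vertical.
    ρ-e₀ : ∀ z → ρ e₀ z ≡ suc (N G 1 z ∸ 1 + N G 0 z)
    ρ-e₀ z = begin
      n e₀ z + (H ∸ e₀)                ≡⟨ cong (n e₀ z +_) (ℕ.m+n∸n≡m 1 e₀) ⟩
      n e₀ z + 1                       ≡⟨ ℕ.+-comm (n e₀ z) 1 ⟩
      suc (rankOf (Γ e₀) z + rankOf (Γ H) z)
        ≡⟨ cong suc (cong₂ _+_ (trans (cong (λ xs → rankOf xs z) (γ-first h′))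
             (trans (rankOf-blank (base-increasing 1) z) (cong (_∸ 1) (rankOf-base 1 z))))
             (rankOf-Γ 0 z (ℕ.+-identityʳ H))) ⟩
      suc (N G 1 z ∸ 1 + N G 0 z) ∎
      where open ≡-Reasoning

    ρ-H : ∀ z → ρ H z ≡ N G 0 z + N G 1 z
    ρ-H z = begin
      n H z + (H ∸ H)   ≡⟨ cong (n H z +_) (ℕ.n∸n≡0 H) ⟩
      n H z + 0         ≡⟨ ℕ.+-identityʳ _ ⟩
      n H z             ≡⟨ cong₂ _+_ (rankOf-Γ 0 z (ℕ.+-identityʳ H)) (rankOf-Γ 1 z (ℕ.+-comm H 1)) ⟩
      N G 0 z + N G 1 z ∎
      where open ≡-Reasoning

    vertical₀⇒none : ∀ z → ¬ (ρ e₀ z ≤ ρ H z) → N G 1 z ≡ 0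
    vertical₀⇒none z ≰ with N G 1 z | ρ-e₀ z | ρ-H z
    ... | zero  | _  | _  = refl
    ... | suc k | e₁ | e₂ = ⊥-elim (≰ (ℕ.≤-reflexive (trans e₁ (trans (ℕ.+-comm (suc k) (N G 0 z)) (sym e₂)))))

    none⇒vertical₀ : ∀ z → N G 1 z ≡ 0 → ¬ (ρ e₀ z ≤ ρ H z)
    none⇒vertical₀ z none le = ℕ.<-irrefl refl (subst₂ _≤_
      (trans (ρ-e₀ z) (cong (λ k → suc (k ∸ 1 + N G 0 z)) none))
      (trans (ρ-H z) (trans (cong (N G 0 z +_) none) (ℕ.+-identityʳ _))) le)

    diagonal-zero : ∀ {x y} → diagonal (x , y) ≡ ℤ.0ℤ → y ≡ x
    diagonal-zero {x} {y} eq with ℕ.<-cmp x y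
    ... | tri< lt _ _ = ⊥-elim (ℤ.<-irrefl (sym eq) (inUp⁺ lt))
    ... | tri≈ _ e _  = sym e
    ... | tri> _ _ gt = ⊥-elim (ℤ.<-irrefl eq (subst (diagonal (x , y) ℤ.<_) (ℤ.n⊖n≡0 x) (ℤ.⊖-monoˡ-< x gt)))

    -- A vertical domino starting at (p + 1, p + 1) has its left neighbour at (p, p), again vertical
    -- and of type 0: fewer beads are smaller than the preceding bead of type 0, so still none of
    -- type 1. That neighbour is not in `InUp′`.
    t-admissible : Admissible (map proj₁ t)
    t-admissible (x , y) blocked = cases onD₀
      where
      open Blocked blocked

      cases : On₂ ℤ.0ℤ (vertical (x , y)) → ⊥
      -- With the upper cell on the main diagonal, the cell left of the lower one is (y, y), whose
      -- domino is never in `InUp′`.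
      cases (there (here eq)) = below-diagonal (diagonal-zero eq)
        where
        below-diagonal : suc y ≡ x → ⊥
        below-diagonal refl =
          let c∈ = leftClosed (∈-concatMap-cells present (here refl))
              e , q , q∈ , d∈ = onto c∈
          in low⇒¬inUp′ (F e (proj₁ q)) (low-cell⇒low (F e (proj₁ q)) d∈ ℕ.≤-refl)
               (allUp (∈-map⁺ proj₁ (∈-t⁺ {e} {q} q∈)) (y , y , d∈ , here refl))
          where
          ∈-concatMap-cells : ∀ {d c} → d ∈ map proj₁ t → c ∈ dominoCells d → c ∈ cells sh
          ∈-concatMap-cells d∈ c∈ = ∈-resp-↭ t-paving (∈-concatMap-intro dominoCells d∈ c∈)
      cases (here eq) = on-diagonal (diagonal-zero eq) hasLeft
        where
        on-diagonal : y ≡ x → ∃[ e ] e ∈ map proj₁ t × LeftAdjacent e (vertical (x , y)) → ⊥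
        on-diagonal refl (_ , _ , p , _ , _ , f∈) = predecessor (column f∈)
          where
          column : ∀ {r} → (suc p , r) ∈ dominoCells (vertical (x , x)) → x ≡ suc p
          column (here refl)         = refl
          column (there (here refl)) = refl

          predecessor : x ≡ suc p → ⊥
          predecessor refl =
            let (d , ent) , d∈ , v≡ = ∈-map⁻ proj₁ present
                e , z , d≡ , p∈ = ∈-t⁻ d∈
            in low-neighbour e z ent (trans v≡ d≡) p∈
            where
            low-neighbour : ∀ e z ent → vertical (suc p , suc p) ≡ F e z → (z , ent) ∈ Γ (suc e) → ⊥
            -- Below `z` there are p + 1 beads of type 0 and none of type 1; the last of these beads
            -- has position p and sits at (p, p).
            low-neighbour e z ent v≡ p∈ = finish (at-position 0 p<m)
              where
              spot≡ : (suc p , suc p) ≡ at (suc e) z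
              spot≡ = trans (cong lo v≡) (F-lo e z)
              e≡ : e ≡ e₀
              e≡ = ℕ.suc-injective (ℕ.+-cancelˡ-≡ (suc p) _ _ (sym (trans (cong (λ c → col c + H) spot≡)
                (trans (col-row (suc e) z) (cong (λ c → row c + suc e) (sym spot≡))))))
              none : N G 1 z ≡ 0
              none = vertical₀⇒none z (subst (λ e → ¬ (ρ e z ≤ ρ (suc e) z)) e≡ (vertical⁻ (sym v≡)))
              N₀≡ : N G 0 z ≡ suc p
              N₀≡ = sym (trans (cong row spot≡) (trans (cong (λ e → ρ (suc e) z) e≡) (trans (ρ-H z)
                (trans (cong (N G 0 z +_) none) (ℕ.+-identityʳ _)))))
              p<m : p < m 0
              p<m = let Z , h = upperBound key G in ℕ.≤-trans (ℕ.≤-reflexive (sym N₀≡))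
                (subst (N G 0 z ≤_) (total 0 (λ b∈ → ℕ.<-≤-trans (h b∈) (ℕ.m≤n⊔m z Z)))
                  (N-mono G 0 (ℕ.m≤m⊔n z Z)))
              finish : ∃[ l ] (0 , l) ∈ G × N G 0 (key (0 , l)) ≡ p → ⊥
              finish (l , b∈ , N≡p) = low⇒¬inUp′ (vertical (p , p)) ℕ.≤-refl
                (subst InUp′ tile≡ (allUp (∈-map⁺ proj₁ (tile∈t b∈))
                  (p , suc p , subst (λ d → (p , suc p) ∈ dominoCells d) (sym tile≡) (there (here refl)) , here refl)))
                where
                z′ = key (0 , l)
                z′≤z : z′ ≤ z
                z′≤z = ℕ.<⇒≤ (ℕ.≰⇒> λ z≤ → ℕ.<-irrefl refl (subst₂ _≤_ N₀≡ N≡p (N-mono G 0 z≤)))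
                none′ : N G 1 z′ ≡ 0
                none′ = ℕ.n≤0⇒n≡0 (subst (N G 1 z′ ≤_) none (N-mono G 1 z′≤z))
                n≡p : n H z′ ≡ p
                n≡p = trans (sym (trans (cong (n H z′ +_) (ℕ.n∸n≡0 H)) (ℕ.+-identityʳ _)))
                  (trans (ρ-H z′) (trans (cong₂ _+_ N≡p none′) (ℕ.+-identityʳ p)))
                E₀≡ : E 0 ≡ e₀
                E₀≡ = cong suc (ℕ.+-identityʳ (dbl h′))
                tile≡ : Tile (0 , l) ≡ vertical (p , p)
                tile≡ = trans (cong (λ e → F e z′) E₀≡) (trans (F-vertical {e₀} {z′} (none⇒vertical₀ z′ none′))
                  (cong vertical (trans (at-low {H} z′ ℕ.≤-refl)
                    (cong₂ _,_ (trans (cong₂ _+_ n≡p (ℕ.n∸n≡0 H)) (ℕ.+-identityʳ p)) n≡p))))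

    T : ShiftedDominoTableau sh
    T = record { filling = t ; paving = t-paving ; admissible = t-admissible ; isTableau = t-tableau }

    beads⁺ : ∀ {b} → b ∈ G → b ∈ dominoBeads t
    beads⁺ {i , l} b∈ = subst (λ j → (j , l) ∈ dominoBeads t) (F-type i (key (i , l))) (∈-map⁺ dominoBead (labelled⁺ b∈))

    beads⁻ : ∀ {b} → b ∈ dominoBeads t → b ∈ G
    beads⁻ b∈ =
      let (d , l) , u∈ , eq = ∈-map⁻ dominoBead b∈
          i , c∈ , d≡ = labelled⁻ u∈
      in subst (_∈ G) (sym (trans eq (cong (_, l) (trans (cong type d≡) (F-type i (key (i , l))))))) c∈

-- Rows of a diagram

part : List ℕ → ℕ → ℕ
part []       _       = 0
part (r ∷ rs) zero    = r
part (r ∷ rs) (suc y) = part rs y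

cellsFrom⁺ : ∀ y₀ rs {x y} → x < part rs y → (x , y₀ + y) ∈ cellsFrom y₀ rs
cellsFrom⁺ y₀ (r ∷ rs) {x} {zero}  x< = ∈-++⁺ˡ
  (subst (λ v → (x , v) ∈ map (_, y₀) (upTo r)) (sym (ℕ.+-identityʳ y₀)) (∈-map⁺ (_, y₀) (∈-upTo⁺ x<)))
cellsFrom⁺ y₀ (r ∷ rs) {x} {suc y} x< = ∈-++⁺ʳ (map (_, y₀) (upTo r))
  (subst (λ v → (x , v) ∈ cellsFrom (suc y₀) rs) (sym (ℕ.+-suc y₀ y)) (cellsFrom⁺ (suc y₀) rs x<))

cellsFrom⁻ : ∀ y₀ rs {x y} → (x , y₀ + y) ∈ cellsFrom y₀ rs → x < part rs y
cellsFrom⁻ y₀ (r ∷ rs) {x} {y} c∈ = split y (∈-++⁻ (map (_, y₀) (upTo r)) c∈)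
  where
  split : ∀ y → (x , y₀ + y) ∈ map (_, y₀) (upTo r) ⊎ (x , y₀ + y) ∈ cellsFrom (suc y₀) rs → x < part (r ∷ rs) y
  split zero (inj₁ p) = let _ , x∈ , eq = ∈-map⁻ (_, y₀) p in
    subst (_< r) (sym (cong proj₁ eq)) (∈-upTo⁻ x∈)
  split (suc y) (inj₁ p) = let _ , _ , eq = ∈-map⁻ (_, y₀) p in
    ⊥-elim (ℕ.m+1+n≢m y₀ (cong proj₂ eq))
  split zero (inj₂ p) = ⊥-elim (ℕ.<-irrefl (sym (ℕ.+-identityʳ y₀)) (cellsFrom-row (suc y₀) rs p))
  split (suc y) (inj₂ p) = cellsFrom⁻ (suc y₀) rs (subst (λ v → (x , v) ∈ cellsFrom (suc y₀) rs) (ℕ.+-suc y₀ y) p)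

cells⁺ : ∀ {q x y} → x < part q y → (x , y) ∈ cells q
cells⁺ {q} = cellsFrom⁺ 0 q

cells⁻ : ∀ {q x y} → (x , y) ∈ cells q → x < part q y
cells⁻ {q} = cellsFrom⁻ 0 q

NonIncreasing : List ℕ → Set
NonIncreasing q = ∀ y → part q (suc y) ≤ part q y

linked⇒nonIncreasing : ∀ {q} → Linked _≥_ q → NonIncreasing q
linked⇒nonIncreasing []       y       = z≤n
linked⇒nonIncreasing [-]      zero    = z≤n
linked⇒nonIncreasing [-]      (suc y) = z≤n
linked⇒nonIncreasing (p ∷ ps) zero    = p
linked⇒nonIncreasing (p ∷ ps) (suc y) = linked⇒nonIncreasing ps y

left-closed : ∀ {q x y} → (suc x , y) ∈ cells q → (x , y) ∈ cells q
left-closed {q} {x} {y} c∈ = cells⁺ {q} {x} {y} (ℕ.<⇒≤ (cells⁻ {q} {suc x} {y} c∈))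

down-closed : ∀ {q x y} → NonIncreasing q → (x , suc y) ∈ cells q → (x , y) ∈ cells q
down-closed {q} {x} {y} ni c∈ = cells⁺ {q} {x} {y} (ℕ.<-≤-trans (cells⁻ {q} {x} {suc y} c∈) (ni y))

positive-parts : List ℕ → List ℕ
positive-parts = filter (0 ℕ.<?_)

part-anti : ∀ {q} → NonIncreasing q → ∀ y → part q y ≤ part q 0
part-anti ni zero    = ℕ.≤-refl
part-anti {q} ni (suc y) = ℕ.≤-trans (ni y) (part-anti {q} ni y)

-- In a non-increasing list the zeros come last, so dropping them shifts no row.
part-positive-parts : ∀ q → NonIncreasing q → ∀ y → part (positive-parts q) y ≡ part q y
part-positive-parts []            ni y       = refl
part-positive-parts (suc r ∷ rs)  ni zero    = refl
part-positive-parts (suc r ∷ rs)  ni (suc y) = part-positive-parts rs (ni ∘ suc) y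
part-positive-parts q@(zero ∷ rs) ni y       = trans (part-positive-parts rs (ni ∘ suc) y)
  (trans (ℕ.n≤0⇒n≡0 (part-anti {q} ni (suc y))) (sym (ℕ.n≤0⇒n≡0 (part-anti {q} ni y))))

-- Beta-sets

Decreasing : List ℕ → Set
Decreasing = AllPairs _>_

-- The partition with beta-set `hs`, listed in decreasing order; zero parts are kept.
betaParts : List ℕ → List ℕ
betaParts []       = []
betaParts (h ∷ hs) = (h ∸ length hs) ∷ betaParts hs

betaParts-nonIncreasing : ∀ {hs} → Decreasing hs → NonIncreasing (betaParts hs)
betaParts-nonIncreasing []                                    y       = z≤n
betaParts-nonIncreasing {h ∷ []}      (_ ∷ _)                 zero    = z≤n
betaParts-nonIncreasing {h ∷ g ∷ hs}  ((g<h ∷ _) ∷ _)         zero    =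
  ℕ.∸-monoˡ-≤ (suc (length hs)) g<h
betaParts-nonIncreasing {h ∷ hs}      (_ ∷ d)                 (suc y) = betaParts-nonIncreasing d y

module _ (x : ℕ) where

  reaches? : ∀ m y → Decidable (λ h → x + m ≤ h + y)
  reaches? m y h = x + m ℕ.≤? h + y

  private
    shift : ∀ hs m y → count (reaches? (suc m) (suc y)) hs ≡ count (reaches? m y) hs
    shift hs m y = count-cong (reaches? (suc m) (suc y)) (reaches? m y) hs
      (λ {h} _ le → ℕ.≤-pred (subst₂ _≤_ (ℕ.+-suc x m) (ℕ.+-suc h y) le))
      (λ {h} _ le → subst₂ _≤_ (sym (ℕ.+-suc x m)) (sym (ℕ.+-suc h y)) (s≤s le))

    exceed : ∀ h m → x < h ∸ m → x + m < h
    exceed h m x< = ℕ.≰⇒> λ h≤ → ℕ.<⇒≱ x< (ℕ.m≤n+o⇒m∸n≤o h m (subst (h ≤_) (ℕ.+-comm x m) h≤))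

  -- Row y comes from the (y + 1)-st largest entry, and the cell is present when that entry
  -- satisfies `reaches?`; as the entries decrease, this happens when at least y + 1 of them do. As
  -- a count, membership can be split by parity.
  betaParts⁺ : ∀ {hs} → Decreasing hs → ∀ {y} → x < part (betaParts hs) y →
               y < count (reaches? (length hs) y) hs
  betaParts⁺ {h ∷ hs} _ {zero} x< rewrite count-∷ (reaches? (suc (length hs)) 0) h hs
    | χ-yes {p = reaches? (suc (length hs)) 0 h} (subst₂ _≤_ (sym (ℕ.+-suc x (length hs))) (sym (ℕ.+-identityʳ h))
        (exceed h (length hs) x<)) = s≤s z≤n
  betaParts⁺ {h ∷ hs} (h> ∷ d) {suc y} x< rewrite count-∷ (reaches? (suc (length hs)) (suc y)) h hs
    | shift hs (length hs) y = ℕ.≤-trans (s≤s IH)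
        (ℕ.+-monoˡ-≤ _ (ℕ.≤-reflexive (sym (χ-yes {p = reaches? (suc (length hs)) (suc y) h} head-reaches))))
    where
    IH : y < count (reaches? (length hs) y) hs
    IH = betaParts⁺ d x<
    head-reaches : x + suc (length hs) ≤ h + suc y
    head-reaches = let g , g∈ , le = count-positive (reaches? (length hs) y) hs (ℕ.≤-trans (s≤s z≤n) IH)
      in subst₂ _≤_ (sym (ℕ.+-suc x (length hs))) (sym (ℕ.+-suc h y))
           (s≤s (ℕ.≤-trans le (ℕ.+-monoˡ-≤ y (ℕ.<⇒≤ (All.lookup h> g∈)))))

  betaParts⁻ : ∀ {hs} → Decreasing hs → ∀ {y} → y < count (reaches? (length hs) y) hs →
               x < part (betaParts hs) y
  betaParts⁻ {h ∷ hs} (h> ∷ d) {zero} y< with reaches? (suc (length hs)) 0 h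
  ... | yes le = ℕ.m+n≤o⇒m≤o∸n (suc x) (subst₂ _≤_ (ℕ.+-suc x (length hs)) (ℕ.+-identityʳ h) le)
  ... | no ≰ = ⊥-elim (ℕ.<-irrefl (sym (count-none (reaches? (suc (length hs)) 0) (h ∷ hs)
    λ { (here refl) → ≰ ; (there g∈) le → ≰ (ℕ.≤-trans le (ℕ.+-monoˡ-≤ 0 (ℕ.<⇒≤ (All.lookup h> g∈)))) })) y<)
  betaParts⁻ {h ∷ hs} (_ ∷ d) {suc y} y< = betaParts⁻ d (ℕ.≤-pred (begin
    suc (suc y)                                                      ≤⟨ y< ⟩
    count (reaches? (suc (length hs)) (suc y)) (h ∷ hs)              ≡⟨ count-∷ (reaches? (suc (length hs)) (suc y)) h hs ⟩
    χ (reaches? (suc (length hs)) (suc y) h) + count (reaches? (suc (length hs)) (suc y)) hs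
      ≤⟨ ℕ.+-mono-≤ (χ≤1 (reaches? (suc (length hs)) (suc y) h)) (ℕ.≤-reflexive (shift hs (length hs) y)) ⟩
    suc (count (reaches? (length hs) y) hs) ∎))
    where
    open ℕ.≤-Reasoning
    χ≤1 : ∀ {P : Set} (p : Dec P) → χ p ≤ 1
    χ≤1 (yes _) = ℕ.≤-refl
    χ≤1 (no  _) = z≤n

decreasing-head : ∀ {h hs} → Decreasing (h ∷ hs) → length hs ≤ h
decreasing-head {hs = []}     _                   = z≤n
decreasing-head {hs = g ∷ hs} ((g<h ∷ _) ∷ d) = ℕ.≤-trans (s≤s (decreasing-head d)) g<h

-- The k-th largest of n distinct natural numbers is at least n - k.
low-reach : ∀ {hs} → Decreasing hs → ∀ {y} → y < length hs → y < count (λ h → length hs ℕ.≤? h + suc y) hs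
low-reach {h ∷ hs} (h> ∷ d) {y} y< rewrite count-∷ (λ h → suc (length hs) ℕ.≤? h + suc y) h hs
  | χ-yes {p = suc (length hs) ℕ.≤? h + suc y} (ℕ.≤-trans (s≤s (ℕ.≤-trans (decreasing-head (h> ∷ d)) (ℕ.m≤m+n h y)))
      (ℕ.≤-reflexive (sym (ℕ.+-suc h y)))) = s≤s (rest y y<)
  where
  rest : ∀ y → y < suc (length hs) → y ≤ count (λ h → suc (length hs) ℕ.≤? h + suc y) hs
  rest zero    _        = z≤n
  rest (suc y) (s≤s y<) = ℕ.≤-trans (low-reach d y<) (ℕ.≤-reflexive (count-cong _ _ hs
    (λ {h} _ le → ℕ.≤-trans (s≤s le) (ℕ.≤-reflexive (sym (ℕ.+-suc h (suc y)))))
    (λ {h} _ le → ℕ.≤-pred (ℕ.≤-trans le (ℕ.≤-reflexive (ℕ.+-suc h (suc y)))))))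

L-length : ∀ sh → length (L-sequence sh) ≡ length sh
L-length []       = refl
L-length (r ∷ rs) = cong suc (L-length rs)

betaParts-L : ∀ sh → betaParts (L-sequence sh) ≡ sh
betaParts-L []       = refl
betaParts-L (r ∷ rs) = cong₂ _∷_ (trans (cong (r + length rs ∸_) (L-length rs)) (ℕ.m+n∸n≡m r (length rs))) (betaParts-L rs)

L-decreasing : ∀ {sh} → Linked _≥_ sh → Decreasing (L-sequence sh)
L-decreasing l = Linked⇒AllPairs (λ p q → ℕ.<-trans q p) (linked l)
  where
  linked : ∀ {sh} → Linked _≥_ sh → Linked _>_ (L-sequence sh)
  linked []       = []
  linked [-]      = [-]
  linked {r ∷ s ∷ rs} (s≤r ∷ l) = ℕ.≤-trans (s≤s (ℕ.+-monoˡ-≤ (length rs) s≤r)) (ℕ.≤-reflexive (sym (ℕ.+-suc r _))) ∷ linked l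

-- Parities

bit : ℕ → ℕ
bit 0             = 0
bit 1             = 1
bit (suc (suc n)) = bit n

bit-cases : ∀ n → bit n ≡ 0 ⊎ bit n ≡ 1
bit-cases 0             = inj₁ refl
bit-cases 1             = inj₂ refl
bit-cases (suc (suc n)) = bit-cases n

bit-suc : ∀ n → bit (suc n) + bit n ≡ 1
bit-suc 0             = refl
bit-suc 1             = refl
bit-suc (suc (suc n)) = bit-suc n

bit-half : ∀ n → n ≡ bit n + 2 * ⌊ n /2⌋
bit-half 0             = refl
bit-half 1             = refl
bit-half (suc (suc n)) = trans (cong (suc ∘ suc) (bit-half n)) (lemma (bit n) ⌊ n /2⌋)
  where
  lemma : ∀ b h → 2 + (b + 2 * h) ≡ b + 2 * suc h
  lemma = solve-∀

bit-+ : ∀ {r} n → bit r ≡ 0 → bit (r + n) ≡ bit n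
bit-+ {0}           n _  = refl
bit-+ {suc (suc r)} n eq = bit-+ {r} n eq

bit-+1 : ∀ {r} n → bit r ≡ 1 → bit (r + n) ≡ bit (suc n)
bit-+1 {1}           n _  = refl
bit-+1 {suc (suc r)} n eq = bit-+1 {r} n eq

bit≢ : ∀ n → bit (suc n) ≢ bit n
bit≢ n eq with bit n | bit (suc n) | bit-cases n | bit-suc n
bit≢ n refl | _ | _ | inj₁ refl | ()
bit≢ n refl | _ | _ | inj₂ refl | ()

even⇒bit : ∀ {n} → 2 ∣ n → bit n ≡ 0
even⇒bit (divides q refl) = twice-bit q
  where
  twice-bit : ∀ q → bit (q * 2) ≡ 0
  twice-bit zero    = refl
  twice-bit (suc q) = twice-bit q

bit⇒even : ∀ {n} → bit n ≡ 0 → 2 ∣ n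
bit⇒even {n} eq = divides ⌊ n /2⌋ (trans (bit-half n) (trans (cong (_+ 2 * ⌊ n /2⌋) eq) (ℕ.*-comm 2 ⌊ n /2⌋)))

odd⇒bit : ∀ {n} → ¬ (2 ∣ n) → bit n ≡ 1
odd⇒bit {n} odd with bit-cases n
... | inj₁ eq = ⊥-elim (odd (bit⇒even eq))
... | inj₂ eq = eq

bit⇒odd : ∀ {n} → bit n ≡ 1 → ¬ (2 ∣ n)
bit⇒odd {n} eq ev with () ← trans (sym eq) (even⇒bit ev)

-- Quotients

quotientParts : {P : ℕ → Set} → Decidable P → List ℕ → List ℕ
quotientParts P? ls = map (λ (l , m) → (l ∸ m) / 2) (filter (P? ∘ proj₁) (zip ls (M-sequence ls)))

M-head : ℕ → List ℕ → ℕ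
M-head l ls = if does (Even? l) then 2 * length (filter Even? ls) else 1 + 2 * length (filter Odd? ls)

ofBit : ℕ → List ℕ → List ℕ
ofBit p = filter (λ l → bit l ℕ.≟ p)

-- The M-entry has the parity of `l`, and half of it counts the later entries of that parity. So the
-- quotient part is what `betaParts` makes of ⌊ l /2⌋ among the halved entries of the same parity.
quotientParts≡ : ∀ p {P : ℕ → Set} (P? : Decidable P) →
  (∀ {l} → P l → bit l ≡ p) → (∀ {l} → bit l ≡ p → P l) →
  (∀ {l} ls → P l → M-head l ls ≡ p + 2 * count P? ls) →
  ∀ ls → quotientParts P? ls ≡ betaParts (map ⌊_/2⌋ (ofBit p ls))
quotientParts≡ p {P} P? to from hd []       = refl
quotientParts≡ p {P} P? to from hd (l ∷ ls) = go (P? l)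
  where
  g : ℕ × ℕ → ℕ
  g (l , m) = (l ∸ m) / 2

  pair : ℕ × ℕ
  pair = l , M-head l ls

  head≡ : P l → g pair ≡ ⌊ l /2⌋ ∸ length (map ⌊_/2⌋ (ofBit p ls))
  head≡ pl = begin
    (l ∸ M-head l ls) / 2                             ≡⟨ cong₂ (λ a b → (a ∸ b) / 2) (trans (bit-half l) (cong (_+ 2 * ⌊ l /2⌋) (to pl))) (hd ls pl) ⟩
    ((p + 2 * ⌊ l /2⌋) ∸ (p + 2 * count P? ls)) / 2   ≡⟨ cong (_/ 2) (ℕ.[m+n]∸[m+o]≡n∸o p _ _) ⟩
    (2 * ⌊ l /2⌋ ∸ 2 * count P? ls) / 2               ≡⟨ cong (_/ 2) (ℕ.*-distribˡ-∸ 2 ⌊ l /2⌋ (count P? ls)) ⟨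
    2 * (⌊ l /2⌋ ∸ count P? ls) / 2                   ≡⟨ cong (_/ 2) (ℕ.*-comm 2 (⌊ l /2⌋ ∸ count P? ls)) ⟩
    (⌊ l /2⌋ ∸ count P? ls) * 2 / 2                   ≡⟨ m*n/n≡m (⌊ l /2⌋ ∸ count P? ls) 2 ⟩
    ⌊ l /2⌋ ∸ count P? ls                             ≡⟨ cong (⌊ l /2⌋ ∸_) (trans
                                                          (count-cong P? (λ l → bit l ℕ.≟ p) ls (λ _ → to) (λ _ → from))
                                                          (sym (length-map ⌊_/2⌋ (ofBit p ls)))) ⟩
    ⌊ l /2⌋ ∸ length (map ⌊_/2⌋ (ofBit p ls))         ∎
    where open ≡-Reasoning

  go : Dec (P l) → quotientParts P? (l ∷ ls) ≡ betaParts (map ⌊_/2⌋ (ofBit p (l ∷ ls)))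
  go (yes pl) = begin
    map g (filter (P? ∘ proj₁) (pair ∷ zip ls (M-sequence ls)))
      ≡⟨ cong (map g) (filter-accept (P? ∘ proj₁) {x = pair} pl) ⟩
    g pair ∷ quotientParts P? ls
      ≡⟨ cong₂ _∷_ (head≡ pl) (quotientParts≡ p P? to from hd ls) ⟩
    betaParts (map ⌊_/2⌋ (l ∷ ofBit p ls))
      ≡⟨ cong (betaParts ∘ map ⌊_/2⌋) (filter-accept (λ l → bit l ℕ.≟ p) {x = l} {xs = ls} (to pl)) ⟨
    betaParts (map ⌊_/2⌋ (ofBit p (l ∷ ls))) ∎
    where open ≡-Reasoning
  go (no ¬pl) = begin
    map g (filter (P? ∘ proj₁) (pair ∷ zip ls (M-sequence ls)))
      ≡⟨ cong (map g) (filter-reject (P? ∘ proj₁) {x = pair} ¬pl) ⟩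
    quotientParts P? ls
      ≡⟨ quotientParts≡ p P? to from hd ls ⟩
    betaParts (map ⌊_/2⌋ (ofBit p ls))
      ≡⟨ cong (betaParts ∘ map ⌊_/2⌋) (filter-reject (λ l → bit l ℕ.≟ p) {x = l} {xs = ls} (¬pl ∘ from)) ⟨
    betaParts (map ⌊_/2⌋ (ofBit p (l ∷ ls))) ∎
    where open ≡-Reasoning

quotient : ℕ → List ℕ → List ℕ
quotient p sh = positive-parts (betaParts (map ⌊_/2⌋ (ofBit p (L-sequence sh))))

twoQuotient≡ : ∀ sh → twoQuotient sh ≡ (quotient 0 sh , quotient 1 sh)
twoQuotient≡ sh = cong₂ _,_
  (cong positive-parts (quotientParts≡ 0 Even? even⇒bit bit⇒even
    (λ {l} ls ev → cong (if_then 2 * length (filter Even? ls) else 1 + 2 * length (filter Odd? ls)) (dec-true (Even? l) ev)) L))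
  (cong positive-parts (quotientParts≡ 1 Odd? odd⇒bit bit⇒odd
    (λ {l} ls od → cong (if_then 2 * length (filter Even? ls) else 1 + 2 * length (filter Odd? ls)) (dec-false (Even? l) od)) L))
  where L = L-sequence sh

halves-decreasing : ∀ p {ls} → Decreasing ls → Decreasing (map ⌊_/2⌋ (ofBit p ls))
halves-decreasing p {ls} d = AllPairsₚ.map⁺ (go (AllPairsₚ.filter⁺ _ d) (All.tabulate λ l∈ → proj₂ (∈-filter⁻ _ {xs = ls} l∈)))
  where
  go : ∀ {ls} → Decreasing ls → All (λ l → bit l ≡ p) ls → AllPairs (λ l k → ⌊ l /2⌋ > ⌊ k /2⌋) ls
  go []       _          = []
  go (d ∷ ds) (b ∷ bs) = All.tabulate (λ {k} k∈ → half< (All.lookup d k∈) (trans b (sym (All.lookup bs k∈)))) ∷ go ds bs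
    where
    half< : ∀ {l k} → k < l → bit l ≡ bit k → ⌊ k /2⌋ < ⌊ l /2⌋
    half< {l} {k} k<l eq = ℕ.*-cancelˡ-< 2 _ _ (ℕ.+-cancelˡ-< (bit l) _ _
      (subst₂ _<_ (trans (bit-half k) (cong (_+ 2 * ⌊ k /2⌋) (sym eq))) (bit-half l) k<l))

-- Colour balance

colour : ℕ → List Cell → ℕ
colour p = count (λ c → bit (col c + row c) ℕ.≟ p)

χ-bits : ∀ n → χ (bit n ℕ.≟ 0) + χ (bit (suc n) ℕ.≟ 0) ≡ χ (bit n ℕ.≟ 1) + χ (bit (suc n) ℕ.≟ 1)
χ-bits 0             = refl
χ-bits 1             = refl
χ-bits (suc (suc n)) = χ-bits n

colour-two : ∀ p c d → colour p (c ∷ d ∷ []) ≡ χ (bit (col c + row c) ℕ.≟ p) + χ (bit (col d + row d) ℕ.≟ p)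
colour-two p c d = trans (count-∷ P? c (d ∷ [])) (cong (χ (P? c) +_) (trans (count-∷ P? d []) (ℕ.+-identityʳ _)))
  where
  P? : Decidable (λ (c : Cell) → bit (col c + row c) ≡ p)
  P? c = bit (col c + row c) ℕ.≟ p

domino-balanced : ∀ d → colour 0 (dominoCells d) ≡ colour 1 (dominoCells d)
domino-balanced (horizontal (x , y)) = trans (colour-two 0 (x , y) (suc x , y))
  (trans (χ-bits (x + y)) (sym (colour-two 1 (x , y) (suc x , y))))
domino-balanced (vertical (x , y)) = trans (colour-two 0 (x , y) (x , suc y)) (trans
  (subst (λ n → χ (bit (x + y) ℕ.≟ 0) + χ (bit n ℕ.≟ 0) ≡ χ (bit (x + y) ℕ.≟ 1) + χ (bit n ℕ.≟ 1))
    (sym (ℕ.+-suc x y)) (χ-bits (x + y)))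
  (sym (colour-two 1 (x , y) (x , suc y))))

-- Every removed domino takes one cell of each colour.
pavable-balanced : ∀ {sh} → Star _⟶_ sh [] → colour 0 (cells sh) ≡ colour 1 (cells sh)
pavable-balanced ε = refl
pavable-balanced {sh} (_◅_ {j = sh′} (d , _ , _ , sh↭) rest) = trans (split 0)
  (trans (cong₂ _+_ (domino-balanced d) (pavable-balanced rest)) (sym (split 1)))
  where
  split : ∀ p → colour p (cells sh) ≡ colour p (dominoCells d) + colour p (cells sh′)
  split p = trans (count-↭ (λ c → bit (col c + row c) ℕ.≟ p) sh↭)
    (count-++ (λ c → bit (col c + row c) ℕ.≟ p) (dominoCells d) (cells sh′))

χ-same : ∀ {r} n → bit r ≡ 0 → χ (bit (r + n) ℕ.≟ bit n) ≡ 1 × χ (bit (r + n) ℕ.≟ bit (suc n)) ≡ 0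
χ-same {r} n eq = χ-yes (bit-+ {r} n eq) , χ-no λ e → bit≢ n (trans (sym e) (bit-+ {r} n eq))

χ-flip : ∀ {r} n → bit r ≡ 1 → χ (bit (r + n) ℕ.≟ bit n) ≡ 0 × χ (bit (r + n) ℕ.≟ bit (suc n)) ≡ 1
χ-flip {r} n eq = χ-no (λ e → bit≢ n (trans (sym (bit-+1 {r} n eq)) e)) , χ-yes (bit-+1 {r} n eq)

rowCells : ℕ → ℕ → List Cell
rowCells y r = map (_, y) (upTo r)

row-colour-suc : ∀ y r p → colour p (rowCells y (suc r)) ≡ colour p (rowCells y r) + χ (bit (r + y) ℕ.≟ p)
row-colour-suc y r p = begin
  count P? (map (_, y) (upTo (suc r)))        ≡⟨ cong (count P? ∘ map (_, y)) (upTo-∷ʳ r) ⟨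
  count P? (map (_, y) (upTo r ++ r ∷ []))    ≡⟨ cong (count P?) (map-++ (_, y) (upTo r) (r ∷ [])) ⟩
  count P? (rowCells y r ++ (r , y) ∷ [])     ≡⟨ count-++ P? (rowCells y r) ((r , y) ∷ []) ⟩
  count P? (rowCells y r) + count P? ((r , y) ∷ []) ≡⟨ cong (count P? (rowCells y r) +_)
                                                      (trans (count-∷ P? (r , y) []) (ℕ.+-identityʳ _)) ⟩
  colour p (rowCells y r) + χ (bit (r + y) ℕ.≟ p) ∎
  where
  open ≡-Reasoning
  P? : Decidable (λ (c : Cell) → bit (col c + row c) ≡ p)
  P? c = bit (col c + row c) ℕ.≟ p

-- Colours alternate along a row, starting with that of y, so only an odd row has a cell left over.
row-balance : ∀ y r → colour (bit y) (rowCells y r) ≡ colour (bit (suc y)) (rowCells y r) + bit r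
row-balance y zero = refl
row-balance y (suc r) rewrite row-colour-suc y r (bit y) | row-colour-suc y r (bit (suc y)) | row-balance y r
  with bit-cases r
... | inj₁ eq rewrite proj₁ (χ-same {r} y eq) | proj₂ (χ-same {r} y eq) | eq
    | trans (sym (ℕ.+-identityʳ _)) (subst (λ b → bit (suc r) + b ≡ 1) eq (bit-suc r)) = refl
... | inj₂ eq rewrite proj₁ (χ-flip {r} y eq) | proj₂ (χ-flip {r} y eq) | eq
    | ℕ.+-cancelʳ-≡ 1 (bit (suc r)) 0 (subst (λ b → bit (suc r) + b ≡ 1) eq (bit-suc r)) = refl

ofParity : ℕ → List ℕ → ℕ
ofParity n = count (λ l → bit l ℕ.≟ bit n)

-- Rows are added from below, which exchanges both the parities and the colours; the parity of the
-- new row decides its L-entry and its surplus cell together. For equally many cells of both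
-- colours, the even and odd entries of L are equal in number, or differ by one when the length is
-- odd.
beta-balance : ∀ y rs → let n = length rs; L = L-sequence rs; C = cellsFrom y rs in
  ofParity n L + bit n + 2 * colour (bit (suc y)) C ≡ ofParity (suc n) L + 2 * colour (bit y) C
beta-balance y []       = refl
beta-balance y (r ∷ rs) = ℕ.+-cancelʳ-≡ (bit n) _ _ (begin
  P′ + bit (suc n) + 2 * B′ + bit n
    ≡⟨ cong₂ (λ p b → p + bit (suc n) + 2 * b + bit n) P′≡ B′≡ ⟩
  (c₁ + N) + bit (suc n) + 2 * (b + W) + bit n
    ≡⟨ lemma₁ c₁ N (bit (suc n)) b W (bit n) ⟩
  c₁ + (bit (suc n) + bit n) + 2 * b + (N + 2 * W)
    ≡⟨ cong₂ (λ u v → c₁ + u + 2 * b + v) (trans (bit-suc n) (sym c-sum)) (sym (beta-balance (suc y) rs)) ⟩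
  c₁ + (c₀ + bit r) + 2 * b + (P + bit n + 2 * B)
    ≡⟨ cong (λ u → u + (c₀ + bit r) + 2 * b + (P + bit n + 2 * B)) c₁≡ ⟩
  bit r + (c₀ + bit r) + 2 * b + (P + bit n + 2 * B)
    ≡⟨ lemma₂ (bit r) c₀ b P (bit n) B ⟩
  (c₀ + P) + 2 * ((b + bit r) + B) + bit n
    ≡⟨ cong₂ (λ u v → u + 2 * v + bit n) N′≡ W′≡ ⟨
  N′ + 2 * W′ + bit n ∎)
  where
  open ≡-Reasoning
  n = length rs
  L = L-sequence rs
  C = cellsFrom (suc y) rs
  P = ofParity n L
  N = ofParity (suc n) L
  B = colour (bit (suc (suc y))) C
  W = colour (bit (suc y)) C
  P′ = ofParity (suc n) (L-sequence (r ∷ rs))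
  N′ = ofParity (suc (suc n)) (L-sequence (r ∷ rs))
  B′ = colour (bit (suc y)) (cellsFrom y (r ∷ rs))
  W′ = colour (bit y) (cellsFrom y (r ∷ rs))
  b = colour (bit (suc y)) (rowCells y r)
  c₀ = χ (bit (r + n) ℕ.≟ bit n)
  c₁ = χ (bit (r + n) ℕ.≟ bit (suc n))

  P′≡ : P′ ≡ c₁ + N
  P′≡ = count-∷ (λ l → bit l ℕ.≟ bit (suc n)) (r + n) L
  N′≡ : N′ ≡ c₀ + P
  N′≡ = count-∷ (λ l → bit l ℕ.≟ bit n) (r + n) L
  B′≡ : B′ ≡ b + W
  B′≡ = count-++ (λ c → bit (col c + row c) ℕ.≟ bit (suc y)) (rowCells y r) C
  W′≡ : W′ ≡ (b + bit r) + B
  W′≡ = trans (count-++ (λ c → bit (col c + row c) ℕ.≟ bit y) (rowCells y r) C) (cong (_+ B) (row-balance y r))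
  c₁≡ : c₁ ≡ bit r
  c₁≡ with bit-cases r
  ... | inj₁ eq = trans (proj₂ (χ-same {r} n eq)) (sym eq)
  ... | inj₂ eq = trans (proj₂ (χ-flip {r} n eq)) (sym eq)
  c-sum : c₀ + bit r ≡ 1
  c-sum with bit-cases r
  ... | inj₁ eq = cong₂ _+_ (proj₁ (χ-same {r} n eq)) eq
  ... | inj₂ eq = cong₂ _+_ (proj₁ (χ-flip {r} n eq)) eq

  lemma₁ : ∀ c n s b w t → (c + n) + s + 2 * (b + w) + t ≡ c + (s + t) + 2 * b + (n + 2 * w)
  lemma₁ = solve-∀
  lemma₂ : ∀ r c b p t B → r + (c + r) + 2 * b + (p + t + 2 * B) ≡ (c + p) + 2 * ((b + r) + B) + t
  lemma₂ = solve-∀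

parities-sum : ∀ n L → ofParity n L + ofParity (suc n) L ≡ length L
parities-sum n []      = refl
parities-sum n (l ∷ L) = begin
  ofParity n (l ∷ L) + ofParity (suc n) (l ∷ L)
    ≡⟨ cong₂ _+_ (count-∷ (λ l → bit l ℕ.≟ bit n) l L) (count-∷ (λ l → bit l ℕ.≟ bit (suc n)) l L) ⟩
  (χ (bit l ℕ.≟ bit n) + ofParity n L) + (χ (bit l ℕ.≟ bit (suc n)) + ofParity (suc n) L)
    ≡⟨ interchange (χ (bit l ℕ.≟ bit n)) _ _ _ ⟩
  (χ (bit l ℕ.≟ bit n) + χ (bit l ℕ.≟ bit (suc n))) + (ofParity n L + ofParity (suc n) L)
    ≡⟨ cong₂ _+_ one (parities-sum n L) ⟩
  suc (length L) ∎
  where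
  open ≡-Reasoning
  flip : ∀ {a b} → a ≢ b → a ≡ 0 ⊎ a ≡ 1 → b ≡ 0 ⊎ b ≡ 1 → ∀ {c} → c ≢ b → c ≡ 0 ⊎ c ≡ 1 → c ≡ a
  flip a≢b (inj₁ refl) (inj₁ refl) _   _           = ⊥-elim (a≢b refl)
  flip a≢b (inj₁ refl) (inj₂ refl) c≢b (inj₁ refl) = refl
  flip a≢b (inj₁ refl) (inj₂ refl) c≢b (inj₂ refl) = ⊥-elim (c≢b refl)
  flip a≢b (inj₂ refl) (inj₁ refl) c≢b (inj₁ refl) = ⊥-elim (c≢b refl)
  flip a≢b (inj₂ refl) (inj₁ refl) c≢b (inj₂ refl) = refl
  flip a≢b (inj₂ refl) (inj₂ refl) _   _           = ⊥-elim (a≢b refl)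
  one : χ (bit l ℕ.≟ bit n) + χ (bit l ℕ.≟ bit (suc n)) ≡ 1
  one with bit l ℕ.≟ bit n
  ... | yes eq = cong suc (χ-no λ eq′ → bit≢ n (trans (sym eq′) eq))
  ... | no neq = χ-yes (flip (bit≢ n) (bit-cases (suc n)) (bit-cases n) neq (bit-cases l))

-- Diagonal lengths of one quotient

last-part : ∀ q → NonIncreasing q → ∀ {x y} → x < part q y → ∃[ m ] last q ≡ just m × m ≤ part q y × y < length q
last-part (r ∷ [])     ni {y = zero}  x< = r , refl , ℕ.≤-refl , s≤s z≤n
last-part (r ∷ s ∷ rs) ni {y = zero}  x< = let m , eq , le = first s rs (ni ∘ suc) in
  m , eq , ℕ.≤-trans le (ni 0) , s≤s z≤n
  where
  first : ∀ s rs → NonIncreasing (s ∷ rs) → ∃[ m ] last (s ∷ rs) ≡ just m × m ≤ s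
  first s []       ni = s , refl , ℕ.≤-refl
  first s (r ∷ rs) ni = let m , eq , le = first r rs (ni ∘ suc) in m , eq , ℕ.≤-trans le (ni 0)
last-part (r ∷ s ∷ rs) ni {y = suc y} x< = let m , eq , le , lt = last-part (s ∷ rs) (ni ∘ suc) {y = y} x< in
  m , eq , le , s≤s lt

module Class (L : List ℕ) (decreasing : Decreasing L) (t p : ℕ) (bit-t : bit t ≡ p)
             (size : p + 2 * length (map ⌊_/2⌋ (ofBit p L)) ≡ t) where

  hs : List ℕ
  hs = map ⌊_/2⌋ (ofBit p L)

  c : ℕ
  c = length hs

  q : List ℕ
  q = positive-parts (betaParts hs)

  hs-decreasing : Decreasing hs
  hs-decreasing = halves-decreasing p decreasing

  q-nonIncreasing : NonIncreasing q
  q-nonIncreasing y = subst₂ _≤_ (sym (part-positive-parts (betaParts hs) ni (suc y)))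
    (sym (part-positive-parts (betaParts hs) ni y)) (ni y)
    where ni = betaParts-nonIncreasing hs-decreasing

  -- By `size`, the threshold `length hs` for halved entries becomes the threshold `t` for the
  -- entries themselves. With t = ℓ for one class and t = ℓ + 1 for the other, quotients and shape
  -- are read off the same list.
  T : ℕ → ℕ → ℕ
  T a b = count (λ l → (bit l ℕ.≟ bit t) ×-dec (t + a ℕ.≤? l + b)) L

  private
    double-≤ : ∀ {l u v} → bit l ≡ p → u + c ≤ ⌊ l /2⌋ + v → t + 2 * u ≤ l + 2 * v
    double-≤ {l} {u} {v} eq le = begin
      t + 2 * u                     ≡⟨ cong (_+ 2 * u) size ⟨
      p + 2 * c + 2 * u             ≡⟨ lemma p c u ⟩
      p + 2 * (u + c)               ≤⟨ ℕ.+-monoʳ-≤ p (ℕ.*-monoʳ-≤ 2 le) ⟩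
      p + 2 * (⌊ l /2⌋ + v)         ≡⟨ lemma′ p ⌊ l /2⌋ v ⟩
      p + 2 * ⌊ l /2⌋ + 2 * v       ≡⟨ cong (_+ 2 * v) (trans (cong (_+ 2 * ⌊ l /2⌋) (sym eq)) (sym (bit-half l))) ⟩
      l + 2 * v                     ∎
      where
      open ℕ.≤-Reasoning
      lemma : ∀ p c u → p + 2 * c + 2 * u ≡ p + 2 * (u + c)
      lemma = solve-∀
      lemma′ : ∀ p h v → p + 2 * (h + v) ≡ p + 2 * h + 2 * v
      lemma′ = solve-∀

    halve-≤ : ∀ {l u v} → bit l ≡ p → t + 2 * u ≤ l + 2 * v → u + c ≤ ⌊ l /2⌋ + v
    halve-≤ {l} {u} {v} eq le = ℕ.*-cancelˡ-≤ 2 (ℕ.+-cancelˡ-≤ p _ _ (begin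
      p + 2 * (u + c)               ≡⟨ lemma p c u ⟨
      p + 2 * c + 2 * u             ≡⟨ cong (_+ 2 * u) size ⟩
      t + 2 * u                     ≤⟨ le ⟩
      l + 2 * v                     ≡⟨ cong (_+ 2 * v) (trans (bit-half l) (cong (_+ 2 * ⌊ l /2⌋) eq)) ⟩
      p + 2 * ⌊ l /2⌋ + 2 * v       ≡⟨ lemma′ p ⌊ l /2⌋ v ⟨
      p + 2 * (⌊ l /2⌋ + v)         ∎))
      where
      open ℕ.≤-Reasoning
      lemma : ∀ p c u → p + 2 * c + 2 * u ≡ p + 2 * (u + c)
      lemma = solve-∀
      lemma′ : ∀ p h v → p + 2 * (h + v) ≡ p + 2 * h + 2 * v
      lemma′ = solve-∀

    count-hs : ∀ {P : ℕ → Set} (P? : Decidable P) → count P? hs ≡ count (λ l → (bit l ℕ.≟ p) ×-dec P? ⌊ l /2⌋) L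
    count-hs P? = trans (count-map ⌊_/2⌋ P? (ofBit p L)) (count-filter (λ l → bit l ℕ.≟ p) (P? ∘ ⌊_/2⌋) L)

  reach-count : ∀ x y → count (reaches? x c y) hs ≡ T (2 * x) (2 * y)
  reach-count x y = trans (count-hs (reaches? x c y)) (count-cong _ _ L
    (λ {l} _ (eq , le) → trans eq (sym bit-t) , double-≤ {l} {x} {y} eq le)
    (λ {l} _ (eq , le) → trans eq bit-t , halve-≤ {l} {x} {y} (trans eq bit-t) le))

  mem⁺ : ∀ {x y} → y < T (2 * x) (2 * y) → (x , y) ∈ cells q
  mem⁺ {x} {y} y< = cells⁺ {q} (subst (x <_)
    (sym (part-positive-parts (betaParts hs) (betaParts-nonIncreasing hs-decreasing) y))
    (betaParts⁻ x hs-decreasing (subst (y <_) (sym (reach-count x y)) y<)))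

  mem⁻ : ∀ {x y} → (x , y) ∈ cells q → y < T (2 * x) (2 * y)
  mem⁻ {x} {y} c∈ = subst (y <_) (reach-count x y) (betaParts⁺ x hs-decreasing
    (subst (x <_) (part-positive-parts (betaParts hs) (betaParts-nonIncreasing hs-decreasing) y) (cells⁻ {q} c∈)))

  T-shift : ∀ y a b → T (a + y) (b + y) ≡ T a b
  T-shift y a b = count-cong _ _ L
    (λ {l} _ (eq , le) → eq , ℕ.+-cancelʳ-≤ y _ _ (subst₂ _≤_ (sym (ℕ.+-assoc t a y)) (sym (ℕ.+-assoc l b y)) le))
    (λ {l} _ (eq , le) → eq , subst₂ _≤_ (ℕ.+-assoc t a y) (ℕ.+-assoc l b y) (ℕ.+-monoˡ-≤ y le))

  size-bound : ∀ a b → T a b ≤ c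
  size-bound a b = ℕ.≤-trans (count-mono _ (λ l → bit l ℕ.≟ p) L λ _ (eq , _) → trans eq bit-t)
    (ℕ.≤-reflexive (sym (length-map ⌊_/2⌋ (ofBit p L))))

  lower : Lower q (λ k → T (2 * k) 0)
  lower = record
    { leftClosed = left-closed {q}
    ; downClosed = down-closed {q} q-nonIncreasing
    ; mem⁺ = λ k {y} y< → mem⁺ (subst (y <_) (sym (at k y)) y<)
    ; mem⁻ = λ k {y} c∈ → subst (y <_) (at k y) (mem⁻ c∈)
    }
    where
    at : ∀ k y → T (2 * (y + k)) (2 * y) ≡ T (2 * k) 0
    at k y = trans (cong (λ a → T a (2 * y)) (trans (cong (2 *_) (ℕ.+-comm y k)) (ℕ.*-distribˡ-+ 2 k y))) (T-shift (2 * y) (2 * k) 0)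

  module _ (long : LastPart≥Length q) where

    -- Row y exists, so y is below the number of rows, which is at most the last part and hence at
    -- most row y.
    staircase : ∀ {x y} → (x , y) ∈ cells q → (y , y) ∈ cells q
    staircase {x} {y} c∈ =
      let m , eq , le , lt = last-part q q-nonIncreasing {x} {y} (cells⁻ {q} c∈)
      in cells⁺ {q} (ℕ.<-≤-trans lt (ℕ.≤-trans (long eq) le))

    -- For y ≥ s the count expresses membership of (y - s, y), which `staircase` moves to (y, y).
    -- The rows y < s count for any beta-set, as far as there are entries (`low-reach`). So the
    -- diagonal s steps above the main one has `T 0 0 ∸ s` cells.
    upper-count : ∀ s → T 0 (2 * s) ≡ T 0 0 ⊔ (s ⊓ c)
    upper-count s = ℕ.≤-antisym (below⇒≤ up) (ℕ.⊔-lub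
      (count-mono _ _ L λ {l} _ (eq , le) → eq , ℕ.≤-trans le (ℕ.+-monoʳ-≤ l z≤n))
      (below⇒≤ λ y< → reach (ℕ.≤-trans y< (ℕ.m⊓n≤m s c)) (ℕ.≤-trans y< (ℕ.m⊓n≤n s c))))
      where
      up : ∀ {y} → y < T 0 (2 * s) → y < T 0 0 ⊔ (s ⊓ c)
      up {y} y< with y ℕ.<? s
      ... | yes y<s = ℕ.≤-trans (ℕ.⊓-glb y<s (ℕ.≤-trans y< (size-bound 0 (2 * s)))) (ℕ.m≤n⊔m (T 0 0) (s ⊓ c))
      ... | no  y≮s = ℕ.≤-trans (subst (y <_) (T-shift (2 * y) 0 0) (mem⁻ (staircase
          (mem⁺ {y ∸ s} (subst (y <_) (sym shifted) y<))))) (ℕ.m≤m⊔n (T 0 0) (s ⊓ c))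
        where
        s≤y = ℕ.≮⇒≥ y≮s
        shifted : T (2 * (y ∸ s)) (2 * y) ≡ T 0 (2 * s)
        shifted = trans (cong (T (2 * (y ∸ s))) (trans (cong (2 *_) (sym (ℕ.m+[n∸m]≡n s≤y))) (ℕ.*-distribˡ-+ 2 s (y ∸ s))))
          (T-shift (2 * (y ∸ s)) 0 (2 * s))

      reach : ∀ {y} → y < s → y < c → y < T 0 (2 * s)
      reach {y} y<s y<c = ℕ.<-≤-trans (low-reach hs-decreasing y<c) (ℕ.≤-trans
        (ℕ.≤-reflexive (count-hs (λ h → length hs ℕ.≤? h + suc y)))
        (count-mono _ _ L λ {l} _ (eq , le) → trans eq (sym bit-t) ,
          ℕ.≤-trans (double-≤ {l} {0} {suc y} eq le) (ℕ.+-monoʳ-≤ l (ℕ.*-monoʳ-≤ 2 y<s))))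

-- Diagonal lengths of the shape

parity-cases : ∀ l t → bit l ≡ bit t ⊎ bit l ≡ bit (suc t)
parity-cases l t with bit-cases l | bit-cases t | bit-suc t
... | inj₁ p | inj₁ q | _ = inj₁ (trans p (sym q))
... | inj₂ p | inj₂ q | _ = inj₁ (trans p (sym q))
... | inj₁ p | inj₂ q | s = inj₂ (trans p (sym (ℕ.+-cancelʳ-≡ 1 (bit (suc t)) 0 (subst (λ b → bit (suc t) + b ≡ 1) q s))))
... | inj₂ p | inj₁ q | s = inj₂ (trans p (sym (trans (sym (ℕ.+-identityʳ _)) (subst (λ b → bit (suc t) + b ≡ 1) q s))))

split-parity : ∀ t b L → count (λ l → t ℕ.≤? l + b) L ≡
               count (λ l → (bit l ℕ.≟ bit t) ×-dec (t ℕ.≤? l + b)) L +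
               count (λ l → (bit l ℕ.≟ bit (suc t)) ×-dec (t ℕ.≤? l + b)) L
split-parity t b []      = refl
split-parity t b (l ∷ L) = begin
  count T? (l ∷ L)                   ≡⟨ count-∷ T? l L ⟩
  χ (T? l) + count T? L              ≡⟨ cong₂ _+_ (one (parity-cases l t)) (split-parity t b L) ⟩
  (χ (A? l) + χ (B? l)) + (count A? L + count B? L) ≡⟨ interchange (χ (A? l)) _ _ _ ⟩
  (χ (A? l) + count A? L) + (χ (B? l) + count B? L) ≡⟨ cong₂ _+_ (count-∷ A? l L) (count-∷ B? l L) ⟨
  count A? (l ∷ L) + count B? (l ∷ L) ∎
  where
  open ≡-Reasoning
  T? = λ l → t ℕ.≤? l + b
  A? = λ l → (bit l ℕ.≟ bit t) ×-dec (t ℕ.≤? l + b)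
  B? = λ l → (bit l ℕ.≟ bit (suc t)) ×-dec (t ℕ.≤? l + b)
  one : bit l ≡ bit t ⊎ bit l ≡ bit (suc t) → χ (T? l) ≡ χ (A? l) + χ (B? l)
  one (inj₁ eq) = trans (χ-cong {p = T? l} {A? l} (eq ,_) proj₂) (trans (sym (ℕ.+-identityʳ _))
    (cong (χ (A? l) +_) (sym (χ-no {p = B? l} λ (eq′ , _) → bit≢ t (trans (sym eq′) eq)))))
  one (inj₂ eq) = trans (χ-cong {p = T? l} {B? l} (eq ,_) proj₂)
    (cong (_+ χ (B? l)) (sym (χ-no {p = A? l} λ (eq′ , _) → bit≢ t (trans (sym eq) eq′))))

bit-double : ∀ s n → bit (2 * s + n) ≡ bit n
bit-double s n = bit-+ {2 * s} n (even⇒bit (divides s (ℕ.*-comm 2 s)))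

-- `t` and `l + 2 * s` have opposite parities, so equality is excluded.
sharpen : ∀ t s {l} → bit l ≡ bit (suc t) → t ≤ l + 2 * s → suc t ≤ l + 2 * s
sharpen t s {l} eq le = ℕ.≤∧≢⇒< le λ t≡ → bit≢ t (trans (sym eq)
  (sym (trans (cong bit t≡) (trans (cong bit (ℕ.+-comm l (2 * s))) (bit-double s l)))))

dbl≡ : ∀ s → dbl s ≡ 2 * s
dbl≡ zero    = refl
dbl≡ (suc s) = trans (cong (suc ∘ suc) (dbl≡ s)) (lemma s)
  where
  lemma : ∀ s → 2 + 2 * s ≡ 2 * suc s
  lemma = solve-∀

module Shape (sh : List ℕ) (shifted : ShiftedPavable sh) where

  open ShiftedPavable shifted

  L : List ℕ
  L = L-sequence sh

  ℓ : ℕ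
  ℓ = length sh

  decreasing : Decreasing L
  decreasing = L-decreasing (IsPartition.nonIncreasing isPartition)

  sh-nonIncreasing : NonIncreasing sh
  sh-nonIncreasing = linked⇒nonIncreasing (IsPartition.nonIncreasing isPartition)

  balanced : ofParity ℓ L + bit ℓ ≡ ofParity (suc ℓ) L
  balanced = ℕ.+-cancelʳ-≡ (2 * colour 0 (cells sh)) _ _
    (trans (cong (λ b → ofParity ℓ L + bit ℓ + 2 * b) (pavable-balanced (proj₁ pavable))) (beta-balance 0 sh))

  size-even : bit ℓ + 2 * ofParity ℓ L ≡ ℓ
  size-even = begin
    bit ℓ + 2 * ofParity ℓ L                 ≡⟨ lemma (bit ℓ) (ofParity ℓ L) ⟩
    ofParity ℓ L + (ofParity ℓ L + bit ℓ)    ≡⟨ cong (ofParity ℓ L +_) balanced ⟩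
    ofParity ℓ L + ofParity (suc ℓ) L        ≡⟨ parities-sum ℓ L ⟩
    length L                                 ≡⟨ L-length sh ⟩
    ℓ                                        ∎
    where
    open ≡-Reasoning
    lemma : ∀ b p → b + 2 * p ≡ p + (p + b)
    lemma = solve-∀

  size-odd : bit (suc ℓ) + 2 * ofParity (suc ℓ) L ≡ suc ℓ
  size-odd = begin
    bit (suc ℓ) + 2 * ofParity (suc ℓ) L               ≡⟨ cong (λ p → bit (suc ℓ) + 2 * p) balanced ⟨
    bit (suc ℓ) + 2 * (ofParity ℓ L + bit ℓ)           ≡⟨ lemma (bit (suc ℓ)) (ofParity ℓ L) (bit ℓ) ⟩
    (bit (suc ℓ) + bit ℓ) + (bit ℓ + 2 * ofParity ℓ L) ≡⟨ cong₂ _+_ (bit-suc ℓ) size-even ⟩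
    suc ℓ                                              ∎
    where
    open ≡-Reasoning
    lemma : ∀ c p b → c + 2 * (p + b) ≡ (c + b) + (b + 2 * p)
    lemma = solve-∀

  class-size : ∀ n → length (map ⌊_/2⌋ (ofBit (bit n) L)) ≡ ofParity n L
  class-size n = length-map ⌊_/2⌋ (ofBit (bit n) L)

  -- The entries with the parity of ℓ carry the even types. They form the first quotient when ℓ is
  -- even and the second when ℓ is odd.
  module A = Class L decreasing ℓ (bit ℓ) refl (trans (cong (λ c → bit ℓ + 2 * c) (class-size ℓ)) size-even)
  module B = Class L decreasing (suc ℓ) (bit (suc ℓ)) refl
               (trans (cong (λ c → bit (suc ℓ) + 2 * c) (class-size (suc ℓ))) size-odd)

  m : ℕ → ℕ
  m i = count (λ l → (bit l ℕ.≟ bit (ℓ + i)) ×-dec (ℓ + i ℕ.≤? l)) L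

  sh-mem≡ : ∀ x y → count (reaches? x (length L) y) L ≡ count (λ l → x + ℓ ℕ.≤? l + y) L
  sh-mem≡ x y = cong (λ n → count (reaches? x n y) L) (L-length sh)

  sh⁺ : ∀ {x y} → y < count (λ l → x + ℓ ℕ.≤? l + y) L → (x , y) ∈ cells sh
  sh⁺ {x} {y} y< = cells⁺ {sh} (subst (λ q → x < part q y) (betaParts-L sh)
    (betaParts⁻ x decreasing (subst (y <_) (sym (sh-mem≡ x y)) y<)))

  sh⁻ : ∀ {x y} → (x , y) ∈ cells sh → y < count (λ l → x + ℓ ℕ.≤? l + y) L
  sh⁻ {x} {y} c∈ = subst (y <_) (sh-mem≡ x y) (betaParts⁺ x decreasing
    (subst (λ q → x < part q y) (sym (betaParts-L sh)) (cells⁻ {sh} c∈)))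

  m-sum : ∀ e → count (λ l → ℓ + e ℕ.≤? l) L ≡ m e + m (suc e)
  m-sum e = begin
    count (λ l → ℓ + e ℕ.≤? l) L
      ≡⟨ count-cong _ _ L (λ {l} _ → subst (ℓ + e ≤_) (sym (ℕ.+-identityʳ l))) (λ {l} _ → subst (ℓ + e ≤_) (ℕ.+-identityʳ l)) ⟩
    count (λ l → ℓ + e ℕ.≤? l + 0) L
      ≡⟨ split-parity (ℓ + e) 0 L ⟩
    count (λ l → (bit l ℕ.≟ bit (ℓ + e)) ×-dec (ℓ + e ℕ.≤? l + 0)) L +
    count (λ l → (bit l ℕ.≟ bit (suc (ℓ + e))) ×-dec (ℓ + e ℕ.≤? l + 0)) L
      ≡⟨ cong₂ _+_
           (count-cong _ _ L (λ {l} _ (eq , le) → eq , subst (ℓ + e ≤_) (ℕ.+-identityʳ l) le)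
                             (λ {l} _ (eq , le) → eq , subst (ℓ + e ≤_) (sym (ℕ.+-identityʳ l)) le))
           (count-cong _ _ L
             (λ {l} _ (eq , le) → trans eq (cong bit (sym (ℕ.+-suc ℓ e))) ,
                subst₂ _≤_ (sym (ℕ.+-suc ℓ e)) (ℕ.+-identityʳ l) (sharpen (ℓ + e) 0 {l} eq le))
             (λ {l} _ (eq , le) → trans eq (cong bit (ℕ.+-suc ℓ e)) ,
                ℕ.<⇒≤ (subst₂ _≤_ (ℕ.+-suc ℓ e) (sym (ℕ.+-identityʳ l)) le))) ⟩
    m e + m (suc e) ∎
    where open ≡-Reasoning

  lower : Lower sh (λ e → m e + m (suc e))
  lower = record
    { leftClosed = left-closed {sh}
    ; downClosed = down-closed {sh} sh-nonIncreasing
    ; mem⁺ = λ e {y} y< → sh⁺ (subst (y <_) (sym (at e y)) y<)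
    ; mem⁻ = λ e {y} c∈ → subst (y <_) (at e y) (sh⁻ c∈)
    }
    where
    at : ∀ e y → count (λ l → y + e + ℓ ℕ.≤? l + y) L ≡ m e + m (suc e)
    at e y = trans (count-cong _ _ L
      (λ {l} _ le → ℕ.+-cancelʳ-≤ y _ _ (subst (_≤ l + y) (lemma y e ℓ) le))
      (λ {l} _ le → subst (_≤ l + y) (sym (lemma y e ℓ)) (ℕ.+-monoˡ-≤ y le))) (m-sum e)
      where
      lemma : ∀ y e ℓ → y + e + ℓ ≡ ℓ + e + y
      lemma = solve-∀

  m-even : ∀ k → A.T (2 * k) 0 ≡ m (dbl k)
  m-even k = count-cong _ _ L
    (λ {l} _ (eq , le) → trans eq (sym (same k)) , subst₂ (λ a b → ℓ + a ≤ b) (sym (dbl≡ k)) (ℕ.+-identityʳ l) le)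
    (λ {l} _ (eq , le) → trans eq (same k) , subst₂ (λ a b → ℓ + a ≤ b) (dbl≡ k) (sym (ℕ.+-identityʳ l)) le)
    where
    same : ∀ k → bit (ℓ + dbl k) ≡ bit ℓ
    same k = trans (cong bit (trans (cong (ℓ +_) (dbl≡ k)) (ℕ.+-comm ℓ (2 * k)))) (bit-double k ℓ)

  m-odd : ∀ k → B.T (2 * k) 0 ≡ m (suc (dbl k))
  m-odd k = count-cong _ _ L
    (λ {l} _ (eq , le) → trans eq (sym (same k)) , subst₂ _≤_ (shift k) (ℕ.+-identityʳ l) le)
    (λ {l} _ (eq , le) → trans eq (same k) , subst₂ _≤_ (sym (shift k)) (sym (ℕ.+-identityʳ l)) le)
    where
    shift : ∀ k → suc ℓ + 2 * k ≡ ℓ + suc (dbl k)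
    shift k = trans (cong (suc ℓ +_) (sym (dbl≡ k))) (sym (ℕ.+-suc ℓ (dbl k)))
    same : ∀ k → bit (ℓ + suc (dbl k)) ≡ bit (suc ℓ)
    same k = trans (cong bit (trans (sym (shift k)) (ℕ.+-comm (suc ℓ) (2 * k)))) (bit-double k (suc ℓ))

  lower-A : Lower A.q (m ∘ dbl)
  lower-A = record { leftClosed = leftClosed ; downClosed = downClosed
    ; mem⁺ = λ k {y} y< → mem⁺ k (subst (y <_) (sym (m-even k)) y<)
    ; mem⁻ = λ k {y} c∈ → subst (y <_) (m-even k) (mem⁻ k c∈) }
    where open Lower A.lower

  lower-B : Lower B.q (m ∘ suc ∘ dbl)
  lower-B = record { leftClosed = leftClosed ; downClosed = downClosed
    ; mem⁺ = λ k {y} y< → mem⁺ k (subst (y <_) (sym (m-odd k)) y<)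
    ; mem⁻ = λ k {y} c∈ → subst (y <_) (m-odd k) (mem⁻ k c∈) }
    where open Lower B.lower

  module _ (long-A : LastPart≥Length A.q) (long-B : LastPart≥Length B.q) where

    count-A : ∀ s → A.T 0 (2 * s) ≡ m 0 ⊔ (s ⊓ A.c)
    count-A s = trans (A.upper-count long-A s) (cong (_⊔ (s ⊓ A.c)) (m-even 0))

    count-B : ∀ s → B.T 0 (2 * s) ≡ m 1 ⊔ (s ⊓ B.c)
    count-B s = trans (B.upper-count long-B s) (cong (_⊔ (s ⊓ B.c)) (m-odd 0))

    m₀≤ : m 0 ≤ A.c
    m₀≤ = subst (_≤ A.c) (m-even 0) (A.size-bound 0 0)

    m₁≤ : m 1 ≤ B.c
    m₁≤ = subst (_≤ B.c) (m-odd 0) (B.size-bound 0 0)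

    A≤B : A.c ≤ B.c
    A≤B = subst₂ _≤_ (sym (class-size ℓ)) (trans balanced (sym (class-size (suc ℓ)))) (ℕ.m≤m+n _ (bit ℓ))

    B≤A : B.c ≤ suc A.c
    B≤A = subst₂ _≤_ (trans balanced (sym (class-size (suc ℓ)))) (cong suc (sym (class-size ℓ)))
      (subst (ofParity ℓ L + bit ℓ ≤_) (ℕ.+-comm (ofParity ℓ L) 1) (ℕ.+-monoʳ-≤ (ofParity ℓ L) bit≤1))
      where
      bit≤1 : bit ℓ ≤ 1
      bit≤1 with bit-cases ℓ
      ... | inj₁ eq = subst (_≤ 1) (sym eq) z≤n
      ... | inj₂ eq = ℕ.≤-reflexive eq

    even-count : ∀ s p → count (λ l → p + ℓ ℕ.≤? l + (p + dbl s)) L ≡ A.T 0 (2 * s) + B.T 0 (2 * s)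
    even-count s p = begin
      count (λ l → p + ℓ ℕ.≤? l + (p + dbl s)) L
        ≡⟨ count-cong _ _ L
             (λ {l} _ le → ℕ.+-cancelˡ-≤ p _ _ (subst (p + ℓ ≤_) (move l) le))
             (λ {l} _ le → subst (p + ℓ ≤_) (sym (move l)) (ℕ.+-monoʳ-≤ p le)) ⟩
      count (λ l → ℓ ℕ.≤? l + 2 * s) L
        ≡⟨ split-parity ℓ (2 * s) L ⟩
      count (λ l → (bit l ℕ.≟ bit ℓ) ×-dec (ℓ ℕ.≤? l + 2 * s)) L +
      count (λ l → (bit l ℕ.≟ bit (suc ℓ)) ×-dec (ℓ ℕ.≤? l + 2 * s)) L
        ≡⟨ cong₂ _+_
             (count-cong _ _ L (λ {l} _ (eq , le) → eq , subst (_≤ l + 2 * s) (sym (ℕ.+-identityʳ ℓ)) le)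
                               (λ {l} _ (eq , le) → eq , subst (_≤ l + 2 * s) (ℕ.+-identityʳ ℓ) le))
             (count-cong _ _ L
               (λ {l} _ (eq , le) → eq , subst (_≤ l + 2 * s) (sym (ℕ.+-identityʳ (suc ℓ))) (sharpen ℓ s {l} eq le))
               (λ {l} _ (eq , le) → eq , ℕ.<⇒≤ (subst (_≤ l + 2 * s) (ℕ.+-identityʳ (suc ℓ)) le))) ⟩
      A.T 0 (2 * s) + B.T 0 (2 * s) ∎
      where
      open ≡-Reasoning
      move : ∀ l → l + (p + dbl s) ≡ p + (l + 2 * s)
      move l = trans (cong (λ d → l + (p + d)) (dbl≡ s)) (lemma l p s)
        where
        lemma : ∀ l p s → l + (p + 2 * s) ≡ p + (l + 2 * s)
        lemma = solve-∀

    -- Entries with the parity of ℓ cannot attain ℓ - 1 - 2s, so they stay at step s, while those of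
    -- the other parity can and are already at step s + 1.
    odd-count : ∀ s p → count (λ l → p + ℓ ℕ.≤? l + (p + suc (dbl s))) L ≡ A.T 0 (2 * s) + B.T 0 (2 * suc s)
    odd-count s p = begin
      count (λ l → p + ℓ ℕ.≤? l + (p + suc (dbl s))) L
        ≡⟨ count-cong _ _ L
             (λ {l} _ le → ℕ.+-cancelˡ-≤ p _ _ (subst (p + ℓ ≤_) (move l) le))
             (λ {l} _ le → subst (p + ℓ ≤_) (sym (move l)) (ℕ.+-monoʳ-≤ p le)) ⟩
      count (λ l → ℓ ℕ.≤? l + suc (2 * s)) L
        ≡⟨ split-parity ℓ (suc (2 * s)) L ⟩
      count (λ l → (bit l ℕ.≟ bit ℓ) ×-dec (ℓ ℕ.≤? l + suc (2 * s))) L +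
      count (λ l → (bit l ℕ.≟ bit (suc ℓ)) ×-dec (ℓ ℕ.≤? l + suc (2 * s))) L
        ≡⟨ cong₂ _+_
             (count-cong _ _ L
               (λ {l} _ (eq , le) → eq , subst (_≤ l + 2 * s) (sym (ℕ.+-identityʳ ℓ)) (drop-one {l} eq le))
               (λ {l} _ (eq , le) → eq , ℕ.≤-trans (subst (_≤ l + 2 * s) (ℕ.+-identityʳ ℓ) le) (ℕ.+-monoʳ-≤ l (ℕ.n≤1+n _))))
             (count-cong _ _ L
               (λ {l} _ (eq , le) → eq , subst₂ _≤_ (sym (ℕ.+-identityʳ (suc ℓ))) (next l) (s≤s le))
               (λ {l} _ (eq , le) → eq , ℕ.≤-pred (subst₂ _≤_ (ℕ.+-identityʳ (suc ℓ)) (sym (next l)) le))) ⟩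
      A.T 0 (2 * s) + B.T 0 (2 * suc s) ∎
      where
      open ≡-Reasoning
      move : ∀ l → l + (p + suc (dbl s)) ≡ p + (l + suc (2 * s))
      move l = trans (cong (λ d → l + (p + suc d)) (dbl≡ s)) (lemma l p s)
        where
        lemma : ∀ l p s → l + (p + suc (2 * s)) ≡ p + (l + suc (2 * s))
        lemma = solve-∀
      next : ∀ l → suc (l + suc (2 * s)) ≡ l + 2 * suc s
      next l = lemma l s
        where
        lemma : ∀ l s → suc (l + suc (2 * s)) ≡ l + 2 * suc s
        lemma = solve-∀
      drop-one : ∀ {l} → bit l ≡ bit ℓ → ℓ ≤ l + suc (2 * s) → ℓ ≤ l + 2 * s
      drop-one {l} eq le = ℕ.≤-pred (ℕ.≤∧≢⇒< (subst (ℓ ≤_) (ℕ.+-suc l (2 * s)) le) λ ℓ≡ → bit≢ l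
        (trans (sym (bit-double s (suc l))) (trans (cong bit (trans (ℕ.+-comm (2 * s) (suc l)) (sym ℓ≡))) (sym eq))))

    -- As long as s ≤ c, the maximum of a and s is s plus `a ∸ s`. Once s and t have passed c and d,
    -- both inequalities are false. The two regimes must change together, which `even-range` and
    -- `odd-range` derive from A.c ≤ B.c ≤ A.c + 1.
    truncate : ∀ {a b c d s t} → a ≤ c → b ≤ d → (s ≤ c × t ≤ d) ⊎ (c ≤ s × d ≤ t) →
               ∀ p → (p + (s + t) < (a ⊔ (s ⊓ c)) + (b ⊔ (t ⊓ d)) → p < (a ∸ s) + (b ∸ t)) ×
                     (p < (a ∸ s) + (b ∸ t) → p + (s + t) < (a ⊔ (s ⊓ c)) + (b ⊔ (t ⊓ d)))
    truncate {a} {b} {c} {d} {s} {t} a≤c b≤d (inj₁ (s≤c , t≤d)) p =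
      (λ lt → ℕ.+-cancelʳ-< (s + t) _ _ (subst (p + (s + t) <_) total lt)) ,
      (λ lt → subst (p + (s + t) <_) (sym total) (ℕ.+-monoˡ-< (s + t) lt))
      where
      excess : ∀ a s c → s ≤ c → a ⊔ (s ⊓ c) ≡ (a ∸ s) + s
      excess a s c s≤c rewrite ℕ.m≤n⇒m⊓n≡m s≤c with ℕ.≤-total a s
      ... | inj₁ a≤s rewrite ℕ.m≤n⇒m∸n≡0 a≤s = ℕ.m≤n⇒m⊔n≡n a≤s
      ... | inj₂ s≤a = trans (ℕ.m≥n⇒m⊔n≡m s≤a) (sym (ℕ.m∸n+n≡m s≤a))
      total : (a ⊔ (s ⊓ c)) + (b ⊔ (t ⊓ d)) ≡ ((a ∸ s) + (b ∸ t)) + (s + t)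
      total = trans (cong₂ _+_ (excess a s c s≤c) (excess b t d t≤d)) (interchange (a ∸ s) s (b ∸ t) t)
    truncate {a} {b} {c} {d} {s} {t} a≤c b≤d (inj₂ (c≤s , d≤t)) p =
      (λ lt → ⊥-elim (ℕ.<⇒≱ lt (ℕ.≤-trans (ℕ.+-mono-≤
        (ℕ.⊔-lub (ℕ.≤-trans a≤c c≤s) (ℕ.m⊓n≤m s c)) (ℕ.⊔-lub (ℕ.≤-trans b≤d d≤t) (ℕ.m⊓n≤m t d)))
        (ℕ.m≤n+m (s + t) p)))) ,
      (λ lt → ⊥-elim (ℕ.n≮0 (subst (p <_)
        (cong₂ _+_ (ℕ.m≤n⇒m∸n≡0 (ℕ.≤-trans a≤c c≤s)) (ℕ.m≤n⇒m∸n≡0 (ℕ.≤-trans b≤d d≤t))) lt)))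

    even-range : ∀ s → (s ≤ A.c × s ≤ B.c) ⊎ (A.c ≤ s × B.c ≤ s)
    even-range s with s ℕ.≤? A.c
    ... | yes s≤ = inj₁ (s≤ , ℕ.≤-trans s≤ A≤B)
    ... | no  s≰ = inj₂ (ℕ.<⇒≤ (ℕ.≰⇒> s≰) , ℕ.≤-trans B≤A (ℕ.≰⇒> s≰))

    odd-range : ∀ s → (s ≤ A.c × suc s ≤ B.c) ⊎ (A.c ≤ s × B.c ≤ suc s)
    odd-range s with suc s ℕ.≤? B.c
    ... | yes s< = inj₁ (ℕ.≤-pred (ℕ.≤-trans s< B≤A) , s<)
    ... | no  s≮ = inj₂ (ℕ.≤-trans A≤B (ℕ.≤-pred (ℕ.≰⇒> s≮)) , ℕ.<⇒≤ (ℕ.≰⇒> s≮))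

    even-total : ∀ s p → count (λ l → p + ℓ ℕ.≤? l + (p + dbl s)) L ≡ (m 0 ⊔ (s ⊓ A.c)) + (m 1 ⊔ (s ⊓ B.c))
    even-total s p = trans (even-count s p) (cong₂ _+_ (count-A s) (count-B s))

    odd-total : ∀ s p → count (λ l → p + ℓ ℕ.≤? l + (p + suc (dbl s))) L ≡ (m 0 ⊔ (s ⊓ A.c)) + (m 1 ⊔ (suc s ⊓ B.c))
    odd-total s p = trans (odd-count s p) (cong₂ _+_ (count-A s) (count-B (suc s)))

    dbl-sum : ∀ p s → p + dbl s ≡ p + (s + s)
    dbl-sum p s = cong (p +_) (trans (dbl≡ s) (cong (s +_) (ℕ.+-identityʳ s)))

    suc-dbl-sum : ∀ p s → p + suc (dbl s) ≡ p + (s + suc s)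
    suc-dbl-sum p s = cong (p +_) (trans (cong suc (trans (dbl≡ s) (cong (s +_) (ℕ.+-identityʳ s)))) (sym (ℕ.+-suc s s)))

    upper : Upper sh m
    upper = record
      { even⁺ = λ s {p} lt → sh⁺ (subst₂ _<_ (sym (dbl-sum p s)) (sym (even-total s p)) (proj₂ (truncate m₀≤ m₁≤ (even-range s) p) lt))
      ; even⁻ = λ s {p} c∈ → proj₁ (truncate m₀≤ m₁≤ (even-range s) p) (subst₂ _<_ (dbl-sum p s) (even-total s p) (sh⁻ c∈))
      ; odd⁺  = λ s {p} lt → sh⁺ (subst₂ _<_ (sym (suc-dbl-sum p s)) (sym (odd-total s p)) (proj₂ (truncate m₀≤ m₁≤ (odd-range s) p) lt))
      ; odd⁻  = λ s {p} c∈ → proj₁ (truncate m₀≤ m₁≤ (odd-range s) p) (subst₂ _<_ (suc-dbl-sum p s) (odd-total s p) (sh⁻ c∈))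
      }

  -- A non-empty diagonal e contains (e, 0), whose column is bounded; one more accounts for type e +
  -- 1.
  bound : ∃[ K ] (∀ e → 0 < m e + m (suc e) → suc e < K)
  bound = let z , h = upperBound col (cells sh) in
    suc z , λ e 0< → s≤s (h (Lower.mem⁺ lower e 0<))

-- Products of power series

module Slots (f : Monomial → ℕ) (g : Monomial → ℕ) where

  size : Monomial × Monomial → ℕ
  size (b , c) = f b * g c

  -- A product coefficient counts a disjoint sum, over the factorisations, of products of finite
  -- sets; `encode` and `decode` are the two directions.
  encode : ∀ fs {p} → p ∈ fs → Fin (f (proj₁ p)) → Fin (g (proj₂ p)) → Fin (sum (map size fs))
  encode (p ∷ fs) (here refl) i j = combine i j ↑ˡ sum (map size fs)
  encode (p ∷ fs) (there p∈)  i j = size p ↑ʳ encode fs p∈ i j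

  Slot : List (Monomial × Monomial) → Set
  Slot fs = Σ[ p ∈ Monomial × Monomial ] p ∈ fs × Fin (f (proj₁ p)) × Fin (g (proj₂ p))

  decode : ∀ fs → Fin (sum (map size fs)) → Slot fs
  decode (p ∷ fs) x with Fin.splitAt (size p) x
  ... | inj₁ y = p , here refl , remQuot (g (proj₂ p)) y
  ... | inj₂ z = let q , q∈ , ij = decode fs z in q , there q∈ , ij

  decode-encode : ∀ fs {p} (p∈ : p ∈ fs) i j → decode fs (encode fs p∈ i j) ≡ (p , p∈ , i , j)
  decode-encode (p ∷ fs) (here refl) i j
    rewrite Fin.splitAt-↑ˡ (size p) (combine i j) (sum (map size fs)) | Fin.remQuot-combine i j = refl
  decode-encode (p ∷ fs) (there p∈) i j
    rewrite Fin.splitAt-↑ʳ (size p) (sum (map size fs)) (encode fs p∈ i j) | decode-encode fs p∈ i j = refl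

  encode-decode : ∀ fs x → let p , p∈ , i , j = decode fs x in encode fs p∈ i j ≡ x
  encode-decode (p ∷ fs) x with Fin.splitAt (size p) x in eq
  ... | inj₁ y = trans (cong (_↑ˡ sum (map size fs)) (Fin.combine-remQuot {f (proj₁ p)} (g (proj₂ p)) y))
                   (Fin.splitAt⁻¹-↑ˡ eq)
  ... | inj₂ z = trans (cong (size p ↑ʳ_) (encode-decode fs z)) (Fin.splitAt⁻¹-↑ʳ eq)

factorisations-unique : ∀ a → Unique (factorisations a)
factorisations-unique []      = [] ∷ []
factorisations-unique (n ∷ a) = Unique.cartesianProductWith⁺ _
  (λ eq → ∷-injectiveˡ (cong proj₁ eq) ,
          cong₂ _,_ (∷-injectiveʳ (cong proj₁ eq)) (∷-injectiveʳ (cong proj₂ eq)))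
  (Unique.upTo⁺ (suc n)) (factorisations-unique a)

factorisation-sum : ∀ a {b c} → (b , c) ∈ factorisations a → ∀ k → exponent b k + exponent c k ≡ exponent a k
factorisation-sum [] (here refl) k = refl
factorisation-sum (n ∷ a) p∈ k
  with i , (b , c) , i∈ , q∈ , refl ← ∈-cartesianProductWith⁻ _ (upTo (suc n)) (factorisations a) p∈ = go k
  where
  go : ∀ k → exponent (i ∷ b) k + exponent (n ∸ i ∷ c) k ≡ exponent (n ∷ a) k
  go zero    = ℕ.m+[n∸m]≡n (ℕ.≤-pred (∈-upTo⁻ i∈))
  go (suc k) = factorisation-sum a q∈ k

-- Beyond the length of `a` the sum is 0, so both weights vanish there and lists of that length
-- record them completely.
factorise : ∀ a (f g : ℕ → ℕ) → (∀ k → f k + g k ≡ exponent a k) →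
            Σ[ p ∈ Monomial × Monomial ] p ∈ factorisations a ×
              (∀ k → f k ≡ exponent (proj₁ p) k) × (∀ k → g k ≡ exponent (proj₂ p) k)
factorise [] f g h = ([] , []) , here refl , (λ k → ℕ.m+n≡0⇒m≡0 (f k) (h k)) , (λ k → ℕ.m+n≡0⇒n≡0 (f k) (h k))
factorise (n ∷ a) f g h =
  let (b , c) , p∈ , hb , hc = factorise a (f ∘ suc) (g ∘ suc) (h ∘ suc)
  in (f 0 ∷ b , n ∸ f 0 ∷ c)
   , ∈-cartesianProductWith⁺ (λ i (b , c) → (i ∷ b) , ((n ∸ i) ∷ c))
       (∈-upTo⁺ (s≤s (subst (f 0 ≤_) (h 0) (ℕ.m≤m+n (f 0) (g 0))))) p∈
   , (λ { zero → refl ; (suc k) → hb k })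
   , (λ { zero → trans (sym (ℕ.m+n∸m≡n (f 0) (g 0))) (cong (_∸ f 0) (h 0)) ; (suc k) → hc k })

factorisation-length : ∀ a {b c} → (b , c) ∈ factorisations a → length b ≡ length a × length c ≡ length a
factorisation-length [] (here refl) = refl , refl
factorisation-length (n ∷ a) p∈
  with i , (b , c) , _ , q∈ , refl ← ∈-cartesianProductWith⁻ _ (upTo (suc n)) (factorisations a) p∈ =
  let eb , ec = factorisation-length a q∈ in cong suc eb , cong suc ec

exponent-injective : ∀ a b → length a ≡ length b → (∀ k → exponent a k ≡ exponent b k) → a ≡ b
exponent-injective []      []      _  _ = refl
exponent-injective (m ∷ a) (n ∷ b) eq h =
  cong₂ _∷_ (h 0) (exponent-injective a b (ℕ.suc-injective eq) (h ∘ suc))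

module Product (S S′ : Setoid 0ℓ 0ℓ) (w : Setoid.Carrier S → ℕ → ℕ) (w′ : Setoid.Carrier S′ → ℕ → ℕ)
  (w-cong : ∀ {s t} → Setoid._≈_ S s t → ∀ k → w s k ≡ w t k)
  (w′-cong : ∀ {s t} → Setoid._≈_ S′ s t → ∀ k → w′ s k ≡ w′ t k)
  (F G : PowerSeries) (SF : Sum S w F) (SG : Sum S′ w′ G) where

  private
    module S  = Setoid S
    module S′ = Setoid S′

  open Slots F G

  weight : S.Carrier × S′.Carrier → ℕ → ℕ
  weight (s , t) k = w s k + w′ t k

  module _ (a : Monomial) where

    private fs = factorisations a

    position : Setoid.Carrier (OfWeight (×-setoid S S′) weight a) → Fin ((F ⊛ G) a)
    position ((s , t) , h) =
      let (b , c) , p∈ , hb , hc = factorise a (w s) (w′ t) h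
      in encode fs p∈ (Inverse.to (SF b) (s , hb)) (Inverse.to (SG c) (t , hc))

    -- The factorisation depends only on the weights, and lists of equal length with equal exponents
    -- coincide. Membership proofs agree as well, because `factorisations a` has no repetitions.
    position≡ : ∀ {s t h s₀ t₀ b c} (p∈ : (b , c) ∈ fs)
                (hb : ∀ k → w s₀ k ≡ exponent b k) (hc : ∀ k → w′ t₀ k ≡ exponent c k) →
                s S.≈ s₀ → t S′.≈ t₀ →
                position ((s , t) , h) ≡ encode fs p∈ (Inverse.to (SF b) (s₀ , hb)) (Inverse.to (SG c) (t₀ , hc))
    position≡ {s} {t} {h} {s₀} {t₀} {b} {c} p∈ hb hc s≈ t≈ =
      let (b′ , c′) , q∈ , hb′ , hc′ = factorise a (w s) (w′ t) h
      in same q∈ hb′ hc′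
           (exponent-injective b′ b (trans (proj₁ (factorisation-length a q∈)) (sym (proj₁ (factorisation-length a p∈))))
             (λ k → trans (sym (hb′ k)) (trans (w-cong s≈ k) (hb k))))
           (exponent-injective c′ c (trans (proj₂ (factorisation-length a q∈)) (sym (proj₂ (factorisation-length a p∈))))
             (λ k → trans (sym (hc′ k)) (trans (w′-cong t≈ k) (hc k))))
      where
      same : ∀ {b′ c′} (q∈ : (b′ , c′) ∈ fs) (hb′ : ∀ k → w s k ≡ exponent b′ k) (hc′ : ∀ k → w′ t k ≡ exponent c′ k) →
             b′ ≡ b → c′ ≡ c →
             encode fs q∈ (Inverse.to (SF b′) (s , hb′)) (Inverse.to (SG c′) (t , hc′)) ≡
             encode fs p∈ (Inverse.to (SF b) (s₀ , hb)) (Inverse.to (SG c) (t₀ , hc))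
      same q∈ hb′ hc′ refl refl rewrite unique⇒irrelevant (factorisations-unique a) q∈ p∈ =
        cong₂ (encode fs p∈) (Inverse.to-cong (SF b) s≈) (Inverse.to-cong (SG c) t≈)

    element : Slot fs → Setoid.Carrier (OfWeight (×-setoid S S′) weight a)
    element ((b , c) , p∈ , i , j) =
      let s , hs = Inverse.from (SF b) i
          t , ht = Inverse.from (SG c) j
      in (s , t) , λ k → trans (cong₂ _+_ (hs k) (ht k)) (factorisation-sum a p∈ k)

  sum-product : Sum (×-setoid S S′) weight (F ⊛ G)
  sum-product a = record
    { to        = position a
    ; from      = element a ∘ decode fs
    ; to-cong   = λ { {(s , t) , h} {(s′ , t′) , h′} (s≈ , t≈) →
        let _ , p∈ , hb , hc = factorise a (w s′) (w′ t′) h′ in position≡ a p∈ hb hc s≈ t≈ }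
    ; from-cong = λ { refl → S.refl , S′.refl }
    ; inverse   = inverseˡ , inverseʳ
    }
    where
    fs = factorisations a

    inverseˡ : ∀ {x y} → Setoid._≈_ (OfWeight (×-setoid S S′) weight a) y (element a (decode fs x)) → position a y ≡ x
    inverseˡ {x} {(s , t) , h} (s≈ , t≈) =
      let (b , c) , p∈ , i , j = decode fs x
          s₀ , hs = Inverse.from (SF b) i
          t₀ , ht = Inverse.from (SG c) j
      in trans (position≡ a {h = h} p∈ hs ht s≈ t≈)
           (trans (cong₂ (encode fs p∈) (Inverse.inverseˡ (SF b) S.refl) (Inverse.inverseˡ (SG c) S′.refl))
             (encode-decode fs x))

    inverseʳ : ∀ {x y} → y ≡ position a x → Setoid._≈_ (OfWeight (×-setoid S S′) weight a) (element a (decode fs y)) x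
    inverseʳ {(s , t) , h} refl =
      let (b , c) , p∈ , hb , hc = factorise a (w s) (w′ t) h
      in subst (λ slot → Setoid._≈_ (OfWeight (×-setoid S S′) weight a) (element a slot) ((s , t) , h))
           (sym (decode-encode fs p∈ (Inverse.to (SF b) (s , hb)) (Inverse.to (SG c) (t , hc))))
           (Inverse.inverseʳ (SF b) refl , Inverse.inverseʳ (SG c) refl)

record WeightedBijection (S T : Setoid 0ℓ 0ℓ) (v : Setoid.Carrier S → ℕ → ℕ) (w : Setoid.Carrier T → ℕ → ℕ) : Set where
  private
    module S = Setoid S
    module T = Setoid T
  field
    to        : S.Carrier → T.Carrier
    from      : T.Carrier → S.Carrier
    to-cong   : ∀ {s s′} → s S.≈ s′ → to s T.≈ to s′
    from-cong : ∀ {t t′} → t T.≈ t′ → from t S.≈ from t′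
    to-from   : ∀ t → to (from t) T.≈ t
    from-to   : ∀ s → from (to s) S.≈ s
    weight-to : ∀ s k → w (to s) k ≡ v s k
    weight-from : ∀ t k → v (from t) k ≡ w t k

  transport : ∀ {F} → Sum T w F → Sum S v F
  transport ST a = record
    { to        = λ (s , h) → Inverse.to (ST a) (to s , λ k → trans (weight-to s k) (h k))
    ; from      = λ i → let t , h = Inverse.from (ST a) i in from t , λ k → trans (weight-from t k) (h k)
    ; to-cong   = λ s≈ → Inverse.to-cong (ST a) (to-cong s≈)
    ; from-cong = λ { refl → S.refl }
    ; inverse   = (λ {i} s≈ → Inverse.inverseˡ (ST a) (T.trans (to-cong s≈) (to-from (proj₁ (Inverse.from (ST a) i)))))
                , (λ { {s , _} refl → S.trans (from-cong (Inverse.inverseʳ (ST a) refl)) (from-to s) })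
    }

-- Domino tableaux and pairs of Young tableaux

dbl-cases : ∀ i → ∃[ k ] (i ≡ dbl k ⊎ i ≡ suc (dbl k))
dbl-cases zero          = 0 , inj₁ refl
dbl-cases (suc zero)    = 0 , inj₂ refl
dbl-cases (suc (suc i)) with dbl-cases i
... | k , inj₁ refl = suc k , inj₁ refl
... | k , inj₂ refl = suc k , inj₂ refl

dbl≢suc-dbl : ∀ j k → dbl j ≢ suc (dbl k)
dbl≢suc-dbl (suc j) (suc k) eq = dbl≢suc-dbl j k (ℕ.suc-injective (ℕ.suc-injective eq))

module Sorting (K : ℕ) where

  open Keys K
  open Data.List.Sort (On.decTotalOrder ℕ.≤-decTotalOrder key) public using (sort; sort-↭; sort-↗)

  valid-resp-↭ : ∀ {m G H} → G ↭ H → Valid m G → Valid m H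
  valid-resp-↭ {m} {G} {H} p V = record
    { unique     = unique-resp-↭ p unique
    ; bounded    = bounded ∘ ∈-resp-↭ (↭-sym p)
    ; interlace≥ = λ i z → subst₂ _≤_ (N-↭ p (2 + i) z) (N-↭ p i z) (interlace≥ i z)
    ; interlace≤ = λ i z → subst₂ _≤_ (N-↭ p i z) (cong suc (N-↭ p (2 + i) z)) (interlace≤ i z)
    ; total      = λ i {z} h → trans (sym (N-↭ p i z)) (total i (h ∘ ∈-resp-↭ p))
    }
    where open Valid V

  -- Distinct beads have distinct keys, so the weak order produced by sorting is strict.
  sort-increasing : ∀ {m G} → Valid m (sort G) → AllPairs (λ b c → key b < key c) (sort G)
  sort-increasing {m} {G} V = strict (Linked⇒AllPairs (λ {b} {c} {d} → ℕ.≤-trans {key b} {key c} {key d}) (sort-↗ G)) unique key-inj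
    where
    open Valid V
    strict : ∀ {xs} → AllPairs (λ b c → key b ≤ key c) xs → Unique xs →
             (∀ {b c} → b ∈ xs → c ∈ xs → key b ≡ key c → b ≡ c) → AllPairs (λ b c → key b < key c) xs
    strict []       []       _   = []
    strict (b ∷ bs) (u ∷ us) inj =
      All.tabulate (λ c∈ → ℕ.≤∧≢⇒< (All.lookup b c∈) λ eq → All.lookup u c∈ (inj (here refl) (there c∈) eq))
      ∷ strict bs us (λ p q → inj (there p) (there q))

content-beads : ∀ {P : Set} (bead : P × Letter → Bead) → (∀ u → proj₂ (bead u) ≡ proj₂ u) → ∀ (t : Filling P) k →
                content t k ≡ count (λ b → index (proj₂ b) ℕ.≟ k) (map bead (labelled t))
content-beads bead same t k = trans
  (count-cong _ _ (labelled t) (λ {u} _ eq → trans (cong index (same u)) eq) (λ {u} _ eq → trans (cong index (sym (same u))) eq))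
  (sym (count-map bead (λ b → index (proj₂ b) ℕ.≟ k) (labelled t)))

youngPairs : List ℕ → List ℕ → Setoid 0ℓ 0ℓ
youngPairs A B = ×-setoid (shiftedYoungTableaux A) (shiftedYoungTableaux B)

pairWeight : ∀ {A B} → ShiftedYoungTableau A × ShiftedYoungTableau B → ℕ → ℕ
pairWeight (t , u) k = ShiftedYoungTableau.weight t k + ShiftedYoungTableau.weight u k

PairSum : List ℕ → List ℕ → PowerSeries → Set
PairSum A B = Sum (youngPairs A B) pairWeight

module Correspondence
  (sh A B : List ℕ) (m : ℕ → ℕ) (K : ℕ)
  (lower : Lower sh (λ e → m e + m (suc e))) (upper : Upper sh m)
  (lower-A : Lower A (m ∘ dbl)) (lower-B : Lower B (m ∘ suc ∘ dbl))
  (bound : ∀ e → 0 < m e + m (suc e) → suc e < K) where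

  open Keys K
  open Dominoes K
  open Sorting K

  private
    module YA = Young K dbl (λ _ → refl)
    module YB = Young K (suc ∘ dbl) (λ _ → refl)
    open ShiftedDominoTableau using () renaming (filling to dominoFilling)
    open ShiftedYoungTableau using () renaming (filling to youngFilling)

  bound-A : ∀ k → 0 < m (dbl k) → dbl k < K
  bound-A k 0< = ℕ.<⇒≤ (bound (dbl k) (ℕ.≤-trans 0< (ℕ.m≤m+n (m (dbl k)) _)))

  bound-B : ∀ k → 0 < m (suc (dbl k)) → suc (dbl k) < K
  bound-B k 0< = bound (dbl k) (ℕ.≤-trans 0< (ℕ.m≤n+m (m (suc (dbl k))) _))

  Pair : Set
  Pair = ShiftedYoungTableau A × ShiftedYoungTableau B

  beadsA : ShiftedYoungTableau A → List Bead
  beadsA t = YA.youngBeads (youngFilling t)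

  beadsB : ShiftedYoungTableau B → List Bead
  beadsB u = YB.youngBeads (youngFilling u)

  pairBeads : Pair → List Bead
  pairBeads (t , u) = beadsA t ++ beadsB u

  beadsT : ShiftedDominoTableau sh → List Bead
  beadsT T = dominoBeads (dominoFilling T)

  private
    module FA (t : ShiftedYoungTableau A) = YA.FromTableau lower-A bound-A t
    module FB (u : ShiftedYoungTableau B) = YB.FromTableau lower-B bound-B u
    module FT (T : ShiftedDominoTableau sh) = Dominoes.FromTableau K {sh} {m} lower bound T

  typeA : ∀ {t b k} → b ∈ beadsA t → proj₁ b ≢ suc (dbl k)
  typeA {t} {b} {k} b∈ eq = let j , _ , b≡ , _ = FA.bead⁻ t b∈ in dbl≢suc-dbl j k (trans (sym (cong proj₁ b≡)) eq)

  typeB : ∀ {u b k} → b ∈ beadsB u → proj₁ b ≢ dbl k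
  typeB {u} {b} {k} b∈ eq = let j , _ , b≡ , _ = FB.bead⁻ u b∈ in dbl≢suc-dbl k j (trans (sym eq) (cong proj₁ b≡))

  pair-unique : ∀ p → Unique (pairBeads p)
  pair-unique (t , u) = Unique.++⁺ (FA.G-unique t) (FB.G-unique u) λ (p , q) →
    let j , _ , b≡ , _ = FA.bead⁻ t p in typeB {u} {k = j} q (cong proj₁ b≡)

  N-A : ∀ t u k z → N (pairBeads (t , u)) (dbl k) z ≡ N (beadsA t) (dbl k) z
  N-A t u k z = trans (N-++ (beadsA t) (beadsB u) (dbl k) z) (trans
    (cong (N (beadsA t) (dbl k) z +_) (N-none (beadsB u) z (typeB {u} {k = k}))) (ℕ.+-identityʳ _))

  N-B : ∀ t u k z → N (pairBeads (t , u)) (suc (dbl k)) z ≡ N (beadsB u) (suc (dbl k)) z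
  N-B t u k z = trans (N-++ (beadsA t) (beadsB u) (suc (dbl k)) z)
    (cong (_+ N (beadsB u) (suc (dbl k)) z) (N-none (beadsA t) z (typeA {t} {k = k})))

  -- Interlacing compares types of equal parity, even types come only from `A` and odd ones only
  -- from `B`; so each condition concerns one of the two tableaux.
  pair-valid : ∀ p → Valid m (pairBeads p)
  pair-valid p@(t , u) = record
    { unique     = pair-unique p
    ; bounded    = λ b∈ → bounded (∈-++⁻ (beadsA t) b∈)
    ; interlace≥ = λ i z → interlace≥ i z (dbl-cases i)
    ; interlace≤ = λ i z → interlace≤ i z (dbl-cases i)
    ; total      = λ i h → total i h (dbl-cases i)
    }
    where
    bounded : ∀ {i l} → (i , l) ∈ beadsA t ⊎ (i , l) ∈ beadsB u → i < K
    bounded (inj₁ q) = let _ , _ , b≡ , lt = FA.bead⁻ t q in subst (λ b → proj₁ b < K) (sym b≡) lt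
    bounded (inj₂ q) = let _ , _ , b≡ , lt = FB.bead⁻ u q in subst (λ b → proj₁ b < K) (sym b≡) lt

    interlace≥ : ∀ i z → ∃[ k ] (i ≡ dbl k ⊎ i ≡ suc (dbl k)) → N (pairBeads p) (2 + i) z ≤ N (pairBeads p) i z
    interlace≥ _ z (k , inj₁ refl) = subst₂ _≤_ (sym (N-A t u (suc k) z)) (sym (N-A t u k z)) (FA.N-anti t k z)
    interlace≥ _ z (k , inj₂ refl) = subst₂ _≤_ (sym (N-B t u (suc k) z)) (sym (N-B t u k z)) (FB.N-anti u k z)

    interlace≤ : ∀ i z → ∃[ k ] (i ≡ dbl k ⊎ i ≡ suc (dbl k)) → N (pairBeads p) i z ≤ suc (N (pairBeads p) (2 + i) z)
    interlace≤ _ z (k , inj₁ refl) = subst₂ _≤_ (sym (N-A t u k z)) (cong suc (sym (N-A t u (suc k) z))) (FA.N-step t k z)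
    interlace≤ _ z (k , inj₂ refl) = subst₂ _≤_ (sym (N-B t u k z)) (cong suc (sym (N-B t u (suc k) z))) (FB.N-step u k z)

    total : ∀ i {z} → (∀ {b} → b ∈ pairBeads p → key b < z) → ∃[ k ] (i ≡ dbl k ⊎ i ≡ suc (dbl k)) → N (pairBeads p) i z ≡ m i
    total _ {z} h (k , inj₁ refl) = trans (N-A t u k z) (FA.N-total t k (h ∘ ∈-++⁺ˡ))
    total _ {z} h (k , inj₂ refl) = trans (N-B t u k z) (FB.N-total u k (h ∘ ∈-++⁺ʳ (beadsA t)))

  sorted-valid : ∀ p → Valid m (sort (pairBeads p))
  sorted-valid p = valid-resp-↭ (↭-sym (sort-↭ (pairBeads p))) (pair-valid p)

  private
    module DA (T : ShiftedDominoTableau sh) =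
      YA.FromBeads lower-A bound-A (FT.valid T) (λ _ → refl)
    module DB (T : ShiftedDominoTableau sh) =
      YB.FromBeads lower-B bound-B (FT.valid T) (λ _ → refl)
    module PD (p : Pair) =
      Assemble.FromBeads K {sh} {m} lower upper (sorted-valid p) (sort-increasing (sorted-valid p))

  toPair : ShiftedDominoTableau sh → Pair
  toPair T = DA.T T , DB.T T

  fromPair : Pair → ShiftedDominoTableau sh
  fromPair p = PD.T p

  -- Both passages keep the beads (see `fromPair-beads`). Since beads determine tableaux, the
  -- passages are mutually inverse, and since beads carry the letters, they preserve weights.
  toPair-beads : ∀ T → beadsT T ↭ pairBeads (toPair T)
  toPair-beads T = same-members⇒↭ (FT.G-unique T) (pair-unique (toPair T)) (λ {b} b∈ → into b b∈ (dbl-cases (proj₁ b))) (back ∘ ∈-++⁻ _)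
    where
    into : ∀ b → b ∈ beadsT T → ∃[ k ] (proj₁ b ≡ dbl k ⊎ proj₁ b ≡ suc (dbl k)) → b ∈ pairBeads (toPair T)
    into _ b∈ (k , inj₁ refl) = ∈-++⁺ˡ (DA.beads⁺ T {k} b∈)
    into _ b∈ (k , inj₂ refl) = ∈-++⁺ʳ (beadsA (DA.T T)) (DB.beads⁺ T {k} b∈)
    back : ∀ {b} → b ∈ beadsA (DA.T T) ⊎ b ∈ beadsB (DB.T T) → b ∈ beadsT T
    back (inj₁ q) = DA.beads⁻ T q
    back (inj₂ q) = DB.beads⁻ T q

  fromPair-beads : ∀ p → beadsT (fromPair p) ↭ pairBeads p
  fromPair-beads p = same-members⇒↭ (FT.G-unique (fromPair p)) (pair-unique p)
    (∈-resp-↭ (sort-↭ (pairBeads p)) ∘ PD.beads⁻ p)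
    (PD.beads⁺ p ∘ ∈-resp-↭ (↭-sym (sort-↭ (pairBeads p))))

  pair-determined : ∀ {p q} → pairBeads p ↭ pairBeads q →
                    youngFilling (proj₁ p) ≡ youngFilling (proj₁ q) × youngFilling (proj₂ p) ≡ youngFilling (proj₂ q)
  pair-determined {t , u} {t′ , u′} p↭q =
    YA.young-determined lower-A bound-A t t′
      (same-members⇒↭ (FA.G-unique t) (FA.G-unique t′) (A⊆ {t} {u} {t′} {u′} p↭q) (A⊆ {t′} {u′} {t} {u} (↭-sym p↭q))) ,
    YB.young-determined lower-B bound-B u u′
      (same-members⇒↭ (FB.G-unique u) (FB.G-unique u′) (B⊆ {t} {u} {t′} {u′} p↭q) (B⊆ {t′} {u′} {t} {u} (↭-sym p↭q)))
    where
    A⊆ : ∀ {t u t′ u′} → pairBeads (t , u) ↭ pairBeads (t′ , u′) → ∀ {b} → b ∈ beadsA t → b ∈ beadsA t′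
    A⊆ {t} {u} {t′} {u′} p↭q b∈ with ∈-++⁻ (beadsA t′) (∈-resp-↭ p↭q (∈-++⁺ˡ b∈))
    ... | inj₁ q = q
    ... | inj₂ q = let j , _ , b≡ , _ = FA.bead⁻ t b∈ in ⊥-elim (typeB {u′} {k = j} q (cong proj₁ b≡))
    B⊆ : ∀ {t u t′ u′} → pairBeads (t , u) ↭ pairBeads (t′ , u′) → ∀ {b} → b ∈ beadsB u → b ∈ beadsB u′
    B⊆ {t} {u} {t′} {u′} p↭q b∈ with ∈-++⁻ (beadsA t′) (∈-resp-↭ p↭q (∈-++⁺ʳ (beadsA t) b∈))
    ... | inj₁ q = let j , _ , b≡ , _ = FB.bead⁻ u b∈ in ⊥-elim (typeA {t′} {k = j} q (cong proj₁ b≡))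
    ... | inj₂ q = q

  tableau-determined : ∀ T U → beadsT T ↭ beadsT U → Setoid._≈_ (shiftedDominoTableaux sh) T U
  tableau-determined T U T↭U u = mk⇔
    (domino-tableau-determined {sh} {m} lower bound T U T↭U)
    (domino-tableau-determined {sh} {m} lower bound U T (↭-sym T↭U))

  beadsT-cong : ∀ {T U} → Setoid._≈_ (shiftedDominoTableaux sh) T U → beadsT T ↭ beadsT U
  beadsT-cong {T} {U} T≈U = same-members⇒↭ (FT.G-unique T) (FT.G-unique U)
    (λ b∈ → let v , v∈ , eq = FT.bead⁻ T b∈ in subst (_∈ beadsT U) (sym eq) (FT.bead⁺ U (Equivalence.to (T≈U v) v∈)))
    (λ b∈ → let v , v∈ , eq = FT.bead⁻ U b∈ in subst (_∈ beadsT T) (sym eq) (FT.bead⁺ T (Equivalence.from (T≈U v) v∈)))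

  pairBeads-cong : ∀ {p q} → Setoid._≈_ (youngPairs A B) p q → pairBeads p ↭ pairBeads q
  pairBeads-cong (t≡ , u≡) = ↭-reflexive (cong₂ (λ t u → YA.youngBeads t ++ YB.youngBeads u) t≡ u≡)

  weight≡ : ∀ T p → beadsT T ↭ pairBeads p → ∀ k → pairWeight p k ≡ ShiftedDominoTableau.weight T k
  weight≡ T (t , u) T↭p k = sym (begin
    content (dominoFilling T) k           ≡⟨ content-beads dominoBead (λ _ → refl) (dominoFilling T) k ⟩
    count I? (beadsT T)                   ≡⟨ count-↭ I? T↭p ⟩
    count I? (beadsA t ++ beadsB u)       ≡⟨ count-++ I? (beadsA t) (beadsB u) ⟩
    count I? (beadsA t) + count I? (beadsB u)
      ≡⟨ cong₂ _+_ (content-beads YA.cellBead (λ _ → refl) (youngFilling t) k)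
                   (content-beads YB.cellBead (λ _ → refl) (youngFilling u) k) ⟨
    content (youngFilling t) k + content (youngFilling u) k ∎)
    where
    open ≡-Reasoning
    I? : Decidable (λ (b : Bead) → index (proj₂ b) ≡ k)
    I? b = index (proj₂ b) ℕ.≟ k

  bijection : WeightedBijection (shiftedDominoTableaux sh) (youngPairs A B) ShiftedDominoTableau.weight pairWeight
  bijection = record
    { to        = toPair
    ; from      = fromPair
    ; to-cong   = λ {T} {U} T≈U → pair-determined {toPair T} {toPair U}
        (↭-trans (↭-sym (toPair-beads T)) (↭-trans (beadsT-cong {T} {U} T≈U) (toPair-beads U)))
    ; from-cong = λ {p} {q} p≈q → tableau-determined (fromPair p) (fromPair q)
        (↭-trans (fromPair-beads p) (↭-trans (pairBeads-cong {p} {q} p≈q) (↭-sym (fromPair-beads q))))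
    ; to-from   = λ p → pair-determined {toPair (fromPair p)} {p}
        (↭-trans (↭-sym (toPair-beads (fromPair p))) (fromPair-beads p))
    ; from-to   = λ T → tableau-determined (fromPair (toPair T)) T
        (↭-trans (fromPair-beads (toPair T)) (↭-sym (toPair-beads T)))
    ; weight-to   = λ T → weight≡ T (toPair T) (toPair-beads T)
    ; weight-from = λ p k → sym (weight≡ (fromPair p) p (fromPair-beads p) k)
    }

young-product : ∀ μ ν → PairSum μ ν (Q μ ⊛ Q ν)
young-product μ ν = Product.sum-product (shiftedYoungTableaux μ) (shiftedYoungTableaux ν)
  ShiftedYoungTableau.weight ShiftedYoungTableau.weight
  (λ t≡ k → cong (λ t → content t k) t≡) (λ t≡ k → cong (λ t → content t k) t≡)
  (Q μ) (Q ν) (Q-sum μ) (Q-sum ν)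

-- For shapes of odd length, where the second quotient carries the even types.
young-product-swapped : ∀ μ ν → PairSum ν μ (Q μ ⊛ Q ν)
young-product-swapped μ ν = WeightedBijection.transport swapped (young-product μ ν)
  where
  swapped : WeightedBijection (youngPairs ν μ) (youngPairs μ ν) pairWeight pairWeight
  swapped = record
    { to = swap ; from = swap ; to-cong = swap ; from-cong = swap
    ; to-from = λ _ → refl , refl ; from-to = λ _ → refl , refl
    ; weight-to = λ (t , u) k → ℕ.+-comm (ShiftedYoungTableau.weight u k) _
    ; weight-from = λ (t , u) k → ℕ.+-comm (ShiftedYoungTableau.weight u k) _
    }

theorem3p2 : ∀ (sh μ ν : List ℕ) → ShiftedPavable sh → twoQuotient sh ≡ (μ , ν) →
    Sum (shiftedDominoTableaux sh) ShiftedDominoTableau.weight (Q μ ⊛ Q ν)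
theorem3p2 sh μ ν shifted two≡ = cases (bit-cases ℓ)
  where
  open Shape sh shifted
  open ShiftedPavable shifted using (quotient₁; quotient₂)

  μ≡ : μ ≡ quotient 0 sh
  μ≡ = cong proj₁ (trans (sym two≡) (twoQuotient≡ sh))
  ν≡ : ν ≡ quotient 1 sh
  ν≡ = cong proj₂ (trans (sym two≡) (twoQuotient≡ sh))

  long-μ : LastPart≥Length μ
  long-μ = subst LastPart≥Length (cong proj₁ two≡) quotient₁
  long-ν : LastPart≥Length ν
  long-ν = subst LastPart≥Length (cong proj₂ two≡) quotient₂

  bit-suc≡ : ∀ {b c} → bit ℓ ≡ b → b + c ≡ 1 → c ≡ bit (suc ℓ)
  bit-suc≡ {b} eq s = ℕ.+-cancelˡ-≡ b _ _ (trans s (trans (sym (bit-suc ℓ))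
    (trans (ℕ.+-comm (bit (suc ℓ)) (bit ℓ)) (cong (_+ bit (suc ℓ)) eq))))

  result : ∀ {A′ B′ F} → A′ ≡ A.q → B′ ≡ B.q → LastPart≥Length A′ → LastPart≥Length B′ →
           PairSum A′ B′ F → Sum (shiftedDominoTableaux sh) ShiftedDominoTableau.weight F
  result refl refl long-A long-B = WeightedBijection.transport
    (Correspondence.bijection sh A.q B.q m (proj₁ bound) lower (upper long-A long-B) lower-A lower-B (proj₂ bound))

  -- When the length is odd the two quotients exchange their roles.
  cases : bit ℓ ≡ 0 ⊎ bit ℓ ≡ 1 → Sum (shiftedDominoTableaux sh) ShiftedDominoTableau.weight (Q μ ⊛ Q ν)
  cases (inj₁ even) = result
    (trans μ≡ (cong (λ p → quotient p sh) (sym even)))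
    (trans ν≡ (cong (λ p → quotient p sh) (bit-suc≡ even refl)))
    long-μ long-ν (young-product μ ν)
  cases (inj₂ odd) = result
    (trans ν≡ (cong (λ p → quotient p sh) (sym odd)))
    (trans μ≡ (cong (λ p → quotient p sh) (bit-suc≡ odd refl)))
    long-ν long-μ (young-product-swapped μ ν)
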